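{- For $1\le i\le k$, let $\mathbf{v}_i\in\mathbb{Q}(t)^n$, and for every positive integer $t$ at which all the $\mathbf{v}_i$ are defined (in particular for all sufficiently large $t$) let $R(t)\subset\mathbb{R}^n$ be the convex hull of $\mathbf{v}_1(t),\ldots,\mathbf{v}_k(t)$. Then there exists a positive integer $d$ such that for each residue class modulo $d$ there exist an integer $z\ge 0$ and $\mathbf{w}_1,\ldots,\mathbf{w}_z\in\mathbb{Q}[t]^n$ such that for all sufficiently large $t$ in that residue class, the convex hull of the set $R(t)\cap\mathbb{Z}^n$ of lattice points in $R(t)$ has vertices $\mathbf{w}_1(t),\ldots,\mathbf{w}_z(t)$.
   Context: $t$ ranges over positive integers, and $\mathbb{Q}(t)$ is the field of rational functions in $t$. The number $z$ and the vectors $\mathbf{w}_j$ may depend on the residue class, and $z=0$ is allowed (when there are no lattice points). -}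

module Defs where

open import Level using (0ℓ)
open import Data.Nat as ℕ using (ℕ; zero; suc)
import Data.Nat.Properties as ℕ
open import Data.Integer as ℤ using (ℤ; +_)
open import Data.Rational
open import Data.Rational.Properties
open import Data.Rational.Solver using (module +-*-Solver)
open import Data.Fin using (Fin)
open import Data.List using (List; []; _∷_; map)
open import Data.Product using (Σ-syntax; ∃-syntax; _×_; _,_)
open import Data.Vec.Functional using (Vector; foldr)
open import Function using (_⇔_)
open import Relation.Binary.PropositionalEquality
  using (_≡_; _≢_; refl; sym; trans; cong; cong₂; subst)
open import Relation.Nullary using (¬_)
open import Relation.Unary using (Pred; _∈_)

-- Real numbers: Cauchy sequences of rationals, compared by _≈ᴿ_.

IsCauchy : (ℕ → ℚ) → Set
IsCauchy x = ∀ ε → 0ℚ < ε →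
  ∃[ N ] ∀ m n → N ℕ.≤ m → N ℕ.≤ n → ∣ x m - x n ∣ < ε

record ℝ : Set where
  constructor mkℝ
  field
    seq    : ℕ → ℚ
    cauchy : IsCauchy seq

open ℝ public

infix 4 _≈ᴿ_ _≤ᴿ_ _<ᴿ_

_≈ᴿ_ : ℝ → ℝ → Set
x ≈ᴿ y = ∀ ε → 0ℚ < ε → ∃[ N ] ∀ n → N ℕ.≤ n → ∣ seq x n - seq y n ∣ < ε

_≤ᴿ_ : ℝ → ℝ → Set
x ≤ᴿ y = ∀ ε → 0ℚ < ε → ∃[ N ] ∀ n → N ℕ.≤ n → seq x n < seq y n + ε

_<ᴿ_ : ℝ → ℝ → Set
x <ᴿ y = ∃[ ε ] 0ℚ < ε × (∃[ N ] ∀ n → N ℕ.≤ n → seq x n + ε < seq y n)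

private
  halve : ∀ ε → ½ * ε + ½ * ε ≡ ε
  halve = solve 1 (λ e → con ½ :* e :+ con ½ :* e := e) refl
    where open +-*-Solver

  half-pos : ∀ {ε} → 0ℚ < ε → 0ℚ < ½ * ε
  half-pos {ε} 0<ε = subst (_< ½ * ε) (*-zeroʳ ½) (*-monoʳ-<-pos ½ 0<ε)

  ⊔-≤ˡ : ∀ {a b n} → a ℕ.⊔ b ℕ.≤ n → a ℕ.≤ n
  ⊔-≤ˡ {a} {b} = ℕ.≤-trans (ℕ.m≤m⊔n a b)

  ⊔-≤ʳ : ∀ {a b n} → a ℕ.⊔ b ℕ.≤ n → b ℕ.≤ n
  ⊔-≤ʳ {a} {b} = ℕ.≤-trans (ℕ.m≤n⊔m a b)

  const-cauchy : ∀ q → IsCauchy (λ _ → q)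
  const-cauchy q ε 0<ε =
    0 , λ _ _ _ _ → subst (_< ε) (sym (cong ∣_∣ (+-inverseʳ q))) 0<ε

  +-cauchy : ∀ {x y} → IsCauchy x → IsCauchy y → IsCauchy (λ n → x n + y n)
  +-cauchy {x} {y} cx cy ε 0<ε
    with cx (½ * ε) (half-pos 0<ε) | cy (½ * ε) (half-pos 0<ε)
  ... | M , hx | N , hy = M ℕ.⊔ N , λ m n M⊔N≤m M⊔N≤n → begin-strict
      ∣ (x m + y m) - (x n + y n) ∣
        ≡⟨ cong ∣_∣ (rearrange (x m) (y m) (x n) (y n)) ⟩
      ∣ (x m - x n) + (y m - y n) ∣
        ≤⟨ ∣p+q∣≤∣p∣+∣q∣ (x m - x n) (y m - y n) ⟩
      ∣ x m - x n ∣ + ∣ y m - y n ∣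
        <⟨ +-mono-< (hx m n (⊔-≤ˡ {M} {N} M⊔N≤m) (⊔-≤ˡ {M} {N} M⊔N≤n))
                    (hy m n (⊔-≤ʳ {M} {N} M⊔N≤m) (⊔-≤ʳ {M} {N} M⊔N≤n)) ⟩
      ½ * ε + ½ * ε
        ≡⟨ halve ε ⟩
      ε ∎
    where
    open ≤-Reasoning
    rearrange : ∀ a b c d → (a + b) - (c + d) ≡ (a - c) + (b - d)
    rearrange = solve 4 (λ a b c d →
      (a :+ b) :- (c :+ d) := (a :- c) :+ (b :- d)) refl
      where open +-*-Solver

  bounded : ∀ {x} → IsCauchy x →
    ∃[ B ] 0ℚ < B × (∃[ N ] ∀ n → N ℕ.≤ n → ∣ x n ∣ ≤ B)
  bounded {x} cx with cx 1ℚ (positive⁻¹ 1ℚ)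
  ... | N , h = 1ℚ + ∣ x N ∣ , +-mono-<-≤ (positive⁻¹ 1ℚ) (0≤∣p∣ (x N)) , N ,
    λ n N≤n → begin
      ∣ x n ∣                     ≡⟨ cong ∣_∣ (split (x n) (x N)) ⟩
      ∣ (x n - x N) + x N ∣       ≤⟨ ∣p+q∣≤∣p∣+∣q∣ (x n - x N) (x N) ⟩
      ∣ x n - x N ∣ + ∣ x N ∣     ≤⟨ +-monoˡ-≤ ∣ x N ∣ (<⇒≤ (h n N N≤n ℕ.≤-refl)) ⟩
      1ℚ + ∣ x N ∣                ∎
    where
    open ≤-Reasoning
    split : ∀ a b → a ≡ (a - b) + b
    split = solve 2 (λ a b → a := (a :- b) :+ b) refl
      where open +-*-Solver

  shrink : ∀ {B ε} → 0ℚ < B → 0ℚ < ε → ∃[ δ ] 0ℚ < δ × B * δ ≡ ε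
  shrink {B} {ε} 0<B 0<ε = δ , 0<δ , Bδ≡ε
    where
    instance
      B-pos : Positive B
      B-pos = positive 0<B
      B-nz : NonZero B
      B-nz = pos⇒nonZero B
      1/B-pos : Positive (1/ B)
      1/B-pos = 1/pos⇒pos B
    δ : ℚ
    δ = 1/ B * ε
    0<δ : 0ℚ < δ
    0<δ = subst (_< δ) (*-zeroʳ (1/ B)) (*-monoʳ-<-pos (1/ B) 0<ε)
    Bδ≡ε : B * δ ≡ ε
    Bδ≡ε = trans (sym (*-assoc B (1/ B) ε))
          (trans (cong (_* ε) (*-inverseʳ B)) (*-identityˡ ε))

  ∣*∣-< : ∀ {a b B δ} → 0ℚ < B → ∣ a ∣ ≤ B → ∣ b ∣ < δ → ∣ a * b ∣ < B * δ
  ∣*∣-< {a} {b} {B} {δ} 0<B ∣a∣≤B ∣b∣<δ = begin-strict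
    ∣ a * b ∣      ≡⟨ ∣p*q∣≡∣p∣*∣q∣ a b ⟩
    ∣ a ∣ * ∣ b ∣  ≤⟨ *-monoʳ-≤-nonNeg ∣ b ∣ {{∣-∣-nonNeg b}} ∣a∣≤B ⟩
    B * ∣ b ∣      <⟨ *-monoʳ-<-pos B {{positive 0<B}} ∣b∣<δ ⟩
    B * δ          ∎
    where open ≤-Reasoning

  *-diff-< : ∀ a b c d {B C δ η} → 0ℚ < B → 0ℚ < C → ∣ a ∣ ≤ B → ∣ d ∣ ≤ C →
    ∣ b - d ∣ < δ → ∣ a - c ∣ < η → ∣ a * b - c * d ∣ < B * δ + C * η
  *-diff-< a b c d {B} {C} {δ} {η} 0<B 0<C ∣a∣≤B ∣d∣≤C b-d a-c =
    subst (_< B * δ + C * η) (cong ∣_∣ (sym (rearrange a b c d)))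
      (≤-<-trans (∣p+q∣≤∣p∣+∣q∣ (a * (b - d)) (d * (a - c)))
        (+-mono-< {∣ a * (b - d) ∣} {B * δ} {∣ d * (a - c) ∣} {C * η}
          (∣*∣-< {a} {b - d} {B} {δ} 0<B ∣a∣≤B b-d)
          (∣*∣-< {d} {a - c} {C} {η} 0<C ∣d∣≤C a-c)))
    where
    rearrange : ∀ a b c d → a * b - c * d ≡ a * (b - d) + d * (a - c)
    rearrange = solve 4 (λ a b c d →
      a :* b :- c :* d := a :* (b :- d) :+ d :* (a :- c)) refl
      where open +-*-Solver

  *-cauchy : ∀ {x y} → IsCauchy x → IsCauchy y → IsCauchy (λ n → x n * y n)
  *-cauchy {x} {y} cx cy ε 0<ε =
    let B , 0<B , K , hB = bounded {x} cx
        C , 0<C , L , hC = bounded {y} cy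
        δ , 0<δ , Bδ = shrink {B} {½ * ε} 0<B (half-pos {ε} 0<ε)
        η , 0<η , Cη = shrink {C} {½ * ε} 0<C (half-pos {ε} 0<ε)
        M , hy = cy δ 0<δ
        N , hx = cx η 0<η
    in (K ℕ.⊔ L) ℕ.⊔ (M ℕ.⊔ N) , λ m n p q →
      let p₁ = ⊔-≤ˡ {K ℕ.⊔ L} {M ℕ.⊔ N} p
          q₁ = ⊔-≤ˡ {K ℕ.⊔ L} {M ℕ.⊔ N} q
          p₂ = ⊔-≤ʳ {K ℕ.⊔ L} {M ℕ.⊔ N} p
          q₂ = ⊔-≤ʳ {K ℕ.⊔ L} {M ℕ.⊔ N} q
      in subst (∣ x m * y m - x n * y n ∣ <_)
           (trans (cong₂ _+_ Bδ Cη) (halve ε))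
           (*-diff-< (x m) (y m) (x n) (y n) {B} {C} {δ} {η} 0<B 0<C
             (hB m (⊔-≤ˡ {K} {L} p₁)) (hC n (⊔-≤ʳ {K} {L} q₁))
             (hy m n (⊔-≤ˡ {M} {N} p₂) (⊔-≤ˡ {M} {N} q₂))
             (hx m n (⊔-≤ʳ {M} {N} p₂) (⊔-≤ʳ {M} {N} q₂)))

infixl 6 _+ᴿ_
infixl 7 _*ᴿ_

ι : ℚ → ℝ
ι q = mkℝ (λ _ → q) (const-cauchy q)

_+ᴿ_ : ℝ → ℝ → ℝ
x +ᴿ y = mkℝ (λ n → seq x n + seq y n) (+-cauchy {seq x} {seq y} (cauchy x) (cauchy y))

_*ᴿ_ : ℝ → ℝ → ℝ
x *ᴿ y = mkℝ (λ n → seq x n * seq y n) (*-cauchy {seq x} {seq y} (cauchy x) (cauchy y))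

0ᴿ 1ᴿ : ℝ
0ᴿ = ι 0ℚ
1ᴿ = ι 1ℚ

sumᴿ : ∀ {m} → Vector ℝ m → ℝ
sumᴿ = foldr _+ᴿ_ 0ᴿ

Point : ℕ → Set
Point n = Vector ℝ n

infix 4 _≋_

_≋_ : ∀ {n} → Point n → Point n → Set
x ≋ y = ∀ c → x c ≈ᴿ y c

conv : ∀ {n} → Pred (Point n) 0ℓ → Pred (Point n) 0ℓ
conv {n} S x =
  ∃[ m ] Σ[ y ∈ Vector (Point n) m ] Σ[ a ∈ Vector ℝ m ]
    (∀ i → y i ∈ S) ×
    (∀ i → 0ᴿ ≤ᴿ a i) ×
    sumᴿ a ≈ᴿ 1ᴿ ×
    x ≋ (λ c → sumᴿ (λ i → a i *ᴿ y i c))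

-- Vertices are extreme points: p is not a proper convex combination of two
-- distinct points of C.
IsVertex : ∀ {n} → Pred (Point n) 0ℓ → Point n → Set
IsVertex {n} C p =
  p ∈ C ×
  (∀ (x y : Point n) (a b : ℝ) → x ∈ C → y ∈ C →
     0ᴿ <ᴿ a → 0ᴿ <ᴿ b → a +ᴿ b ≈ᴿ 1ᴿ →
     p ≋ (λ c → a *ᴿ x c +ᴿ b *ᴿ y c) → x ≋ y)

-- The vertices of C are w 0, …, w (z - 1), listed without repetition.
HasVertices : ∀ {n z} → Pred (Point n) 0ℓ → Vector (Point n) z → Set
HasVertices C w =
  (∀ p → IsVertex C p ⇔ (∃[ j ] p ≋ w j)) ×
  (∀ i j → w i ≋ w j → i ≡ j)

Lattice : ∀ n → Pred (Point n) 0ℓ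
Lattice n x = Σ[ u ∈ Vector ℤ n ] x ≋ (λ c → ι (u c / 1))

-- ℚ[t]: coefficient lists, constant term first, trailing zeros allowed.

ℚ[t] : Set
ℚ[t] = List ℚ

coeff : ℚ[t] → ℕ → ℚ
coeff []      _       = 0ℚ
coeff (a ∷ _) zero    = a
coeff (_ ∷ p) (suc i) = coeff p i

infix 4 _≈ᴾ_ _∣ᴾ_

_≈ᴾ_ : ℚ[t] → ℚ[t] → Set
p ≈ᴾ q = ∀ i → coeff p i ≡ coeff q i

0ᴾ 1ᴾ : ℚ[t]
0ᴾ = []
1ᴾ = 1ℚ ∷ []

infixl 6 _+ᴾ_
infixl 7 _*ᴾ_

_+ᴾ_ : ℚ[t] → ℚ[t] → ℚ[t]
[]      +ᴾ q       = q
(a ∷ p) +ᴾ []      = a ∷ p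
(a ∷ p) +ᴾ (b ∷ q) = a + b ∷ p +ᴾ q

_*ᴾ_ : ℚ[t] → ℚ[t] → ℚ[t]
[]      *ᴾ q = []
(a ∷ p) *ᴾ q = map (a *_) q +ᴾ (0ℚ ∷ p *ᴾ q)

_∣ᴾ_ : ℚ[t] → ℚ[t] → Set
g ∣ᴾ p = ∃[ h ] g *ᴾ h ≈ᴾ p

eval : ℚ[t] → ℕ → ℚ
eval []      t = 0ℚ
eval (a ∷ p) t = a + (+ t / 1) * eval p t

-- ℚ(t): fractions in lowest terms, so that the poles are exactly the
-- zeros of the denominator.

record ℚ⟨t⟩ : Set where
  field
    num     : ℚ[t]
    den     : ℚ[t]
    den≉0   : ¬ den ≈ᴾ 0ᴾ
    coprime : ∀ g → g ∣ᴾ num → g ∣ᴾ den → g ∣ᴾ 1ᴾ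

open ℚ⟨t⟩ public

DefinedAt : ℕ → ℚ⟨t⟩ → Set
DefinedAt t f = eval (den f) t ≢ 0ℚ

value : ∀ t (f : ℚ⟨t⟩) → DefinedAt t f → ℚ
value t f d = _÷_ (eval (num f) t) (eval (den f) t) {{≢-nonZero d}}

AllDefinedAt : ∀ {k n} → ℕ → Vector (Vector ℚ⟨t⟩ n) k → Set
AllDefinedAt t v = ∀ i c → DefinedAt t (v i c)

R : ∀ {k n} (v : Vector (Vector ℚ⟨t⟩ n) k) (t : ℕ) → AllDefinedAt t v →
    Pred (Point n) 0ℓ
R v t d = conv (λ x → ∃[ i ] x ≋ (λ c → ι (value t (v i c) (d i c))))

evalPoint : ∀ {n} → Vector ℚ[t] n → ℕ → Point n
evalPoint w t c = ι (eval (w c) t)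

{-# OPTIONS --safe #-}

-- Scale v i to an integral polynomial vector (q , q v i); a lattice point u lies in R(t) iff (1 , u)
-- lies in the cone spanned by these vectors. Double description, with the eventual sign of a polynomial
-- deciding every comparison, describes this cone by finitely many polynomial inequalities. Since
-- |u c| ≤ t ^ D, write u c + t ^ D in base t: an inequality Σ ℓ k t ^ k ≥ 0 between digits becomes,
-- after guessing the bounded carries, a positive Boolean combination of linear inequalities with
-- constant coefficients in t and the digits, so that the pairs (t , digits) form a semilinear set. A
-- piece p + ℕ h₁ + … + ℕ hₘ of it, with all h i of the same height L in the direction of t, has as its
-- slice at t = height p + q L the dilated simplex with vertices p + q h i, whose coordinates are
-- polynomial in t on the residue class of t mod L. The polynomial points so obtained span the hull of
-- the lattice points in R(t), and the redundant ones can be discarded uniformly in t by double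
-- description once more.
--
-- Over the reals an extreme point p = Σ a i y i with a i > ρ > 0 equals y i, and a listed point is
-- extreme because a rational functional separates it from the others.
module Submission where

-- The obstacle is that the facet normals of R(t) vary with t, so that no fixed system of linear
-- inequalities describes the coordinates u. In base-t digits the coefficients become constants, and
-- t itself is one of the variables: a single semilinear set holds the slices for all t at once. The
-- return map from digits to u has coefficients polynomial in t but is linear for each fixed t; it
-- therefore respects convex hulls and sends polynomial vertices to polynomial vertices. Digits lie
-- between 0 and t, which keeps the slices bounded and excludes nonzero generators of height 0.
--
-- All geometry is done over the integers in homogeneous coordinates, where cones replace hulls and
-- comparisons are decidable. The reals are Cauchy sequences without a decidable order, so real
-- points are handled through rational affine functionals: what is shown of their values is that a
-- sequence tends to 0 or is asymptotically nonnegative.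

-- Integer vectors, integer polynomials and eventual signs.

module IntegersAndPolynomials where

  open import Data.Nat as ℕ using (ℕ; zero; suc)
  import Data.Nat.Properties as ℕ
  open import Data.Integer hiding (suc; pred; sign)
  open import Data.Integer.Properties
  open import Data.Integer.Tactic.RingSolver using (solve-∀)
  open import Data.Fin using (Fin; zero; suc)
  open import Data.List using (List; []; _∷_; map)
  open import Data.List.Relation.Unary.All using (All; []; _∷_)
  open import Data.Product using (∃-syntax; _×_; _,_)
  open import Function using (_∘_)
  open import Relation.Binary.PropositionalEquality
  open import Relation.Binary using (tri<; tri≈; tri>)
  open import Algebra.Properties.Semiring.Sum +-*-semiring public
    using (sum; sum-cong-≗; *-distribˡ-sum; *-distribʳ-sum; ∑-distrib-+; ∑-comm; sum-replicate-zero)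

  +-nonneg : ∀ {a b} → 0ℤ ≤ a → 0ℤ ≤ b → 0ℤ ≤ a + b
  +-nonneg = +-mono-≤

  *-nonneg : ∀ {a b} → 0ℤ ≤ a → 0ℤ ≤ b → 0ℤ ≤ a * b
  *-nonneg {a} {b} p q = subst (_≤ a * b) (*-zeroʳ a) (*-monoˡ-≤-nonNeg a {{nonNegative p}} q)

  *-pos : ∀ {a b} → 0ℤ < a → 0ℤ < b → 0ℤ < a * b
  *-pos {a} {b} p q = subst (_< a * b) (*-zeroʳ a) (*-monoˡ-<-pos a {{positive p}} q)

  +-pos-nonneg : ∀ {a b} → 0ℤ < a → 0ℤ ≤ b → 0ℤ < a + b
  +-pos-nonneg = +-mono-<-≤

  *-nonneg⁻¹ : ∀ {a b} → 0ℤ < a → 0ℤ ≤ a * b → 0ℤ ≤ b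
  *-nonneg⁻¹ {a} {b} p q = *-cancelˡ-≤-pos 0ℤ b a {{positive p}} (subst (_≤ a * b) (sym (*-zeroʳ a)) q)

  *-pos⁻¹ : ∀ {a b} → 0ℤ ≤ a → 0ℤ < a * b → 0ℤ < b
  *-pos⁻¹ {a} {b} p q = *-cancelˡ-<-nonNeg a {{nonNegative p}} (subst (_< a * b) (sym (*-zeroʳ a)) q)

  diff-≤ : ∀ {a b} → 0ℤ ≤ b - a → a ≤ b
  diff-≤ {a} {b} p = 0≤i-j⇒j≤i p

  ≤-diff : ∀ {a b} → a ≤ b → 0ℤ ≤ b - a
  ≤-diff = i≤j⇒0≤j-i

  <-diff : ∀ {a b} → a < b → 0ℤ < b - a
  <-diff {a} {b} p = subst (_< b - a) (+-inverseʳ a) (+-monoˡ-< (- a) p)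

  <⇒1≤ : ∀ {a} → 0ℤ < a → 1ℤ ≤ a
  <⇒1≤ = i<j⇒suc[i]≤j

  neg-pos : ∀ {a} → a < 0ℤ → 0ℤ < - a
  neg-pos = neg-mono-<

  i≤∣i∣ : ∀ i → i ≤ + ∣ i ∣
  i≤∣i∣ (+ n)    = ≤-refl
  i≤∣i∣ -[1+ n ] = -≤+

  sum-nonneg : ∀ {m} (f : Fin m → ℤ) → (∀ i → 0ℤ ≤ f i) → 0ℤ ≤ sum f
  sum-nonneg {zero}  f h = ≤-refl
  sum-nonneg {suc m} f h = +-nonneg (h zero) (sum-nonneg (f ∘ suc) (h ∘ suc))

  -- Vectors and pairings

  Vℤ : ℕ → Set
  Vℤ m = Fin m → ℤ

  dot : ∀ {m} → Vℤ m → Vℤ m → ℤ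
  dot f x = sum (λ i → f i * x i)

  dot-congˡ : ∀ {m} {f g : Vℤ m} x → f ≗ g → dot f x ≡ dot g x
  dot-congˡ x p = sum-cong-≗ (λ i → cong (_* x i) (p i))

  dot-congʳ : ∀ {m} (f : Vℤ m) {x y} → x ≗ y → dot f x ≡ dot f y
  dot-congʳ f p = sum-cong-≗ (λ i → cong (f i *_) (p i))

  dot-0 : ∀ {m} (f : Vℤ m) {x} → (∀ i → x i ≡ 0ℤ) → dot f x ≡ 0ℤ
  dot-0 {m} f x≡0 = trans (sum-cong-≗ (λ i → trans (cong (f i *_) (x≡0 i)) (*-zeroʳ (f i)))) (sum-replicate-zero m)

  dot-comm : ∀ {m} (f x : Vℤ m) → dot f x ≡ dot x f
  dot-comm f x = sum-cong-≗ (λ i → *-comm (f i) (x i))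

  dot-+ : ∀ {m} (f x y : Vℤ m) → dot f (λ i → x i + y i) ≡ dot f x + dot f y
  dot-+ f x y = trans (sum-cong-≗ (λ i → *-distribˡ-+ (f i) (x i) (y i)))
                      (∑-distrib-+ (λ i → f i * x i) (λ i → f i * y i))

  dot-* : ∀ {m} (f : Vℤ m) a x → dot f (λ i → a * x i) ≡ a * dot f x
  dot-* f a x = trans (sum-cong-≗ (λ i → swap (f i) a (x i)))
                      (sym (*-distribˡ-sum a (λ i → f i * x i)))
    where
    swap : ∀ p q r → p * (q * r) ≡ q * (p * r)
    swap = solve-∀

  dot-lin : ∀ {m} (f : Vℤ m) a x b y → dot f (λ i → a * x i + b * y i) ≡ a * dot f x + b * dot f y
  dot-lin f a x b y = trans (dot-+ f (λ i → a * x i) (λ i → b * y i)) (cong₂ _+_ (dot-* f a x) (dot-* f b y))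

  dot-lin′ : ∀ {m} (x : Vℤ m) a f b g → dot (λ i → a * f i + b * g i) x ≡ a * dot f x + b * dot g x
  dot-lin′ x a f b g = begin
    dot (λ i → a * f i + b * g i) x  ≡⟨ dot-comm _ x ⟩
    dot x (λ i → a * f i + b * g i)  ≡⟨ dot-lin x a f b g ⟩
    a * dot x f + b * dot x g        ≡⟨ cong₂ (λ u v → a * u + b * v) (dot-comm x f) (dot-comm x g) ⟩
    a * dot f x + b * dot g x        ∎
    where open ≡-Reasoning

  dot-sum : ∀ {m k} (f : Vℤ m) (a : Vℤ k) (x : Fin k → Vℤ m) →
    dot f (λ c → sum (λ i → a i * x i c)) ≡ sum (λ i → a i * dot f (x i))
  dot-sum {k = k} f a x = begin
    sum (λ c → f c * sum (λ i → a i * x i c))    ≡⟨ sum-cong-≗ (λ c → *-distribˡ-sum (f c) (λ i → a i * x i c)) ⟩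
    sum (λ c → sum (λ i → f c * (a i * x i c)))  ≡⟨ ∑-comm (λ c i → f c * (a i * x i c)) ⟩
    sum (λ i → sum (λ c → f c * (a i * x i c)))  ≡⟨ sum-cong-≗ (λ i → dot-* f (a i) (x i)) ⟩
    sum (λ i → a i * dot f (x i))                ∎
    where open ≡-Reasoning

  e : ∀ {m} → Fin m → Vℤ m
  e zero    zero    = 1ℤ
  e zero    (suc j) = 0ℤ
  e (suc i) zero    = 0ℤ
  e (suc i) (suc j) = e i j

  e-sym : ∀ {k} (i j : Fin k) → e i j ≡ e j i
  e-sym zero    zero    = refl
  e-sym zero    (suc j) = refl
  e-sym (suc i) zero    = refl
  e-sym (suc i) (suc j) = e-sym i j

  dot-e : ∀ {m} (i : Fin m) x → dot (e i) x ≡ x i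
  dot-e {suc m} zero x = begin
    1ℤ * x zero + sum {m} (λ j → 0ℤ * x (suc j))  ≡⟨ cong₂ _+_ (*-identityˡ (x zero)) (sum-replicate-zero m) ⟩
    x zero + 0ℤ                                   ≡⟨ +-identityʳ (x zero) ⟩
    x zero                                        ∎
    where open ≡-Reasoning
  dot-e {suc m} (suc i) x = trans (+-identityˡ _) (dot-e i (x ∘ suc))

  -- Integer polynomials in t

  Poly : Set
  Poly = List ℤ

  ev : Poly → ℕ → ℤ
  ev []      t = 0ℤ
  ev (a ∷ p) t = a + + t * ev p t

  infixl 6 _⊕_
  infixl 7 _⊙_ _⊗_

  _⊕_ : Poly → Poly → Poly
  []      ⊕ q       = q
  (a ∷ p) ⊕ []      = a ∷ p
  (a ∷ p) ⊕ (b ∷ q) = a + b ∷ p ⊕ q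

  _⊙_ : ℤ → Poly → Poly
  a ⊙ p = map (a *_) p

  _⊗_ : Poly → Poly → Poly
  []      ⊗ q = []
  (a ∷ p) ⊗ q = (a ⊙ q) ⊕ (0ℤ ∷ p ⊗ q)

  K : ℤ → Poly
  K a = a ∷ []

  ev-K : ∀ a t → ev (K a) t ≡ a
  ev-K a t = trans (cong (λ z → a + z) (*-zeroʳ (+ t))) (+-identityʳ a)

  ev-⊕ : ∀ p q t → ev (p ⊕ q) t ≡ ev p t + ev q t
  ev-⊕ []      q       t = sym (+-identityˡ _)
  ev-⊕ (a ∷ p) []      t = sym (+-identityʳ _)
  ev-⊕ (a ∷ p) (b ∷ q) t =
    trans (cong (λ z → a + b + + t * z) (ev-⊕ p q t)) (arrange a b (+ t) (ev p t) (ev q t))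
    where
    arrange : ∀ a b t x y → a + b + t * (x + y) ≡ (a + t * x) + (b + t * y)
    arrange = solve-∀

  ev-⊙ : ∀ a p t → ev (a ⊙ p) t ≡ a * ev p t
  ev-⊙ a []      t = sym (*-zeroʳ a)
  ev-⊙ a (b ∷ p) t = trans (cong (λ z → a * b + + t * z) (ev-⊙ a p t)) (arrange a b (+ t) (ev p t))
    where
    arrange : ∀ a b t x → a * b + t * (a * x) ≡ a * (b + t * x)
    arrange = solve-∀

  ev-⊗ : ∀ p q t → ev (p ⊗ q) t ≡ ev p t * ev q t
  ev-⊗ []      q t = refl
  ev-⊗ (a ∷ p) q t = begin
    ev ((a ⊙ q) ⊕ (0ℤ ∷ p ⊗ q)) t               ≡⟨ ev-⊕ (a ⊙ q) (0ℤ ∷ p ⊗ q) t ⟩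
    ev (a ⊙ q) t + (0ℤ + + t * ev (p ⊗ q) t)    ≡⟨ cong₂ (λ x y → x + (0ℤ + + t * y)) (ev-⊙ a q t) (ev-⊗ p q t) ⟩
    a * ev q t + (0ℤ + + t * (ev p t * ev q t)) ≡⟨ arrange a (+ t) (ev p t) (ev q t) ⟩
    (a + + t * ev p t) * ev q t                 ∎
    where
    open ≡-Reasoning
    arrange : ∀ a t x y → a * y + (0ℤ + t * (x * y)) ≡ (a + t * x) * y
    arrange = solve-∀

  ΣP : ∀ {m} → (Fin m → Poly) → Poly
  ΣP {zero}  f = []
  ΣP {suc m} f = f zero ⊕ ΣP (f ∘ suc)

  ev-ΣP : ∀ {m} (f : Fin m → Poly) t → ev (ΣP f) t ≡ sum (λ i → ev (f i) t)
  ev-ΣP {zero}  f t = refl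
  ev-ΣP {suc m} f t = trans (ev-⊕ (f zero) (ΣP (f ∘ suc)) t) (cong (λ z → ev (f zero) t + z) (ev-ΣP (f ∘ suc) t))

  dotP : ∀ {m} → (Fin m → Poly) → (Fin m → Poly) → Poly
  dotP f g = ΣP (λ i → f i ⊗ g i)

  evs : ∀ {m} → (Fin m → Poly) → ℕ → Vℤ m
  evs f t i = ev (f i) t

  ev-dotP : ∀ {m} (f g : Fin m → Poly) t → ev (dotP f g) t ≡ dot (evs f t) (evs g t)
  ev-dotP f g t = trans (ev-ΣP (λ i → f i ⊗ g i) t) (sum-cong-≗ (λ i → ev-⊗ (f i) (g i) t))

  -- Eventual sign of a polynomial

  Eventually : (ℕ → Set) → Set
  Eventually P = ∃[ T ] ∀ t → T ℕ.≤ t → P t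

  _∧ᴱ_ : ∀ {P Q : ℕ → Set} → Eventually P → Eventually Q → Eventually (λ t → P t × Q t)
  (S , f) ∧ᴱ (T , g) = S ℕ.⊔ T , λ t h →
    f t (ℕ.≤-trans (ℕ.m≤m⊔n S T) h) , g t (ℕ.≤-trans (ℕ.m≤n⊔m S T) h)

  mapᴱ : ∀ {P Q : ℕ → Set} → (∀ t → P t → Q t) → Eventually P → Eventually Q
  mapᴱ f (T , g) = T , λ t h → f t (g t h)

  pureᴱ : ∀ {P : ℕ → Set} → (∀ t → P t) → Eventually P
  pureᴱ f = 0 , λ t _ → f t

  allFinᴱ : ∀ {k} {P : Fin k → ℕ → Set} → (∀ i → Eventually (P i)) → Eventually (λ t → ∀ i → P i t)
  allFinᴱ {zero}  f = 0 , λ t _ ()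
  allFinᴱ {suc k} f = mapᴱ (λ { t (p , q) zero → p ; t (p , q) (suc i) → q i }) (f zero ∧ᴱ allFinᴱ (f ∘ suc))

  ev-zero : ∀ {p} → All (_≡ 0ℤ) p → ∀ t → ev p t ≡ 0ℤ
  ev-zero []         t = refl
  ev-zero (refl ∷ h) t = trans (+-identityˡ _) (trans (cong (+ t *_) (ev-zero h t)) (*-zeroʳ (+ t)))

  large : ∀ a → Eventually (λ t → 0ℤ < a + + t)
  large a = suc ∣ a ∣ , λ t h → <-≤-trans (lem a)
      (+-monoʳ-≤ a (+≤+ h))
    where
    lem : ∀ a → 0ℤ < a + + suc ∣ a ∣
    lem (+ n)    = +<+ (subst (0 ℕ.<_) (sym (ℕ.+-suc n n)) ℕ.z<s)
    lem -[1+ n ] = subst (0ℤ <_) (sym (trans (arrange (+ suc n)) refl)) (+<+ ℕ.z<s)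
      where
      arrange : ∀ x → - x + (1ℤ + x) ≡ 1ℤ
      arrange = solve-∀

  -- A positive integer value of `p` is at least 1, so `a + t * ev p t` is at least `a + t`.
  large-* : ∀ a {p} → Eventually (λ t → 0ℤ < ev p t) → Eventually (λ t → 0ℤ < ev (a ∷ p) t)
  large-* a {p} pos = mapᴱ (λ t (h , l) → <-≤-trans l
      (+-monoʳ-≤ a (subst (_≤ + t * ev p t) (*-identityʳ (+ t))
        (*-monoˡ-≤-nonNeg (+ t) (<⇒1≤ h)))))
    (pos ∧ᴱ large a)

  ev-neg : ∀ p t → ev (-1ℤ ⊙ p) t ≡ - ev p t
  ev-neg p t = trans (ev-⊙ -1ℤ p t) (-1*i≡-i (ev p t))

  -- `zer` asserts that all coefficients vanish: the value is then 0 at every `t`, and a denominator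
  -- with this verdict is the zero polynomial. `neg₋` is phrased with a negation to match the form
  -- in which elimination consumes negative rows.
  data Sign (p : Poly) : Set where
    zer : All (_≡ 0ℤ) p → Sign p
    pos₊ : Eventually (λ t → 0ℤ < ev p t) → Sign p
    neg₋ : Eventually (λ t → 0ℤ < - ev p t) → Sign p

  neg-∷ : ∀ a p t → - ev (a ∷ p) t ≡ ev (- a ∷ (-1ℤ ⊙ p)) t
  neg-∷ a p t = trans (arrange a (+ t) (ev p t)) (cong (λ z → - a + + t * z) (sym (ev-neg p t)))
    where
    arrange : ∀ a t x → - (a + t * x) ≡ - a + t * (- x)
    arrange = solve-∀

  ev-const : ∀ a {p} → All (_≡ 0ℤ) p → ∀ t → ev (a ∷ p) t ≡ a
  ev-const a z t = trans (cong (λ w → a + + t * w) (ev-zero z t)) (ev-K a t)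

  -- Trailing zeros are allowed, so there is no leading coefficient to inspect. A nonzero tail
  -- decides, since the constant term is negligible against `t` times a nonzero integer; otherwise
  -- the constant term does.
  sign : ∀ p → Sign p
  sign [] = zer []
  sign (a ∷ p) with sign p
  ... | pos₊ h = pos₊ (large-* a {p} h)
  ... | neg₋ h = neg₋ (mapᴱ (λ t → subst (0ℤ <_) (sym (neg-∷ a p t)))
                      (large-* (- a) { -1ℤ ⊙ p} (mapᴱ (λ t → subst (0ℤ <_) (sym (ev-neg p t))) h)))
  ... | zer z with <-cmp a 0ℤ
  ...   | tri≈ _ a≡0 _ = zer (a≡0 ∷ z)
  ...   | tri> _ _ a>0 = pos₊ (pureᴱ λ t → subst (0ℤ <_) (sym (ev-const a z t)) a>0)
  ...   | tri< a<0 _ _ = neg₋ (pureᴱ λ t → subst (λ w → 0ℤ < - w) (sym (ev-const a z t)) (neg-pos a<0))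

-- Cones with polynomial generators and their descriptions by inequalities.

module ConeDescription where

  open IntegersAndPolynomials
  open import Data.Nat as ℕ using (ℕ; zero; suc)
  import Data.Nat.Properties as ℕ
  open import Data.Integer hiding (suc; pred; sign)
  open import Data.Integer.Properties
  open import Data.Integer.Tactic.RingSolver using (solve-∀)
  open import Data.Fin using (Fin; zero; suc)
  open import Data.List using (List; []; _∷_; _++_; tabulate; cartesianProductWith)
  open import Data.List.Relation.Unary.All as All using (All; []; _∷_)
  import Data.List.Relation.Unary.All.Properties as All
  open import Data.List.Membership.Propositional using (_∈_)
  open import Data.List.Membership.Propositional.Properties
  open import Data.Product using (Σ-syntax; ∃-syntax; _×_; _,_)
  open import Function using (_∘_)
  open import Relation.Nullary using (yes; no)
  open import Relation.Binary.PropositionalEquality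

  -- Integral points of the rational cone: `μ` clears the denominators of the coefficients.
  Cone : ∀ {k m} → (Fin k → Vℤ m) → Vℤ m → Set
  Cone {k} G x = Σ[ μ ∈ ℤ ] Σ[ a ∈ Vℤ k ]
    0ℤ < μ × (∀ i → 0ℤ ≤ a i) × (∀ c → μ * x c ≡ sum (λ i → a i * G i c))

  cone-nonneg : ∀ {k m} {G : Fin k → Vℤ m} {x} f → (∀ i → 0ℤ ≤ dot f (G i)) → Cone G x → 0ℤ ≤ dot f x
  cone-nonneg {G = G} {x} f h (μ , a , μ>0 , a≥0 , eq) = *-nonneg⁻¹ μ>0 (subst (0ℤ ≤_) (sym μfx)
      (sum-nonneg _ (λ i → *-nonneg (a≥0 i) (h i))))
    where
    μfx : μ * dot f x ≡ sum (λ i → a i * dot f (G i))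
    μfx = trans (sym (dot-* f μ x)) (trans (dot-congʳ f eq) (dot-sum f a G))

  -- Fourier–Motzkin elimination of the coefficient n / μ of a new generator g: here d h and
  -- c h are the values of the row h at x and at g.
  eliminate : ∀ {A : Set} (c d : A → ℤ) (ps ns : List A) →
    All (λ h → 0ℤ ≤ d h) ps → All (λ h → 0ℤ < - c h) ns →
    (∀ {h h′} → h ∈ ps → h′ ∈ ns → 0ℤ ≤ c h * d h′ + - c h′ * d h) →
    Σ[ μ ∈ ℤ ] Σ[ n ∈ ℤ ] 0ℤ < μ × 0ℤ ≤ n ×
      All (λ h → 0ℤ ≤ μ * d h + - n * c h) ps × All (λ h → 0ℤ ≤ μ * d h + - n * c h) ns
  eliminate c d ps [] p [] _ = 1ℤ , 0ℤ , +<+ ℕ.z<s , ≤-refl ,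
    All.map (λ {h} → subst (0ℤ ≤_) (arrange (d h) (c h))) p , []
    where
    arrange : ∀ x y → x ≡ 1ℤ * x + - 0ℤ * y
    arrange = solve-∀
  eliminate c d ps (h′ ∷ ns) p (c′<0 ∷ q) comb
    with eliminate c d ps ns p q (λ i j → comb i (there j))
    where open import Data.List.Relation.Unary.Any using (there)
  ... | μ , n , μ>0 , n≥0 , r , s with 0ℤ ≤? μ * d h′ + - n * c h′
  ...   | yes ok = μ , n , μ>0 , n≥0 , r , ok ∷ s
  -- The violated row `h′` demands a larger coefficient, the least possible being `d h′ / c h′`,
  -- where it vanishes. The other rows of `ns` only gain from the increase, and those of `ps` stay
  -- nonnegative by `comb`.
  ...   | no ¬ok = - c h′ , - d h′ , c′<0 , <⇒≤ d′<0 ,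
      All.tabulate (λ {h} i → subst (0ℤ ≤_) (arr₁ (c h) (d h′) (c h′) (d h)) (comb i (here refl))) ,
      ≤-reflexive (arr₂ (c h′) (d h′)) ∷ All.zipWith (λ { (ck<0 , k) → other _ _ ck<0 k }) (q , s)
    where
    open import Data.List.Relation.Unary.Any using (here)
    arr₁ : ∀ ch dh′ ch′ dh → ch * dh′ + - ch′ * dh ≡ - ch′ * dh + - - dh′ * ch
    arr₁ = solve-∀
    arr₂ : ∀ ch′ dh′ → 0ℤ ≡ - ch′ * dh′ + - - dh′ * ch′
    arr₂ = solve-∀
    arr₃ : ∀ μ n c d → - (μ * d + - n * c) + n * - c ≡ μ * - d
    arr₃ = solve-∀
    arr₄ : ∀ μ n ck dk c d → - c * (μ * dk + - n * ck) + - ck * - (μ * d + - n * c) ≡ μ * (- c * dk + - - d * ck)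
    arr₄ = solve-∀
    gap : 0ℤ < - (μ * d h′ + - n * c h′)
    gap = neg-pos (≰⇒> ¬ok)
    d′<0 : 0ℤ < - d h′
    d′<0 = *-pos⁻¹ (<⇒≤ μ>0) (subst (0ℤ <_) (arr₃ μ n (c h′) (d h′)) (+-pos-nonneg gap (*-nonneg n≥0 (<⇒≤ c′<0))))
    other : ∀ ck dk → 0ℤ < - ck → 0ℤ ≤ μ * dk + - n * ck → 0ℤ ≤ - c h′ * dk + - - d h′ * ck
    other ck dk ck<0 k = *-nonneg⁻¹ μ>0 (subst (0ℤ ≤_) (arr₄ μ n ck dk (c h′) (d h′))
      (+-nonneg (*-nonneg (<⇒≤ c′<0) k) (*-nonneg (<⇒≤ ck<0) (<⇒≤ gap))))

  Row : ℕ → Set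
  Row m = Fin m → Poly

  NonnegAt : ∀ {m} → ℕ → Vℤ m → Row m → Set
  NonnegAt t x h = 0ℤ ≤ dot (evs h t) x

  -- Only statements of the form `All Q` are moved between the rows and their two classes, so
  -- `gather`, `onPs` and `onNs` take the place of a permutation. Rows vanishing at `g` count among
  -- `ps`.
  record Split {m} (g : Row m) (rows : List (Row m)) : Set₁ where
    field
      ps ns  : List (Row m)
      gather : ∀ {Q : Row m → Set} → All Q ps → All Q ns → All Q rows
      onPs   : ∀ {Q : Row m → Set} → All Q rows → All Q ps
      onNs   : ∀ {Q : Row m → Set} → All Q rows → All Q ns
      signs  : Eventually (λ t → All (NonnegAt t (evs g t)) ps × All (λ h → 0ℤ < - dot (evs h t) (evs g t)) ns)

  split : ∀ {m} (g : Row m) rows → Split g rows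
  split g [] = record
    { ps = [] ; ns = [] ; gather = λ _ _ → [] ; onPs = λ _ → [] ; onNs = λ _ → [] ; signs = pureᴱ (λ _ → [] , []) }
  split g (h ∷ rows) with split g rows | sign (dotP h g)
  ... | s | neg₋ c<0 = record
    { ps = ps ; ns = h ∷ ns
    ; gather = λ { p (q ∷ r) → q ∷ gather p r }
    ; onPs = λ { (_ ∷ p) → onPs p } ; onNs = λ { (q ∷ p) → q ∷ onNs p }
    ; signs = mapᴱ (λ { t (c , p , n) → p , subst (λ z → 0ℤ < - z) (ev-dotP h g t) c ∷ n }) (c<0 ∧ᴱ signs) }
    where open Split s
  ... | s | pos₊ c>0 = record
    { ps = h ∷ ps ; ns = ns
    ; gather = λ { (q ∷ p) r → q ∷ gather p r }
    ; onPs = λ { (q ∷ p) → q ∷ onPs p } ; onNs = λ { (_ ∷ p) → onNs p }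
    ; signs = mapᴱ (λ { t (c , p , n) → subst (0ℤ ≤_) (ev-dotP h g t) (<⇒≤ c) ∷ p , n }) (c>0 ∧ᴱ signs) }
    where open Split s
  ... | s | zer z = record
    { ps = h ∷ ps ; ns = ns
    ; gather = λ { (q ∷ p) r → q ∷ gather p r }
    ; onPs = λ { (q ∷ p) → q ∷ onPs p } ; onNs = λ { (_ ∷ p) → onNs p }
    ; signs = mapᴱ (λ { t (p , n) → ≤-reflexive (trans (sym (ev-zero z t)) (ev-dotP h g t)) ∷ p , n }) signs }
    where open Split s

  -- The combination of `h` and `h′` that vanishes at `g`. For `h` in `ps` and `h′` in `ns` both
  -- coefficients are eventually nonnegative, so it remains valid on the old cone.
  crossRow : ∀ {m} → Row m → Row m → Row m → Row m
  crossRow g h h′ i = (dotP h g ⊗ h′ i) ⊕ ((-1ℤ ⊙ dotP h′ g) ⊗ h i)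

  dot-crossRow : ∀ {m} (g h h′ : Row m) t x → dot (evs (crossRow g h h′) t) x ≡
    dot (evs h t) (evs g t) * dot (evs h′ t) x + - dot (evs h′ t) (evs g t) * dot (evs h t) x
  dot-crossRow g h h′ t x = trans (dot-congˡ x pointwise)
      (dot-lin′ x (dot (evs h t) (evs g t)) (evs h′ t) (- dot (evs h′ t) (evs g t)) (evs h t))
    where
    pointwise : ∀ i → ev (crossRow g h h′ i) t ≡
      dot (evs h t) (evs g t) * ev (h′ i) t + - dot (evs h′ t) (evs g t) * ev (h i) t
    pointwise i = trans (ev-⊕ (dotP h g ⊗ h′ i) _ t) (cong₂ _+_
      (trans (ev-⊗ (dotP h g) (h′ i) t) (cong (_* ev (h′ i) t) (ev-dotP h g t)))
      (trans (ev-⊗ (-1ℤ ⊙ dotP h′ g) (h i) t) (cong (_* ev (h i) t)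
        (trans (ev-neg (dotP h′ g) t) (cong -_ (ev-dotP h′ g t))))))

  HRep : ∀ {k m} → (Fin k → Row m) → List (Row m) → ℕ → Set
  HRep {m = m} G rows t =
    All (λ h → ∀ i → NonnegAt t (evs (G i) t) h) rows ×
    (∀ (x : Vℤ m) → All (NonnegAt t x) rows → Cone (λ i → evs (G i) t) x)

  -- Minkowski–Weyl: x lies in the cone extended by a generator g iff x - λ g lies in the old cone for
  -- some λ ≥ 0, and λ is eliminated.
  hrep : ∀ {k m} (G : Fin k → Row m) → Σ[ rows ∈ List (Row m) ] Eventually (HRep G rows)
  -- Without generators the cone is the origin, so every coordinate is bounded by 0 from both sides.
  hrep {zero} {m} G = tabulate plus ++ tabulate minus , pureᴱ λ t →
      All.tabulate (λ _ ()) ,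
      λ x h → 1ℤ , (λ ()) , +<+ ℕ.z<s , (λ ()) , λ c → trans (*-identityˡ (x c)) (≤-antisym
        (diff-≤ (subst (0ℤ ≤_) (value′ t x c) (All.tabulate⁻ (All.++⁻ʳ (tabulate plus) h) c)))
        (subst (0ℤ ≤_) (value t x c) (All.tabulate⁻ (All.++⁻ˡ (tabulate plus) h) c)))
    where
    plus minus : Fin m → Row m
    plus i j = K (e i j)
    minus i j = -1ℤ ⊙ K (e i j)
    value : ∀ t x c → dot (evs (plus c) t) x ≡ x c
    value t x c = trans (dot-congˡ x (λ j → ev-K (e c j) t)) (dot-e c x)
    value′ : ∀ t x c → dot (evs (minus c) t) x ≡ 0ℤ - x c
    value′ t x c = begin
      dot (evs (minus c) t) x          ≡⟨ dot-congˡ x (λ j → ev-⊙ -1ℤ (plus c j) t) ⟩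
      dot (λ j → -1ℤ * ev (plus c j) t) x  ≡⟨ dot-comm _ x ⟩
      dot x (λ j → -1ℤ * ev (plus c j) t)  ≡⟨ dot-* x -1ℤ (evs (plus c) t) ⟩
      -1ℤ * dot x (evs (plus c) t)     ≡⟨ cong (-1ℤ *_) (trans (dot-comm x _) (value t x c)) ⟩
      -1ℤ * x c                        ≡⟨ trans (-1*i≡-i (x c)) (sym (+-identityˡ (- x c))) ⟩
      0ℤ - x c                         ∎
      where open ≡-Reasoning
  hrep {suc k} {m} G with hrep (G ∘ suc)
  ... | rows , IH with split (G zero) rows
  ...   | s = ps ++ combs , mapᴱ step (signs ∧ᴱ IH)
    where
    open Split s
    g = G zero
    combs = cartesianProductWith (crossRow g) ps ns
    step : ∀ t → (All (NonnegAt t (evs g t)) ps × All (λ h → 0ℤ < - dot (evs h t) (evs g t)) ns) ×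
      HRep (G ∘ suc) rows t → HRep G (ps ++ combs) t
    step t ((ps≥0 , ns<0) , sound , complete) =
      All.++⁺ (All.zipWith (λ { (p , q) zero → p ; (p , q) (suc i) → q i }) (ps≥0 , onPs sound))
              (All.tabulate λ {r} r∈ → combs≥0 r (∈-cartesianProductWith⁻ (crossRow g) ps ns r∈)) ,
      λ x h → extend x (All.++⁻ˡ ps h) (All.++⁻ʳ ps h)
      where
      combs≥0 : ∀ r → (∃[ h ] ∃[ h′ ] h ∈ ps × h′ ∈ ns × r ≡ crossRow g h h′) → ∀ i → NonnegAt t (evs (G i) t) r
      combs≥0 _ (h , h′ , h∈ , h′∈ , refl) zero = ≤-reflexive (sym (trans (dot-crossRow g h h′ t (evs g t))
          (cancel (dot (evs h t) (evs g t)) (dot (evs h′ t) (evs g t)))))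
        where
        cancel : ∀ a b → a * b + - b * a ≡ 0ℤ
        cancel = solve-∀
      combs≥0 _ (h , h′ , h∈ , h′∈ , refl) (suc i) = subst (0ℤ ≤_) (sym (dot-crossRow g h h′ t (evs (G (suc i)) t)))
        (+-nonneg (*-nonneg (All.lookup ps≥0 h∈) (All.lookup (onNs sound) h′∈ i))
                  (*-nonneg (<⇒≤ (All.lookup ns<0 h′∈)) (All.lookup (onPs sound) h∈ i)))
      extend : ∀ x → All (NonnegAt t x) ps → All (NonnegAt t x) combs → Cone (λ i → evs (G i) t) x
      extend x hp hc
        with eliminate (λ h → dot (evs h t) (evs g t)) (λ h → dot (evs h t) x) ps ns hp ns<0
               (λ {h} {h′} h∈ h′∈ → subst (0ℤ ≤_) (dot-crossRow g h h′ t x)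
                  (All.lookup hc (∈-cartesianProductWith⁺ (crossRow g) h∈ h′∈)))
      ... | μ , n , μ>0 , n≥0 , p , q
        -- `μ x - n g` satisfies every old row, hence lies in the old cone with some multiplier `ν`.
        -- Moving `n g` to the other side gives `g` the coefficient `ν n` and `x` the multiplier
        -- `ν μ`.
        with complete (λ c → μ * x c + - n * ev (g c) t)
               (gather (All.map (λ {h} → subst (0ℤ ≤_) (sym (dot-lin (evs h t) μ x (- n) (evs g t)))) p)
                       (All.map (λ {h} → subst (0ℤ ≤_) (sym (dot-lin (evs h t) μ x (- n) (evs g t)))) q))
      ... | ν , a , ν>0 , a≥0 , eq = ν * μ , a′ , *-pos ν>0 μ>0 ,
          (λ { zero → *-nonneg (<⇒≤ ν>0) n≥0 ; (suc i) → a≥0 i }) ,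
          λ c → trans (arrange ν μ (x c) n (ev (g c) t)) (cong (λ z → ν * n * ev (g c) t + z) (eq c))
        where
        a′ : Vℤ (suc k)
        a′ zero    = ν * n
        a′ (suc i) = a i
        arrange : ∀ ν μ x n g → ν * μ * x ≡ ν * n * g + ν * (μ * x + - n * g)
        arrange = solve-∀

-- Semilinear sets and positive Boolean combinations of linear inequalities.

module Semilinear where

  open IntegersAndPolynomials
  open import Data.Nat as ℕ using (ℕ; zero; suc)
  import Data.Nat.Properties as ℕ
  open import Data.Nat.DivMod using (_/_; _%_; m≡m%n+[m/n]*n; m%n<n)
  open import Data.Integer hiding (suc; pred; sign; _/_; _%_)
  open import Data.Integer.Properties
  open import Data.Integer.Tactic.RingSolver using (solve-∀)
  open import Data.Fin using (Fin; zero; suc)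
  open import Data.List using (List; []; _∷_; _++_; tabulate; upTo; cartesianProductWith)
  open import Data.List.Relation.Unary.All as All using (All; []; _∷_)
  import Data.List.Relation.Unary.All.Properties as All
  open import Data.List.Relation.Unary.Any as Any using (Any; here; there)
  import Data.List.Relation.Unary.Any.Properties as Any
  open import Data.List.Membership.Propositional using (_∈_; find; lose)
  open import Data.List.Membership.Propositional.Properties
  open import Data.Product using (Σ-syntax; ∃-syntax; _×_; _,_; proj₁; proj₂)
  open import Data.Sum using (_⊎_; inj₁; inj₂; [_,_]′)
  open import Function using (_∘_; id)
  open import Relation.Nullary using (Dec; yes; no; contradiction)
  open import Relation.Binary.PropositionalEquality

  infixl 6 _+ᵥ_
  infixl 7 _*ᵥ_

  0ᵥ : ∀ {m} → Vℤ m
  0ᵥ _ = 0ℤ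

  _+ᵥ_ : ∀ {m} → Vℤ m → Vℤ m → Vℤ m
  (x +ᵥ y) c = x c + y c

  _*ᵥ_ : ∀ {m} → ℤ → Vℤ m → Vℤ m
  (a *ᵥ x) c = a * x c

  -- The number of summands is recorded because `k` generators of common value `B` have total value
  -- `k B`, and because positive and negative generators are matched by count.
  SpanN : ∀ {m} → List (Vℤ m) → ℕ → Vℤ m → Set
  SpanN hs zero    x = x ≗ 0ᵥ
  SpanN hs (suc k) x = ∃[ h ] ∃[ y ] h ∈ hs × SpanN hs k y × x ≗ h +ᵥ y

  Span : ∀ {m} → List (Vℤ m) → Vℤ m → Set
  Span hs x = ∃[ k ] SpanN hs k x

  spanN-resp : ∀ {m} {hs : List (Vℤ m)} k {x x′} → x′ ≗ x → SpanN hs k x → SpanN hs k x′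
  spanN-resp zero    eq s = λ c → trans (eq c) (s c)
  spanN-resp (suc k) eq (h , y , h∈ , s , x≗) = h , y , h∈ , s , λ c → trans (eq c) (x≗ c)

  span-resp : ∀ {m} {hs : List (Vℤ m)} {x x′} → x′ ≗ x → Span hs x → Span hs x′
  span-resp eq (k , s) = k , spanN-resp k eq s

  spanN-+ : ∀ {m} {hs : List (Vℤ m)} j {k x y} → SpanN hs j x → SpanN hs k y → SpanN hs (j ℕ.+ k) (x +ᵥ y)
  spanN-+ zero {k} {x} {y} s t = spanN-resp k (λ c → trans (cong (_+ y c) (s c)) (+-identityˡ (y c))) t
  spanN-+ (suc j) {k} {x} {y} (h , z , h∈ , s , eq) t =
    h , z +ᵥ y , h∈ , spanN-+ j s t , λ c → trans (cong (_+ y c) (eq c)) (+-assoc (h c) (z c) (y c))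

  span-+ : ∀ {m} {hs : List (Vℤ m)} {x y} → Span hs x → Span hs y → Span hs (x +ᵥ y)
  span-+ (j , s) (k , t) = j ℕ.+ k , spanN-+ j s t

  span-0 : ∀ {m} {hs : List (Vℤ m)} → Span hs 0ᵥ
  span-0 = 0 , λ _ → refl

  span-∈ : ∀ {m} {hs : List (Vℤ m)} {h} → h ∈ hs → Span hs h
  span-∈ {h = h} h∈ = 1 , h , 0ᵥ , h∈ , (λ _ → refl) , λ c → sym (+-identityʳ (h c))

  span-* : ∀ {m} {hs : List (Vℤ m)} n {x} → Span hs x → Span hs (+ n *ᵥ x)
  span-* zero    s = span-0
  span-* (suc n) {x} s = span-resp (λ c → suc-* (+ n) (x c)) (span-+ s (span-* n s))

  span-bind : ∀ {m} {hs hs′ : List (Vℤ m)} → (∀ {h} → h ∈ hs → Span hs′ h) → ∀ {x} → Span hs x → Span hs′ x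
  span-bind f (zero , s) = zero , s
  span-bind f (suc k , h , y , h∈ , s , eq) = span-resp eq (span-+ (f h∈) (span-bind f (k , s)))

  span-⊆ : ∀ {m} {hs hs′ : List (Vℤ m)} → (∀ {h} → h ∈ hs → h ∈ hs′) → ∀ {x} → Span hs x → Span hs′ x
  span-⊆ f = span-bind (span-∈ ∘ f)

  span-sum : ∀ {k l} (h : Fin k → Vℤ l) (n : Fin k → ℕ) → Span (tabulate h) (λ c → sum (λ i → + n i * h i c))
  span-sum {zero}  h n = span-0
  span-sum {suc k} h n = span-+ (span-* (n zero) (span-∈ (here refl))) (span-⊆ there (span-sum (h ∘ suc) (n ∘ suc)))

  spanN-split : ∀ {m} {hs : List (Vℤ m)} j {k x} → SpanN hs (j ℕ.+ k) x →
    ∃[ y ] ∃[ z ] SpanN hs j y × SpanN hs k z × x ≗ y +ᵥ z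
  spanN-split zero {x = x} s = 0ᵥ , x , (λ _ → refl) , s , λ c → sym (+-identityˡ (x c))
  spanN-split (suc j) {x = x} (h , w , h∈ , s , eq) with spanN-split j s
  ... | y , z , sy , sz , w≗ = h +ᵥ y , z , (h , y , h∈ , sy , λ _ → refl) , sz , x≗
    where
    x≗ : ∀ c → x c ≡ h c + y c + z c
    x≗ c rewrite eq c | w≗ c = sym (+-assoc (h c) (y c) (z c))

  span-nonneg : ∀ {m} f {hs : List (Vℤ m)} → All (λ h → 0ℤ ≤ dot f h) hs → ∀ {x} → Span hs x → 0ℤ ≤ dot f x
  span-nonneg f {hs} hs≥0 (k , s) = go k s
    where
    go : ∀ k {x} → SpanN hs k x → 0ℤ ≤ dot f x
    go zero    s = ≤-reflexive (sym (dot-0 f s))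
    go (suc k) (h , y , h∈ , s , eq) = subst (0ℤ ≤_) (sym (trans (dot-congʳ f eq) (dot-+ f h y)))
      (+-nonneg (All.lookup hs≥0 h∈) (go k s))

  spanN-value : ∀ {m} f B {hs : List (Vℤ m)} → All (λ h → dot f h ≡ B) hs → ∀ k {x} → SpanN hs k x → dot f x ≡ + k * B
  spanN-value {m} f B hs≡B zero s = dot-0 f s
  spanN-value f B hs≡B (suc k) (h , y , h∈ , s , eq) = begin
    dot f _              ≡⟨ trans (dot-congʳ f eq) (dot-+ f h y) ⟩
    dot f h + dot f y    ≡⟨ cong₂ _+_ (All.lookup hs≡B h∈) (spanN-value f B hs≡B k s) ⟩
    B + + k * B          ≡⟨ sym (suc-* (+ k) B) ⟩
    + suc k * B          ∎
    where
    open ≡-Reasoning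

  sums : ∀ {m} → ℕ → List (Vℤ m) → List (Vℤ m)
  sums zero    hs = 0ᵥ ∷ []
  sums (suc k) hs = cartesianProductWith _+ᵥ_ hs (sums k hs)

  sums-complete : ∀ {m} {hs : List (Vℤ m)} k {x} → SpanN hs k x → ∃[ s ] s ∈ sums k hs × x ≗ s
  sums-complete zero s = 0ᵥ , here refl , s
  sums-complete (suc k) (h , y , h∈ , s , eq) with sums-complete k s
  ... | s′ , s′∈ , y≗ = h +ᵥ s′ , ∈-cartesianProductWith⁺ _+ᵥ_ h∈ s′∈ , λ c → trans (eq c) (cong (λ z → h c + z) (y≗ c))

  sums-sound : ∀ {m} {hs : List (Vℤ m)} k {x} → x ∈ sums k hs → SpanN hs k x
  sums-sound zero (here refl) = λ _ → refl
  sums-sound {hs = hs} (suc k) x∈ with ∈-cartesianProductWith⁻ _+ᵥ_ hs (sums k hs) x∈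
  ... | h , y , h∈ , y∈ , refl = h , y , h∈ , sums-sound k y∈ , λ _ → refl

  span-uncons : ∀ {m} {h : Vℤ m} {hs x} → Span (h ∷ hs) x → ∃[ n ] ∃[ y ] Span hs y × x ≗ + n *ᵥ h +ᵥ y
  span-uncons {h = h} {x = x} (zero , s) = 0 , 0ᵥ , span-0 , s
  span-uncons {h = h} {x = x} (suc k , h′ , w , h∈ , s , eq) with span-uncons (k , s)
  ... | n , y , sy , w≗ with h∈
  ...   | here refl = suc n , y , sy , x≗
    where
    arrange : ∀ n h y → h + (n * h + y) ≡ (1ℤ + n) * h + y
    arrange = solve-∀
    x≗ : ∀ c → x c ≡ + suc n * h c + y c
    x≗ c rewrite eq c | w≗ c = arrange (+ n) (h c) (y c)
  ...   | there h′∈ = n , h′ +ᵥ y , span-+ (span-∈ h′∈) sy , x≗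
    where
    arrange : ∀ a h y → h + (a + y) ≡ a + (h + y)
    arrange = solve-∀
    x≗ : ∀ c → x c ≡ + n * h c + (h′ c + y c)
    x≗ c rewrite eq c | w≗ c = arrange (+ n * h c) (h′ c) (y c)

  data Trit (B z : ℤ) : Set where
    nil  : z ≡ 0ℤ → Trit B z
    plus : z ≡ B → Trit B z
    minus : z ≡ - B → Trit B z

  trit-* : ∀ {m} f b n (x : Vℤ m) → ∃[ k ] Trit (+ suc b) (dot f (+ suc k *ᵥ x)) →
    ∃[ k ] Trit (+ suc b * + suc n) (dot f (+ suc k *ᵥ x))
  -- Multipliers are stored as predecessors, which keeps them positive; this is the predecessor of
  -- `suc k * suc n`.
  trit-* f b n x (k , t) = n ℕ.+ k ℕ.* suc n , go t
    where
    arrange : ∀ k n d → k * n * d ≡ k * d * n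
    arrange = solve-∀
    value : dot f (+ suc k * + suc n *ᵥ x) ≡ dot f (+ suc k *ᵥ x) * + suc n
    value = trans (dot-* f (+ suc k * + suc n) x) (trans (arrange (+ suc k) (+ suc n) (dot f x))
              (cong (_* + suc n) (sym (dot-* f (+ suc k) x))))
    go : Trit (+ suc b) (dot f (+ suc k *ᵥ x)) → Trit (+ suc b * + suc n) (dot f (+ suc k * + suc n *ᵥ x))
    go (nil p)   = nil (trans value (cong (_* + suc n) p))
    go (plus p)  = plus (trans value (cong (_* + suc n) p))
    go (minus p) = minus (trans value (trans (cong (_* + suc n) p) (sym (neg-distribˡ-* (+ suc b) (+ suc n)))))

  -- `suc b` is the product of the absolute values of all nonzero values of `f`, and a generator
  -- with nonzero value is scaled by the product of the other factors.
  multiplier : ∀ {m} f (hs : List (Vℤ m)) →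
    ∃[ b ] All (λ h → ∃[ k ] Trit (+ suc b) (dot f (+ suc k *ᵥ h))) hs
  multiplier f [] = 0 , []
  multiplier f (h ∷ hs) with multiplier f hs
  ... | b , ts with dot f h in eq
  ...   | + zero   = b , (0 , nil (trans (dot-* f 1ℤ h) (trans (*-identityˡ _) eq))) ∷ ts
  ...   | + suc n  = n ℕ.+ b ℕ.* suc n ,
      (b , plus (trans (dot-* f (+ suc b) h) (cong (+ suc b *_) eq))) ∷ All.map (λ {x} → trit-* f b n x) ts
  ...   | -[1+ n ] = n ℕ.+ b ℕ.* suc n ,
      (b , minus (trans (dot-* f (+ suc b) h) (cong (+ suc b *_) eq))) ∷ All.map (λ {x} → trit-* f b n x) ts

  record Rescaling {m} (Q : Vℤ m → Set) (hs : List (Vℤ m)) : Set₁ where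
    field
      offsets gens : List (Vℤ m)
      offsets⊆ : All (Span hs) offsets
      gens⊆    : All (Span hs) gens
      good     : All Q gens
      cover    : ∀ {x} → Span hs x → ∃[ o ] ∃[ y ] o ∈ offsets × Span gens y × x ≗ o +ᵥ y

  -- The multiplicity of `h` is divided by its multiplier: the quotient counts copies of the scaled
  -- generator, and the remainder, which takes finitely many values, goes into the offset.
  rescale : ∀ {m} {Q : Vℤ m → Set} hs → All (λ h → ∃[ k ] Q (+ suc k *ᵥ h)) hs → Rescaling Q hs
  rescale [] [] = record
    { offsets = 0ᵥ ∷ [] ; gens = [] ; offsets⊆ = span-0 ∷ [] ; gens⊆ = [] ; good = []
    ; cover = λ { {x} (zero , s) → 0ᵥ , 0ᵥ , here refl , span-0 , s } }
  rescale {m} {Q} (h ∷ hs) ((k , q) ∷ qs) = record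
    { offsets = cartesianProductWith (λ r o → + r *ᵥ h +ᵥ o) (upTo (suc k)) offsets
    ; gens = + suc k *ᵥ h ∷ gens
    ; offsets⊆ = All.tabulate offset∈
    ; gens⊆ = span-* (suc k) (span-∈ (here refl)) ∷ All.map (span-⊆ there) gens⊆
    ; good = q ∷ good
    ; cover = cover′ }
    where
    open Rescaling (rescale {Q = Q} hs qs)
    offset∈ : ∀ {o} → o ∈ cartesianProductWith (λ r o → + r *ᵥ h +ᵥ o) (upTo (suc k)) offsets → Span (h ∷ hs) o
    offset∈ o∈ with ∈-cartesianProductWith⁻ _ (upTo (suc k)) offsets o∈
    ... | r , o , _ , o∈′ , refl = span-+ (span-* r (span-∈ (here refl))) (span-⊆ there (All.lookup offsets⊆ o∈′))
    cover′ : ∀ {x} → Span (h ∷ hs) x → _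
    cover′ {x} s with span-uncons s
    ... | n , w , sw , x≗ with cover sw
    ... | o , y , o∈ , sy , w≗ = + (n % suc k) *ᵥ h +ᵥ o , + (n / suc k) *ᵥ (+ suc k *ᵥ h) +ᵥ y ,
        ∈-cartesianProductWith⁺ _ (∈-upTo⁺ (m%n<n n (suc k))) o∈ ,
        span-+ (span-* (n / suc k) (span-∈ (here refl))) (span-⊆ there sy) , eq
      where
      arrange : ∀ r q k h o y → (r + q * k) * h + (o + y) ≡ r * h + o + (q * (k * h) + y)
      arrange = solve-∀
      n≡ : + n ≡ + (n % suc k) + + (n / suc k) * + suc k
      n≡ = trans (cong +_ (m≡m%n+[m/n]*n n (suc k))) (trans (pos-+ (n % suc k) _) (cong (λ z → + (n % suc k) + z) (pos-* (n / suc k) (suc k))))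
      eq : ∀ c → x c ≡ + (n % suc k) * h c + o c + (+ (n / suc k) * (+ suc k * h c) + y c)
      eq c = trans (x≗ c) (trans (cong₂ (λ u v → u * h c + v) n≡ (w≗ c))
               (arrange (+ (n % suc k)) (+ (n / suc k)) (+ suc k) (h c) (o c) (y c)))

  -- Counts are kept for `as` and `ns`, where they determine the value of the functional; generators
  -- in `zs` leave it unchanged.
  Decomposed : ∀ {m} (zs as ns : List (Vℤ m)) → Vℤ m → Set
  Decomposed zs as ns x = ∃[ z ] ∃[ a ] ∃[ n ] ∃[ i ] ∃[ j ]
    Span zs z × SpanN as i a × SpanN ns j n × x ≗ z +ᵥ (a +ᵥ n)

  record Classes {m} f (B : ℤ) (hs : List (Vℤ m)) : Set where
    field
      zs as ns : List (Vℤ m)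
      zs⊆ : ∀ {h} → h ∈ zs → h ∈ hs
      as⊆ : ∀ {h} → h ∈ as → h ∈ hs
      ns⊆ : ∀ {h} → h ∈ ns → h ∈ hs
      zs≡ : All (λ h → dot f h ≡ 0ℤ) zs
      as≡ : All (λ h → dot f h ≡ B) as
      ns≡ : All (λ h → dot f h ≡ - B) ns
      decompose : ∀ {x} → Span hs x → Decomposed zs as ns x

  weakenN : ∀ {m} {h : Vℤ m} {hs} k {x} → SpanN hs k x → SpanN (h ∷ hs) k x
  weakenN zero    s = s
  weakenN (suc k) (h , y , h∈ , s , eq) = h , y , there h∈ , weakenN k s , eq

  spanN-* : ∀ {m} {hs : List (Vℤ m)} n {h} → h ∈ hs → SpanN hs n (+ n *ᵥ h)
  spanN-* zero        h∈ = λ c → refl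
  spanN-* (suc n) {h} h∈ = h , + n *ᵥ h , h∈ , spanN-* n h∈ , λ c → suc-* (+ n) (h c)

  classify : ∀ {m} f B (hs : List (Vℤ m)) → All (λ h → Trit B (dot f h)) hs → Classes f B hs
  classify f B [] [] = record
    { zs = [] ; as = [] ; ns = [] ; zs⊆ = id ; as⊆ = id ; ns⊆ = id ; zs≡ = [] ; as≡ = [] ; ns≡ = []
    ; decompose = λ { (zero , s) → 0ᵥ , 0ᵥ , 0ᵥ , 0 , 0 , span-0 , (λ _ → refl) , (λ _ → refl) , s } }
  classify {m} f B (h ∷ hs) (nil p ∷ ps) = record
    { zs = h ∷ zs ; as = as ; ns = ns
    ; zs⊆ = λ { (here e) → here e ; (there i) → there (zs⊆ i) } ; as⊆ = there ∘ as⊆ ; ns⊆ = there ∘ ns⊆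
    ; zs≡ = p ∷ zs≡ ; as≡ = as≡ ; ns≡ = ns≡ ; decompose = dec }
    where
    open Classes (classify f B hs ps)
    dec : ∀ {x} → Span (h ∷ hs) x → Decomposed (h ∷ zs) as ns x
    dec {x} s with span-uncons s
    ... | k , y , sy , x≗ with decompose sy
    ... | z , a , n , i , j , sz , sa , sn , y≗ = + k *ᵥ h +ᵥ z , a , n , i , j ,
        span-+ (span-* k (span-∈ (here refl))) (span-⊆ there sz) , sa , sn ,
        λ c → trans (x≗ c) (trans (cong (λ u → + k * h c + u) (y≗ c)) (sym (+-assoc (+ k * h c) (z c) (a c + n c))))
  classify {m} f B (h ∷ hs) (plus p ∷ ps) = record
    { zs = zs ; as = h ∷ as ; ns = ns
    ; as⊆ = λ { (here e) → here e ; (there i) → there (as⊆ i) } ; zs⊆ = there ∘ zs⊆ ; ns⊆ = there ∘ ns⊆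
    ; zs≡ = zs≡ ; as≡ = p ∷ as≡ ; ns≡ = ns≡ ; decompose = dec }
    where
    open Classes (classify f B hs ps)
    dec : ∀ {x} → Span (h ∷ hs) x → Decomposed zs (h ∷ as) ns x
    dec {x} s with span-uncons s
    ... | k , y , sy , x≗ with decompose sy
    ... | z , a , n , i , j , sz , sa , sn , y≗ = z , + k *ᵥ h +ᵥ a , n , k ℕ.+ i , j ,
        sz , spanN-+ k (spanN-* k (here refl)) (weakenN i sa) , sn ,
        λ c → trans (x≗ c) (trans (cong (λ u → + k * h c + u) (y≗ c)) (arrange (+ k * h c) (z c) (a c) (n c)))
      where
      arrange : ∀ k z a n → k + (z + (a + n)) ≡ z + (k + a + n)
      arrange = solve-∀
  classify {m} f B (h ∷ hs) (minus p ∷ ps) = record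
    { zs = zs ; as = as ; ns = h ∷ ns
    ; ns⊆ = λ { (here e) → here e ; (there i) → there (ns⊆ i) } ; zs⊆ = there ∘ zs⊆ ; as⊆ = there ∘ as⊆
    ; zs≡ = zs≡ ; as≡ = as≡ ; ns≡ = p ∷ ns≡ ; decompose = dec }
    where
    open Classes (classify f B hs ps)
    dec : ∀ {x} → Span (h ∷ hs) x → Decomposed zs as (h ∷ ns) x
    dec {x} s with span-uncons s
    ... | k , y , sy , x≗ with decompose sy
    ... | z , a , n , i , j , sz , sa , sn , y≗ = z , a , + k *ᵥ h +ᵥ n , i , k ℕ.+ j ,
        sz , sa , spanN-+ k (spanN-* k (here refl)) (weakenN j sn) ,
        λ c → trans (x≗ c) (trans (cong (λ u → + k * h c + u) (y≗ c)) (arrange (+ k * h c) (z c) (a c) (n c)))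
      where
      arrange : ∀ k z a n → k + (z + (a + n)) ≡ z + (a + (k + n))
      arrange = solve-∀

  Piece : ℕ → Set
  Piece m = Vℤ m × List (Vℤ m)

  infix 4 _∈ₚ_

  _∈ₚ_ : ∀ {m} → Vℤ m → Piece m → Set
  x ∈ₚ (p , hs) = ∃[ y ] Span hs y × x ≗ p +ᵥ y

  Semilinear : ∀ {m} → (Vℤ m → Set) → Set
  Semilinear {m} P = Σ[ pieces ∈ List (Piece m) ]
    ∀ x → (P x → Any (x ∈ₚ_) pieces) × (Any (x ∈ₚ_) pieces → P x)

  sl-map : ∀ {m} {P Q : Vℤ m → Set} → (∀ x → P x → Q x) → (∀ x → Q x → P x) → Semilinear P → Semilinear Q
  sl-map f g (ps , h) = ps , λ x → proj₁ (h x) ∘ g x , f x ∘ proj₂ (h x)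

  sl-piece : ∀ {m} (π : Piece m) → Semilinear (_∈ₚ π)
  sl-piece π = π ∷ [] , λ x → here , λ { (here p) → p }

  sl-∪ : ∀ {m} {P Q : Vℤ m → Set} → Semilinear P → Semilinear Q → Semilinear (λ x → P x ⊎ Q x)
  sl-∪ (ps , f) (qs , g) = ps ++ qs , λ x →
    [ Any.++⁺ˡ ∘ proj₁ (f x) , Any.++⁺ʳ ps ∘ proj₁ (g x) ]′ ,
    λ a → [ inj₁ ∘ proj₂ (f x) , inj₂ ∘ proj₂ (g x) ]′ (Any.++⁻ ps a)

  sl-⋃ : ∀ {m} {A : Set} {P : A → Vℤ m → Set} (as : List A) → (∀ a → Semilinear (P a)) →
    Semilinear (λ x → Any (λ a → P a x) as)
  sl-⋃ []       f = [] , λ x → (λ ()) , (λ ())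
  sl-⋃ (a ∷ as) f = sl-map (λ x → [ here , there ]′) (λ { x (here p) → inj₁ p ; x (there p) → inj₂ p })
    (sl-∪ (f a) (sl-⋃ as f))

  sl-dec : ∀ {m} {D : Set} {P : Vℤ m → Set} → Dec D → Semilinear P → Semilinear (λ x → D × P x)
  sl-dec (yes d) s = sl-map (λ _ p → d , p) (λ _ → proj₂) s
  sl-dec (no ¬d) s = [] , λ x → (λ (d , _) → contradiction d ¬d) , (λ ())

  -- A conjunction is treated by refining each piece of the first set in turn, so two arbitrary
  -- semilinear sets are never intersected.
  sl-refine : ∀ {m} {P Q : Vℤ m → Set} → Semilinear P → (∀ π → Semilinear (λ x → x ∈ₚ π × Q x)) →
    Semilinear (λ x → P x × Q x)
  sl-refine (ps , f) g = sl-map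
    (λ x a → proj₂ (f x) (Any.map proj₁ a) , proj₂ (proj₂ (find′ a)))
    (λ x (p , q) → Any.map (λ r → r , q) (proj₁ (f x) p))
    (sl-⋃ ps g)
    where
    find′ : ∀ {A : Set} {P : A → Set} {Q : Set} {as : List A} → Any (λ a → P a × Q) as → ∃[ a ] P a × Q
    find′ (here (p , q)) = _ , p , q
    find′ (there a) = find′ a

  -- After normalising the values of f on the generators to 0 and ±B, every positive
  -- generator can be matched with a negative one, except for boundedly many.
  sl-atom : ∀ {m} f (π : Piece m) → Semilinear (λ x → x ∈ₚ π × 0ℤ ≤ dot f x)
  sl-atom {m} f (p , hs) with multiplier f hs
  ... | b , mult = sl-map sound complete
      -- `s` gathers the unmatched generators that settle the sign of the base. A deficit of
      -- positive generators is at most `∣ dot f (p +ᵥ o) ∣`, as `dot f x` is nonnegative and `B` is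
      -- at least 1. Of a larger surplus, that many already make the base nonnegative, and the rest
      -- stay free in `as`.
      (sl-⋃ offsets λ o → sl-⋃ (upTo (suc ∣ dot f (p +ᵥ o) ∣)) λ k → sl-⋃ (sums k as ++ sums k ns) λ s →
        sl-dec (0ℤ ≤? dot f (p +ᵥ o +ᵥ s)) (sl-piece (p +ᵥ o +ᵥ s , zs ++ as ++ pairs)))
    where
    B = + suc b
    open Rescaling (rescale {Q = λ h → Trit B (dot f h)} hs mult)
    open Classes (classify f B gens good)
    pairs : List (Vℤ m)
    pairs = cartesianProductWith _+ᵥ_ as ns
    matched : List (Vℤ m)
    matched = zs ++ as ++ pairs
    Result : Vℤ m → Set
    Result x = Any (λ o → Any (λ k → Any (λ s → 0ℤ ≤ dot f (p +ᵥ o +ᵥ s) × x ∈ₚ (p +ᵥ o +ᵥ s , matched))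
      (sums k as ++ sums k ns)) (upTo (suc ∣ dot f (p +ᵥ o) ∣))) offsets

    as→hs : ∀ {x} → Span as x → Span hs x
    as→hs = span-bind (All.lookup gens⊆ ∘ as⊆)
    ns→hs : ∀ {x} → Span ns x → Span hs x
    ns→hs = span-bind (All.lookup gens⊆ ∘ ns⊆)
    matched→hs : ∀ {h} → h ∈ matched → Span hs h
    matched→hs h∈ with ∈-++⁻ zs h∈
    ... | inj₁ i = All.lookup gens⊆ (zs⊆ i)
    ... | inj₂ i with ∈-++⁻ as i
    ...   | inj₁ j = as→hs (span-∈ j)
    ...   | inj₂ j with ∈-cartesianProductWith⁻ _+ᵥ_ as ns j
    ...     | u , v , u∈ , v∈ , refl = span-+ (as→hs (span-∈ u∈)) (ns→hs (span-∈ v∈))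
    matched≥0 : All (λ h → 0ℤ ≤ dot f h) matched
    matched≥0 = All.++⁺ (All.map (≤-reflexive ∘ sym) zs≡)
      (All.++⁺ (All.map (λ eq → subst (0ℤ ≤_) (sym eq) (+≤+ ℕ.z≤n)) as≡)
               (All.tabulate (λ {h} h∈ → pair≥0 (∈-cartesianProductWith⁻ _+ᵥ_ as ns h∈))))
      where
      pair≥0 : ∀ {h} → (∃[ u ] ∃[ v ] u ∈ as × v ∈ ns × h ≡ u +ᵥ v) → 0ℤ ≤ dot f h
      pair≥0 (u , v , u∈ , v∈ , refl) = ≤-reflexive (sym (trans (dot-+ f u v)
        (trans (cong₂ _+_ (All.lookup as≡ u∈) (All.lookup ns≡ v∈)) (+-inverseʳ B))))

    sound : ∀ x → Result x → x ∈ₚ (p , hs) × 0ℤ ≤ dot f x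
    sound x r with find r
    ... | o , o∈ , r₁ with find r₁
    ... | k , k∈ , r₂ with find r₂
    ... | s , s∈ , base≥0 , y , sy , x≗ =
        (o +ᵥ s +ᵥ y , span-+ (span-+ (All.lookup offsets⊆ o∈) s∈hs) (span-bind matched→hs sy) , x≗′) ,
        subst (0ℤ ≤_) (sym (trans (dot-congʳ f x≗) (dot-+ f (p +ᵥ o +ᵥ s) y)))
          (+-nonneg base≥0 (span-nonneg f matched≥0 sy))
      where
      s∈hs : Span hs s
      s∈hs with ∈-++⁻ (sums k as) s∈
      ... | inj₁ i = as→hs (k , sums-sound k i)
      ... | inj₂ i = ns→hs (k , sums-sound k i)
      arrange : ∀ p o s y → p + o + s + y ≡ p + (o + s + y)
      arrange = solve-∀
      x≗′ : ∀ c → x c ≡ p c + (o c + s c + y c)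
      x≗′ c = trans (x≗ c) (arrange (p c) (o c) (s c) (y c))

    match : ∀ j e {a n} → SpanN as (j ℕ.+ e) a → SpanN ns j n → Span matched (a +ᵥ n)
    match zero e {a} {n} sa sn = span-resp (λ c → trans (cong (λ z → a c + z) (sn c)) (+-identityʳ (a c)))
      (span-⊆ (∈-++⁺ʳ zs ∘ ∈-++⁺ˡ) (e , sa))
    match (suc j) e {a} {n} (u , a′ , u∈ , sa , a≗) (v , n′ , v∈ , sn , n≗) = span-resp eq
      (span-+ (span-∈ (∈-++⁺ʳ zs (∈-++⁺ʳ as (∈-cartesianProductWith⁺ _+ᵥ_ u∈ v∈)))) (match j e sa sn))
      where
      arrange : ∀ u a v n → (u + a) + (v + n) ≡ (u + v) + (a + n)
      arrange = solve-∀
      eq : ∀ c → a c + n c ≡ u c + v c + (a′ c + n′ c)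
      eq c rewrite a≗ c | n≗ c = arrange (u c) (a′ c) (v c) (n′ c)

    complete : ∀ x → x ∈ₚ (p , hs) × 0ℤ ≤ dot f x → Result x
    complete x ((w , sw , x≗) , fx≥0) with cover sw
    ... | o , w′ , o∈ , sw′ , w≗ with decompose sw′
    ... | z , a , n , i , j , sz , sa , sn , w′≗ = by-surplus (ℕ.≤-total j i)
      where
      c₀ = dot f (p +ᵥ o)
      fx : dot f x ≡ c₀ + + i * B + + j * - B
      fx = begin
        dot f x                              ≡⟨ dot-congʳ f x≗″ ⟩
        dot f (p +ᵥ o +ᵥ (z +ᵥ (a +ᵥ n)))    ≡⟨ dot-+ f (p +ᵥ o) _ ⟩
        c₀ + dot f (z +ᵥ (a +ᵥ n))           ≡⟨ cong (λ u → c₀ + u) (trans (dot-+ f z _) (cong (λ u → dot f z + u) (dot-+ f a n))) ⟩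
        c₀ + (dot f z + (dot f a + dot f n)) ≡⟨ cong₂ (λ u v → c₀ + (u + v))
                                                 (trans (spanN-value f 0ℤ zs≡ (proj₁ sz) (proj₂ sz)) (*-zeroʳ (+ proj₁ sz)))
                                                 (cong₂ _+_ (spanN-value f B as≡ i sa) (spanN-value f (- B) ns≡ j sn)) ⟩
        c₀ + (0ℤ + (+ i * B + + j * - B))    ≡⟨ arrange c₀ (+ i * B) (+ j * - B) ⟩
        c₀ + + i * B + + j * - B             ∎
        where
        open ≡-Reasoning
        arrange : ∀ c u v → c + (0ℤ + (u + v)) ≡ c + u + v
        arrange = solve-∀
        x≗″ : ∀ c → x c ≡ p c + o c + (z c + (a c + n c))
        x≗″ c rewrite x≗ c | w≗ c | w′≗ c = sym (+-assoc (p c) (o c) (z c + (a c + n c)))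
      place : ∀ k s j′ e {s₀ a′ n′} → k ℕ.≤ ∣ c₀ ∣ → s₀ ≗ s → s ∈ sums k as ++ sums k ns →
        SpanN as (j′ ℕ.+ e) a′ → SpanN ns j′ n′ → a +ᵥ n ≗ s₀ +ᵥ (a′ +ᵥ n′) →
        0ℤ ≤ c₀ + dot f s → Result x
      place k s j′ e {s₀} {a′} {n′} k≤ s₀≗ s∈ sa′ sn′ eq base≥0 =
        lose o∈ (lose (∈-upTo⁺ (ℕ.s≤s k≤)) (lose s∈
          (subst (0ℤ ≤_) (sym (dot-+ f (p +ᵥ o) s)) base≥0 ,
           z +ᵥ (a′ +ᵥ n′) , span-+ (span-⊆ ∈-++⁺ˡ sz) (match j′ e sa′ sn′) , x≗′)))
        where
        arrange : ∀ p o s z u → p + (o + (z + (s + u))) ≡ p + o + s + (z + u)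
        arrange = solve-∀
        x≗′ : ∀ c → x c ≡ p c + o c + s c + (z c + (a′ c + n′ c))
        x≗′ c rewrite x≗ c | w≗ c | w′≗ c | eq c | s₀≗ c = arrange (p c) (o c) (s c) (z c) (a′ c + n′ c)
      by-surplus : j ℕ.≤ i ⊎ i ℕ.≤ j → Result x
      by-surplus (inj₁ j≤i) with ℕ.≤-total (i ℕ.∸ j) ∣ c₀ ∣
      ... | inj₁ e≤c with spanN-split (i ℕ.∸ j) {j} (subst (λ l → SpanN as l a) (sym (ℕ.m∸n+n≡m j≤i)) sa)
      ...   | a₁ , a₂ , sa₁ , sa₂ , a≗ with sums-complete (i ℕ.∸ j) sa₁
      ...   | s , s∈ , a₁≗ = place (i ℕ.∸ j) s j 0 {a₁} {a₂} {n} e≤c a₁≗ (∈-++⁺ˡ s∈)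
                (subst (λ l → SpanN as l a₂) (sym (ℕ.+-identityʳ j)) sa₂) sn
                (λ c → trans (cong (_+ n c) (a≗ c)) (+-assoc (a₁ c) (a₂ c) (n c)))
                (subst (0ℤ ≤_) (trans fx value) fx≥0)
        where
        arrange : ∀ c e j B → c + (e + j) * B + j * - B ≡ c + e * B
        arrange = solve-∀
        value : c₀ + + i * B + + j * - B ≡ c₀ + dot f s
        value = trans (cong (λ l → c₀ + l * B + + j * - B) (trans (cong +_ (sym (ℕ.m∸n+n≡m j≤i))) (pos-+ (i ℕ.∸ j) j)))
          (trans (arrange c₀ (+ (i ℕ.∸ j)) (+ j) B)
            (cong (λ u → c₀ + u) (sym (spanN-value f B as≡ (i ℕ.∸ j) (sums-sound (i ℕ.∸ j) s∈)))))
      by-surplus (inj₁ j≤i) | inj₂ c≤e with spanN-split ∣ c₀ ∣ {j ℕ.+ (i ℕ.∸ j ℕ.∸ ∣ c₀ ∣)}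
          (subst (λ l → SpanN as l a) count sa)
        where
        count : i ≡ ∣ c₀ ∣ ℕ.+ (j ℕ.+ (i ℕ.∸ j ℕ.∸ ∣ c₀ ∣))
        count = begin
          i                                          ≡⟨ ℕ.m+[n∸m]≡n j≤i ⟨
          j ℕ.+ (i ℕ.∸ j)                            ≡⟨ cong (j ℕ.+_) (ℕ.m+[n∸m]≡n c≤e) ⟨
          j ℕ.+ (∣ c₀ ∣ ℕ.+ (i ℕ.∸ j ℕ.∸ ∣ c₀ ∣))    ≡⟨ ℕ.+-assoc j ∣ c₀ ∣ _ ⟨
          j ℕ.+ ∣ c₀ ∣ ℕ.+ (i ℕ.∸ j ℕ.∸ ∣ c₀ ∣)      ≡⟨ cong (ℕ._+ (i ℕ.∸ j ℕ.∸ ∣ c₀ ∣)) (ℕ.+-comm j ∣ c₀ ∣) ⟩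
          ∣ c₀ ∣ ℕ.+ j ℕ.+ (i ℕ.∸ j ℕ.∸ ∣ c₀ ∣)      ≡⟨ ℕ.+-assoc ∣ c₀ ∣ j _ ⟩
          ∣ c₀ ∣ ℕ.+ (j ℕ.+ (i ℕ.∸ j ℕ.∸ ∣ c₀ ∣))    ∎
          where open ≡-Reasoning
      ...   | a₁ , a₂ , sa₁ , sa₂ , a≗ with sums-complete ∣ c₀ ∣ sa₁
      ...   | s , s∈ , a₁≗ = place ∣ c₀ ∣ s j (i ℕ.∸ j ℕ.∸ ∣ c₀ ∣) {a₁} {a₂} {n} ℕ.≤-refl a₁≗ (∈-++⁺ˡ s∈)
                sa₂ sn
                (λ c → trans (cong (_+ n c) (a≗ c)) (+-assoc (a₁ c) (a₂ c) (n c)))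
                (subst (λ u → 0ℤ ≤ c₀ + u) (sym (spanN-value f B as≡ ∣ c₀ ∣ (sums-sound ∣ c₀ ∣ s∈))) (abs-dominates c₀))
        where
        abs-dominates : ∀ c → 0ℤ ≤ c + + ∣ c ∣ * B
        abs-dominates (+ l)    = +-nonneg {+ l} (+≤+ ℕ.z≤n) (*-nonneg {+ l} {B} (+≤+ ℕ.z≤n) (+≤+ ℕ.z≤n))
        abs-dominates -[1+ l ] = subst (0ℤ ≤_) (sym (arrange′ (+ suc l) (+ b))) (*-nonneg {+ suc l} {+ b} (+≤+ ℕ.z≤n) (+≤+ ℕ.z≤n))
          where
          arrange′ : ∀ l b → - l + l * (1ℤ + b) ≡ l * b
          arrange′ = solve-∀
      by-surplus (inj₂ i≤j) with spanN-split (j ℕ.∸ i) {i} (subst (λ l → SpanN ns l n) (sym (ℕ.m∸n+n≡m i≤j)) sn)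
      ...   | n₁ , n₂ , sn₁ , sn₂ , n≗ with sums-complete (j ℕ.∸ i) sn₁
      ...   | s , s∈ , n₁≗ = place (j ℕ.∸ i) s i 0 {n₁} {a} {n₂} e≤c n₁≗ (∈-++⁺ʳ (sums (j ℕ.∸ i) as) s∈)
                (subst (λ l → SpanN as l a) (sym (ℕ.+-identityʳ i)) sa) sn₂
                (λ c → trans (cong (λ u → a c + u) (n≗ c)) (swap (a c) (n₁ c) (n₂ c)))
                (subst (λ u → 0ℤ ≤ c₀ + u) (sym (spanN-value f (- B) ns≡ (j ℕ.∸ i) (sums-sound (j ℕ.∸ i) s∈))) base≥0)
        where
        swap : ∀ a u v → a + (u + v) ≡ u + (a + v)
        swap = solve-∀
        arrange : ∀ c e i B → c + i * B + (e + i) * - B ≡ c + e * - B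
        arrange = solve-∀
        base≥0 : 0ℤ ≤ c₀ + + (j ℕ.∸ i) * - B
        base≥0 = subst (0ℤ ≤_) (trans fx (trans
          (cong (λ l → c₀ + + i * B + l * - B) (trans (cong +_ (sym (ℕ.m∸n+n≡m i≤j))) (pos-+ (j ℕ.∸ i) i)))
          (arrange c₀ (+ (j ℕ.∸ i)) (+ i) B))) fx≥0
        bound : ∀ c e → 0ℤ ≤ c + + e * - B → e ℕ.≤ ∣ c ∣
        bound c e h = drop‿+≤+ (≤-trans (diff-≤ (subst (0ℤ ≤_) (arrange′ c (+ e) (+ b)) (+-nonneg h (*-nonneg {+ e} {+ b} (+≤+ ℕ.z≤n) (+≤+ ℕ.z≤n))))) (i≤∣i∣ c))
          where
          arrange′ : ∀ c e b → c + e * - (1ℤ + b) + e * b ≡ c - e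
          arrange′ = solve-∀
        e≤c : j ℕ.∸ i ℕ.≤ ∣ c₀ ∣
        e≤c = bound c₀ (j ℕ.∸ i) base≥0

  -- Atoms are homogeneous: constants enter through coordinate 0, which the initial piece `orthant`
  -- fixes at 1. Strict inequalities between integers are written as weak ones.
  data Formula (m : ℕ) : Set where
    atom : Vℤ m → Formula m
    _and_ _or_ : Formula m → Formula m → Formula m

  ⟦_⟧ : ∀ {m} → Formula m → Vℤ m → Set
  ⟦ atom f ⟧  x = 0ℤ ≤ dot f x
  ⟦ φ and ψ ⟧ x = ⟦ φ ⟧ x × ⟦ ψ ⟧ x
  ⟦ φ or ψ ⟧  x = ⟦ φ ⟧ x ⊎ ⟦ ψ ⟧ x

  semilinear : ∀ {m} (φ : Formula m) π → Semilinear (λ x → x ∈ₚ π × ⟦ φ ⟧ x)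
  semilinear (atom f)  π = sl-atom f π
  semilinear (φ and ψ) π = sl-map (λ { x ((a , b) , c) → a , b , c }) (λ { x (a , b , c) → (a , b) , c })
    (sl-refine (semilinear φ π) (semilinear ψ))
  semilinear (φ or ψ)  π = sl-map
    (λ { x (inj₁ (a , b)) → a , inj₁ b ; x (inj₂ (a , b)) → a , inj₂ b })
    (λ { x (a , inj₁ b) → inj₁ (a , b) ; x (a , inj₂ b) → inj₂ (a , b) })
    (sl-∪ (semilinear φ π) (semilinear ψ π))

-- Inequalities between base-t expansions as formulas in the digits.

module Carrying where

  open IntegersAndPolynomials
  open ConeDescription using (Row)
  open Semilinear
  open import Data.Nat as ℕ using (ℕ; zero; suc)
  import Data.Nat.Properties as ℕ
  open import Data.Integer hiding (suc; pred; sign; _/_; _%_)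
  open import Data.Integer.Properties hiding (suc-*)
  open import Data.Integer.DivMod using (_/ℕ_; [n/ℕd]*d≤n; n<s[n/ℕd]*d)
  open import Data.Integer.Tactic.RingSolver using (solve-∀)
  open import Data.Fin using (Fin; zero; suc)
  open import Data.List using ([]; _∷_; length)
  open import Data.Product using (∃-syntax; _×_; _,_; proj₁)
  open import Data.Sum using (inj₁; inj₂)
  open import Function using (_∘_)
  open import Relation.Nullary using (yes; no)
  open import Relation.Binary.PropositionalEquality

  -- The index runs over the integers from `- n` to `n`: an existential quantifier over a bounded
  -- carry.
  ⋁ : ∀ {m} → ℕ → (ℤ → Formula m) → Formula m
  ⋁ zero    φ = φ 0ℤ
  ⋁ (suc n) φ = (φ (+ suc n) or φ (-[1+ n ])) or ⋁ n φ

  ⋁-elim : ∀ {m} n (φ : ℤ → Formula m) {x} → ⟦ ⋁ n φ ⟧ x → ∃[ c ] ⟦ φ c ⟧ x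
  ⋁-elim zero    φ h = 0ℤ , h
  ⋁-elim (suc n) φ (inj₁ (inj₁ h)) = + suc n , h
  ⋁-elim (suc n) φ (inj₁ (inj₂ h)) = -[1+ n ] , h
  ⋁-elim (suc n) φ (inj₂ h) = ⋁-elim n φ h

  ⋁-intro : ∀ {m} n (φ : ℤ → Formula m) {x} c → ∣ c ∣ ℕ.≤ n → ⟦ φ c ⟧ x → ⟦ ⋁ n φ ⟧ x
  ⋁-intro zero    φ (+ zero) c≤n h = h
  ⋁-intro (suc n) φ (+ c) c≤n h with c ℕ.≟ suc n
  ... | yes refl = inj₁ (inj₁ h)
  ... | no  c≢   = inj₂ (⋁-intro n φ (+ c) (ℕ.s≤s⁻¹ (ℕ.≤∧≢⇒< c≤n c≢)) h)
  ⋁-intro (suc n) φ -[1+ c ] c≤n h with c ℕ.≟ n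
  ... | yes refl = inj₁ (inj₂ h)
  ... | no  c≢   = inj₂ (⋁-intro n φ -[1+ c ] (ℕ.≤∧≢⇒< (ℕ.s≤s⁻¹ c≤n) c≢) h)

  -- The index set is nonempty because `Formula` has no constant for truth.
  ⋀ : ∀ {k m} → (Fin (suc k) → Formula m) → Formula m
  ⋀ {zero}  φ = φ zero
  ⋀ {suc k} φ = φ zero and ⋀ (φ ∘ suc)

  ⋀-elim : ∀ {k m} (φ : Fin (suc k) → Formula m) {x} → ⟦ ⋀ φ ⟧ x → ∀ i → ⟦ φ i ⟧ x
  ⋀-elim {zero}  φ h       zero    = h
  ⋀-elim {suc k} φ (h , _) zero    = h
  ⋀-elim {suc k} φ (_ , h) (suc i) = ⋀-elim (φ ∘ suc) h i

  ⋀-intro : ∀ {k m} (φ : Fin (suc k) → Formula m) {x} → (∀ i → ⟦ φ i ⟧ x) → ⟦ ⋀ φ ⟧ x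
  ⋀-intro {zero}  φ h = h zero
  ⋀-intro {suc k} φ h = h zero , ⋀-intro (φ ∘ suc) (h ∘ suc)

  -- Total on `[]`, so that polynomials of different lengths shed their lowest coefficients in step.
  headP : Poly → ℤ
  headP []      = 0ℤ
  headP (a ∷ _) = a

  tailP : Poly → Poly
  tailP []      = []
  tailP (_ ∷ p) = p

  ev-headtail : ∀ p t → ev p t ≡ headP p + + t * ev (tailP p) t
  ev-headtail []      t = sym (trans (+-identityˡ (+ t * 0ℤ)) (*-zeroʳ (+ t)))
  ev-headtail (a ∷ p) t = refl

  length-tailP : ∀ {p n} → length p ℕ.≤ suc n → length (tailP p) ℕ.≤ n
  length-tailP {[]}    _ = ℕ.z≤n
  length-tailP {_ ∷ p} h = ℕ.s≤s⁻¹ h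

  -- The coordinates of x are thought of as base-t digits: coordinate 0 is the constant 1 and
  -- coordinate 1 is t itself.
  record Digits {m} (t : ℕ) (x : Vℤ (2 ℕ.+ m)) : Set where
    constructor digits
    field
      at-0  : x zero ≡ 1ℤ
      at-1  : x (suc zero) ≡ + t
      lower : ∀ i → 0ℤ ≤ x i
      upper : ∀ i → x i ≤ + t

  ∥_∥ : ∀ {m} → Vℤ m → ℤ
  ∥ a ∥ = sum (λ i → + ∣ a i ∣)

  ∥∥-nonneg : ∀ {m} (a : Vℤ m) → 0ℤ ≤ ∥ a ∥
  ∥∥-nonneg a = sum-nonneg (λ i → + ∣ a i ∣) (λ i → +≤+ ℕ.z≤n)

  0≤∣i∣+i : ∀ i → 0ℤ ≤ + ∣ i ∣ + i
  0≤∣i∣+i (+ n)    = +≤+ ℕ.z≤n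
  0≤∣i∣+i -[1+ n ] = ≤-reflexive (sym (+-inverseʳ (+ suc n)))

  -- With `b = ∣ a i ∣`, each term equals `b (s - x i) + (b + a i) x i`.
  bounded-below : ∀ {m} (a x : Vℤ m) s → (∀ i → 0ℤ ≤ x i) → (∀ i → x i ≤ s) → 0ℤ ≤ ∥ a ∥ * s + dot a x
  bounded-below {m} a x s lo hi = subst (0ℤ ≤_) (sym total) (sum-nonneg _ term)
    where
    total : ∥ a ∥ * s + dot a x ≡ sum (λ i → + ∣ a i ∣ * s + a i * x i)
    total = trans (cong (_+ dot a x) (*-distribʳ-sum s (λ i → + ∣ a i ∣)))
                  (sym (∑-distrib-+ (λ i → + ∣ a i ∣ * s) (λ i → a i * x i)))
    arrange : ∀ b a s x → b * (s - x) + (b + a) * x ≡ b * s + a * x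
    arrange = solve-∀
    term : ∀ i → 0ℤ ≤ + ∣ a i ∣ * s + a i * x i
    term i = subst (0ℤ ≤_) (arrange (+ ∣ a i ∣) (a i) s (x i))
      (+-nonneg (*-nonneg {+ ∣ a i ∣} (+≤+ ℕ.z≤n) (≤-diff (hi i))) (*-nonneg (0≤∣i∣+i (a i)) (lo i)))

  -- For `0 ≤ x i ≤ t` and `t ≥ 1` the absolute value of `dot a x + c` is at most
  -- `(∥ a ∥ + ∣ c ∣) t`, so the carry is bounded independently of `t`.
  carryBound : ∀ {m} → Vℤ m → ℤ → ℕ
  carryBound a c = ∣ ∥ a ∥ ∣ ℕ.+ ∣ c ∣

  -- Says that `c′` is the floor of `(dot a x + c) / t`. The `1ℤ` added to `c` makes the strict
  -- upper bound a weak integer inequality.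
  carryStep : ∀ {m} → Vℤ (2 ℕ.+ m) → ℤ → ℤ → Formula (2 ℕ.+ m)
  carryStep a c c′ =
    atom (1ℤ *ᵥ (1ℤ *ᵥ a +ᵥ c *ᵥ e zero) +ᵥ - c′ *ᵥ e (suc zero)) and
    atom (1ℤ *ᵥ (- 1ℤ *ᵥ a +ᵥ - (c + 1ℤ) *ᵥ e zero) +ᵥ (1ℤ + c′) *ᵥ e (suc zero))

  -- The formula expressing 0 ≤ c + Σᵢ Aᵢ(t) xᵢ, where n bounds the lengths of the Aᵢ. The carry
  -- passed to the next digit is the quotient by t of the value of the lowest one.
  carry : ∀ {m} → ℕ → ℤ → Row (2 ℕ.+ m) → Formula (2 ℕ.+ m)
  carry zero    c A = atom (c *ᵥ e zero)
  carry {m} (suc n) c A = ⋁ (carryBound (headP ∘ A) c) λ c′ → carryStep {m} (headP ∘ A) c c′ and carry n c′ (tailP ∘ A)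
    
  module _ {m} {t : ℕ} {x : Vℤ (2 ℕ.+ m)} (t>0 : 0 ℕ.< t) (D : Digits t x) where
    open Digits D

    lin : ∀ u a v c w → dot (u *ᵥ (v *ᵥ a +ᵥ c *ᵥ e zero) +ᵥ w *ᵥ e (suc zero)) x ≡ u * (v * dot a x + c * 1ℤ) + w * + t
    lin u a v c w = trans (dot-lin′ x u (v *ᵥ a +ᵥ c *ᵥ e zero) w (e (suc zero))) (cong₂ (λ p q → u * p + w * q)
      (trans (dot-lin′ x v a c (e zero)) (cong (λ q → v * dot a x + c * q) (trans (dot-e zero x) at-0)))
      (trans (dot-e (suc zero) x) at-1))

    carryStep⇒ : ∀ a c c′ → ⟦ carryStep a c c′ ⟧ x →
      0ℤ ≤ dot a x + c - c′ * + t × 0ℤ < (1ℤ + c′) * + t - (dot a x + c)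
    carryStep⇒ a c c′ (p , q) = subst (0ℤ ≤_) (trans (lin 1ℤ a 1ℤ c (- c′)) (arr₁ (dot a x) c c′ (+ t))) p ,
      suc[i]≤j⇒i<j (subst (1ℤ ≤_) (arr₂ (dot a x) c c′ (+ t)) (+-monoʳ-≤ 1ℤ (subst (0ℤ ≤_) (lin 1ℤ a (- 1ℤ) (- (c + 1ℤ)) (1ℤ + c′)) q)))
      where
      arr₁ : ∀ s c c′ t → 1ℤ * (1ℤ * s + c * 1ℤ) + - c′ * t ≡ s + c - c′ * t
      arr₁ = solve-∀
      arr₂ : ∀ s c c′ t → 1ℤ + (1ℤ * (- 1ℤ * s + - (c + 1ℤ) * 1ℤ) + (1ℤ + c′) * t) ≡ (1ℤ + c′) * t - (s + c)
      arr₂ = solve-∀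

    carryStep⇐ : ∀ a c c′ → 0ℤ ≤ dot a x + c - c′ * + t → 0ℤ < (1ℤ + c′) * + t - (dot a x + c) →
      ⟦ carryStep a c c′ ⟧ x
    carryStep⇐ a c c′ p q = subst (0ℤ ≤_) (sym (trans (lin 1ℤ a 1ℤ c (- c′)) (arr₁ (dot a x) c c′ (+ t)))) p ,
      subst (0ℤ ≤_) (sym (trans (lin 1ℤ a (- 1ℤ) (- (c + 1ℤ)) (1ℤ + c′)) (arr₂ (dot a x) c c′ (+ t)))) (≤-diff (<⇒1≤ q))
      where
      arr₁ : ∀ s c c′ t → 1ℤ * (1ℤ * s + c * 1ℤ) + - c′ * t ≡ s + c - c′ * t
      arr₁ = solve-∀
      arr₂ : ∀ s c c′ t → 1ℤ * (- 1ℤ * s + - (c + 1ℤ) * 1ℤ) + (1ℤ + c′) * t ≡ (1ℤ + c′) * t - (s + c) - 1ℤ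
      arr₂ = solve-∀

    -- With `B` the carry bound, `c′ t ≤ dot a x + c ≤ B t` bounds `c′` above, and
    -- `- B t ≤ dot a x + c < (1 + c′) t` bounds it below.
    quotient-bound : ∀ a c c′ → 0ℤ ≤ dot a x + c - c′ * + t → 0ℤ < (1ℤ + c′) * + t - (dot a x + c) →
      ∣ c′ ∣ ℕ.≤ carryBound a c
    quotient-bound a c c′ p q = abs-≤ c′
        (diff-≤ (*-nonneg⁻¹ (+<+ t>0) (subst (0ℤ ≤_) (arr₁ (dot a x) c c′ (+ t) B) (+-nonneg p upper′))))
        (<⇒1≤ (*-pos⁻¹ {+ t} (+≤+ ℕ.z≤n) (subst (0ℤ <_) (arr₂ (dot a x) c c′ (+ t) B) (+-pos-nonneg q lower′))))
      where
      B = + carryBound a c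
      B≡ : B ≡ ∥ a ∥ + + ∣ c ∣
      B≡ = trans (pos-+ ∣ ∥ a ∥ ∣ ∣ c ∣) (cong (_+ + ∣ c ∣) (0≤i⇒+∣i∣≡i (∥∥-nonneg a)))
      arr₁ : ∀ s c c′ t B → s + c - c′ * t + (B * t - (s + c)) ≡ t * (B - c′)
      arr₁ = solve-∀
      arr₂ : ∀ s c c′ t B → (1ℤ + c′) * t - (s + c) + (B * t + (s + c)) ≡ t * (1ℤ + c′ + B)
      arr₂ = solve-∀
      arr₃ : ∀ n b t s c → n * t + s + b * (t - 1ℤ) + (b + c) ≡ (n + b) * t + (s + c)
      arr₃ = solve-∀
      arr₄ : ∀ n b t s c → n * t + - s + b * (t - 1ℤ) + (b + - c) ≡ (n + b) * t - (s + c)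
      arr₄ = solve-∀
      t-1≥0 : 0ℤ ≤ + t - 1ℤ
      t-1≥0 = ≤-diff (<⇒1≤ (+<+ t>0))
      lower′ : 0ℤ ≤ B * + t + (dot a x + c)
      lower′ = subst (λ B → 0ℤ ≤ B * + t + (dot a x + c)) (sym B≡) (subst (0ℤ ≤_) (arr₃ ∥ a ∥ (+ ∣ c ∣) (+ t) (dot a x) c)
        (+-nonneg (+-nonneg (bounded-below a x (+ t) lower upper) (*-nonneg {+ ∣ c ∣} (+≤+ ℕ.z≤n) t-1≥0)) (0≤∣i∣+i c)))
      -a : Vℤ (2 ℕ.+ m)
      -a i = -1ℤ * a i
      ∥-a∥ : ∥ -a ∥ ≡ ∥ a ∥
      ∥-a∥ = sum-cong-≗ (λ i → cong +_ (trans (cong ∣_∣ (-1*i≡-i (a i))) (∣-i∣≡∣i∣ (a i))))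
      dot-a : dot -a x ≡ - dot a x
      dot-a = trans (dot-comm -a x) (trans (dot-* x -1ℤ a) (trans (-1*i≡-i _) (cong -_ (dot-comm x a))))
      upper′ : 0ℤ ≤ B * + t - (dot a x + c)
      upper′ = subst (λ B → 0ℤ ≤ B * + t - (dot a x + c)) (sym B≡) (subst (0ℤ ≤_) (arr₄ ∥ a ∥ (+ ∣ c ∣) (+ t) (dot a x) c)
        (+-nonneg (+-nonneg (subst (0ℤ ≤_) (cong₂ (λ u v → u * + t + v) ∥-a∥ dot-a) (bounded-below -a x (+ t) lower upper))
          (*-nonneg {+ ∣ c ∣} (+≤+ ℕ.z≤n) t-1≥0))
          (subst (λ u → 0ℤ ≤ + u + - c) (∣-i∣≡∣i∣ c) (0≤∣i∣+i (- c)))))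
      abs-≤ : ∀ c′ {B} → c′ ≤ + B → 1ℤ ≤ 1ℤ + c′ + + B → ∣ c′ ∣ ℕ.≤ B
      abs-≤ (+ n)    (+≤+ h) _ = h
      abs-≤ -[1+ n ] {B} _ h = drop‿+≤+ (diff-≤ (subst (0ℤ ≤_) (arr₅ (+ suc n) (+ B)) (≤-diff h)))
        where
        arr₅ : ∀ n B → 1ℤ + - n + B - 1ℤ ≡ B - n
        arr₅ = solve-∀

    carry-value : ∀ c (A : Row (2 ℕ.+ m)) → c + dot (evs A t) x ≡
      (dot (headP ∘ A) x + c) + + t * dot (evs (tailP ∘ A) t) x
    carry-value c A = trans (cong (λ u → c + u) (trans (dot-congˡ x pointwise) (dot-lin′ x 1ℤ (headP ∘ A) (+ t) (evs (tailP ∘ A) t))))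
        (arrange c (dot (headP ∘ A) x) (+ t * dot (evs (tailP ∘ A) t) x))
      where
      pointwise : ∀ i → ev (A i) t ≡ 1ℤ * headP (A i) + + t * ev (tailP (A i)) t
      pointwise i = trans (ev-headtail (A i) t) (cong (_+ + t * ev (tailP (A i)) t) (sym (*-identityˡ (headP (A i)))))
      arrange : ∀ c s u → c + (1ℤ * s + u) ≡ (s + c) + u
      arrange = solve-∀

    carry-zero : ∀ c A → (∀ i → length (A i) ℕ.≤ 0) → dot (c *ᵥ e zero) x ≡ c + dot (evs A t) x
    carry-zero c A len = begin
      dot (c *ᵥ e zero) x     ≡⟨ dot-comm (c *ᵥ e zero) x ⟩
      dot x (c *ᵥ e zero)     ≡⟨ dot-* x c (e zero) ⟩
      c * dot x (e zero)      ≡⟨ cong (c *_) (trans (dot-comm x (e zero)) (trans (dot-e zero x) at-0)) ⟩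
      c * 1ℤ                  ≡⟨ trans (*-identityʳ c) (sym (+-identityʳ c)) ⟩
      c + 0ℤ                  ≡⟨ cong (λ u → c + u) (dot-0 x (λ i → empty (A i) (len i))) ⟨
      c + dot x (evs A t)     ≡⟨ cong (λ u → c + u) (dot-comm x (evs A t)) ⟩
      c + dot (evs A t) x     ∎
      where
      open ≡-Reasoning
      empty : ∀ p → length p ℕ.≤ 0 → ev p t ≡ 0ℤ
      empty [] _ = refl

    -- Let `S` be the contribution of the lowest coefficients and `V` that of the tails. From
    -- `c′ t ≤ S` follows `t (c′ + V) ≤ S + t V`.
    carry⇒ : ∀ n c A → (∀ i → length (A i) ℕ.≤ n) → ⟦ carry n c A ⟧ x → 0ℤ ≤ c + dot (evs A t) x
    carry⇒ zero c A len h = subst (0ℤ ≤_) (carry-zero c A len) h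
    carry⇒ (suc n) c A len h =
      let c′ , step , rest = ⋁-elim (carryBound (headP ∘ A) c) (λ c′ → carryStep (headP ∘ A) c c′ and carry n c′ (tailP ∘ A)) h
      in subst (0ℤ ≤_) (trans (arrange (dot (headP ∘ A) x + c) c′ (+ t) V) (sym (carry-value c A)))
        (+-nonneg (proj₁ (carryStep⇒ (headP ∘ A) c c′ step))
          (*-nonneg {+ t} (+≤+ ℕ.z≤n) (carry⇒ n c′ (tailP ∘ A) (λ i → length-tailP {A i} (len i)) rest)))
      where
      V = dot (evs (tailP ∘ A) t) x
      arrange : ∀ S c′ t V → S - c′ * t + t * (c′ + V) ≡ S + t * V
      arrange = solve-∀

    -- From `S < (1 + c′) t` and `0 ≤ S + t V` follows `0 < t (1 + c′ + V)`, and `V` is an integer,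
    -- so `0 ≤ c′ + V`.
    carry⇐ : ∀ n c A → (∀ i → length (A i) ℕ.≤ n) → 0ℤ ≤ c + dot (evs A t) x → ⟦ carry n c A ⟧ x
    carry⇐ zero c A len h = subst (0ℤ ≤_) (sym (carry-zero c A len)) h
    carry⇐ (suc n) c A len h = ⋁-intro (carryBound (headP ∘ A) c) (λ c′ → carryStep (headP ∘ A) c c′ and carry n c′ (tailP ∘ A)) c′ (quotient-bound (headP ∘ A) c c′ p q)
        (carryStep⇐ (headP ∘ A) c c′ p q , carry⇐ n c′ (tailP ∘ A) (λ i → length-tailP {A i} (len i)) rest)
      where
      instance _ = ℕ.>-nonZero t>0
      S = dot (headP ∘ A) x + c
      V = dot (evs (tailP ∘ A) t) x
      c′ = S /ℕ t
      p : 0ℤ ≤ S - c′ * + t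
      p = ≤-diff ([n/ℕd]*d≤n S t)
      q : 0ℤ < (1ℤ + c′) * + t - S
      q = <-diff (n<s[n/ℕd]*d S t)
      arrange : ∀ S c′ t V → S + t * V + ((1ℤ + c′) * t - S) ≡ t * (1ℤ + (c′ + V))
      arrange = solve-∀
      rest : 0ℤ ≤ c′ + V
      rest = subst (0ℤ ≤_) (arrange′ (c′ + V)) (≤-diff (<⇒1≤ (*-pos⁻¹ {+ t} (+≤+ ℕ.z≤n) (subst (0ℤ <_) (arrange S c′ (+ t) V)
        (+-mono-≤-< (subst (0ℤ ≤_) (carry-value c A) h) q)))))
        where
        arrange′ : ∀ z → 1ℤ + z - 1ℤ ≡ z
        arrange′ = solve-∀

-- Convex hulls of the slices of a semilinear set.

module Hulls where

  open IntegersAndPolynomials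
  open ConeDescription using (Row)
  open Semilinear
  open import Data.Nat as ℕ using (ℕ; zero; suc)
  import Data.Nat.Properties as ℕ
  open import Data.Nat.DivMod using (_/_; _%_; m≡m%n+[m/n]*n; [m+kn]%n≡m%n; m∣n⇒o%n%m≡o%m; /-monoˡ-≤)
  open import Data.Nat.Divisibility using (_∣_; divides)
  open import Data.Integer hiding (suc; pred; sign; _/_; _%_)
  open import Data.Integer.Properties
  open import Data.Integer.Tactic.RingSolver using (solve-∀)
  open import Data.Fin using (Fin; zero; suc)
  open import Data.List using (List; []; _∷_; _++_; map; tabulate)
  open import Data.List.Relation.Unary.All as All using (All; []; _∷_)
  import Data.List.Relation.Unary.All.Properties as All
  open import Data.List.Relation.Unary.Any as Any using (Any; here; there)
  open import Data.List.Membership.Propositional using (_∈_; find; lose)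
  open import Data.Product using (Σ-syntax; ∃-syntax; _×_; _,_; proj₁; proj₂)
  open import Data.Sum using (_⊎_; inj₁; inj₂; [_,_]′)
  open import Data.Empty using (⊥)
  open import Function using (_∘_)
  open import Relation.Nullary using (yes; no; contradiction)
  open import Relation.Binary.PropositionalEquality

  -- A curve (L , G) stands for the quasi-polynomial point G / L.
  Curve : ℕ → Set
  Curve N = ℤ × Row N

  OnCurve : ∀ {N} → (ℕ → Vℤ N → Set) → ℕ → Curve N → Set
  OnCurve S t (L , G) = ∃[ u ] S t u × 0ℤ < L × (∀ c → ev (G c) t ≡ L * u c)

  -- By duality the second component says that S t lies in the convex hull of the curves.
  HullAt : ∀ {N} → (ℕ → Vℤ N → Set) → List (Curve N) → ℕ → Set
  HullAt S cs t = All (OnCurve S t) cs ×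
    (∀ F → All (λ (L , G) → 0ℤ ≤ dot F (evs G t)) cs → ∀ u → S t u → 0ℤ ≤ dot F u)

  -- The period is `suc d`. The residue `r` runs over all of ℕ; values beyond the period are never
  -- attained and are served vacuously.
  Hull : ∀ {N} → (ℕ → Vℤ N → Set) → Set
  Hull {N} S = ∃[ d ] ∀ r → Σ[ cs ∈ List (Curve N) ] Eventually (λ t → t % suc d ≡ r → HullAt S cs t)

  hull-map : ∀ {N} {S S′ : ℕ → Vℤ N → Set} → Eventually (λ t → ∀ u → (S t u → S′ t u) × (S′ t u → S t u)) →
    Hull S → Hull S′
  hull-map h (d , f) = d , λ r → let cs , k = f r in cs ,
    mapᴱ (λ { t (eq , at) t%d → let sound , complete = at t%d in
        All.map (λ { (u , s , rest) → u , proj₁ (eq u) s , rest }) sound ,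
        λ F F≥0 u s′ → complete F F≥0 u (proj₂ (eq u) s′) }) (h ∧ᴱ k)

  hull-∪ : ∀ {N} {S S′ : ℕ → Vℤ N → Set} → Hull S → Hull S′ → Hull (λ t u → S t u ⊎ S′ t u)
  -- The predecessor of the product `suc d * suc d′`, a common multiple of both periods.
  hull-∪ (d , f) (d′ , f′) = d′ ℕ.+ d ℕ.* suc d′ , λ r →
    let cs , h = f (r % suc d) ; cs′ , h′ = f′ (r % suc d′) in cs ++ cs′ ,
    mapᴱ (λ { t (k , k′) refl →
        let sound , complete = k (sym (m∣n⇒o%n%m≡o%m (suc d) (suc d ℕ.* suc d′) t (divides (suc d′) (ℕ.*-comm (suc d) (suc d′)))))
            sound′ , complete′ = k′ (sym (m∣n⇒o%n%m≡o%m (suc d′) (suc d ℕ.* suc d′) t (divides (suc d) refl)))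
        in All.++⁺ (All.map (λ { (u , s , rest) → u , inj₁ s , rest }) sound)
                   (All.map (λ { (u , s , rest) → u , inj₂ s , rest }) sound′) ,
           λ F F≥0 u → [ complete F (All.++⁻ˡ cs F≥0) u , complete′ F (All.++⁻ʳ cs F≥0) u ]′ }) (h ∧ᴱ h′)

  hull-⋃ : ∀ {N} {A : Set} {S : A → ℕ → Vℤ N → Set} (as : List A) → (∀ {a} → a ∈ as → Hull (S a)) →
    Hull (λ t u → Any (λ a → S a t u) as)
  hull-⋃ []       f = 0 , λ r → [] , pureᴱ (λ t _ → [] , λ { F _ u () })
  hull-⋃ (a ∷ as) f = hull-map
    (pureᴱ λ t u → [ here , there ]′ , (λ { (here p) → inj₁ p ; (there p) → inj₂ p }))
    (hull-∪ (f (here refl)) (hull-⋃ as (f ∘ there)))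

  archimedean : ∀ a b → (∀ n → 0ℤ ≤ a + + n * b) → 0ℤ ≤ b
  archimedean a (+ k)    h = +≤+ ℕ.z≤n
  archimedean a -[1+ k ] h = contradiction
      (+-mono-≤ (subst (0ℤ ≤_) (arrange a (+ ∣ a ∣) (+ k)) (+-nonneg (≤-diff (i≤∣i∣ a)) (h (suc ∣ a ∣))))
                (*-nonneg {+ k} {+ suc ∣ a ∣} (+≤+ ℕ.z≤n) (+≤+ ℕ.z≤n)))
      (λ h → absurd (subst (0ℤ ≤_) (arrange′ (+ k * + suc ∣ a ∣)) h))
    where
    arrange : ∀ a b k → (b - a) + (a + (1ℤ + b) * - (1ℤ + k)) ≡ -1ℤ + - (k * (1ℤ + b))
    arrange = solve-∀
    arrange′ : ∀ z → -1ℤ + - z + z ≡ -1ℤ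
    arrange′ = solve-∀
    absurd : 0ℤ ≤ -1ℤ → ⊥
    absurd ()

  orthant : ∀ {m} → Piece (2 ℕ.+ m)
  orthant = e zero , tabulate (λ i → e (suc i))

  ∈-orthant : ∀ {m} {x : Vℤ (2 ℕ.+ m)} → x zero ≡ 1ℤ → (∀ i → 0ℤ ≤ x i) → x ∈ₚ orthant
  ∈-orthant {x = x} x₀ x≥0 = _ , span-sum (λ i → e (suc i)) (λ i → ∣ x (suc i) ∣) , λ c → begin
      x c                                                                 ≡⟨ dot-e c x ⟨
      dot (e c) x                                                         ≡⟨ dot-comm (e c) x ⟩
      sum (λ i → x i * e c i)                                             ≡⟨ sum-cong-≗ (λ i → cong (x i *_) (e-sym c i)) ⟩
      x zero * e zero c + sum (λ i → x (suc i) * e (suc i) c)             ≡⟨ cong₂ _+_ (trans (cong (_* e zero c) x₀) (*-identityˡ (e zero c)))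
                                                                               (sum-cong-≗ (λ i → cong (_* e (suc i) c) (sym (0≤i⇒+∣i∣≡i (x≥0 (suc i)))))) ⟩
      e zero c + sum (λ i → + ∣ x (suc i) ∣ * e (suc i) c)                ∎
    where open ≡-Reasoning

  orthant-zero : ∀ {m} {x : Vℤ (2 ℕ.+ m)} → x ∈ₚ orthant → x zero ≡ 1ℤ
  orthant-zero {x = x} (y , (k , s) , x≗) = trans (x≗ zero) (cong (λ v → 1ℤ + v) (begin
      y zero             ≡⟨ dot-e zero y ⟨
      dot (e zero) y     ≡⟨ spanN-value (e zero) 0ℤ (All.tabulate⁺ {f = λ i → e (suc i)} (λ i → dot-e zero (e (suc i)))) k s ⟩
      + k * 0ℤ           ≡⟨ *-zeroʳ (+ k) ⟩
      0ℤ                 ∎))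
    where open ≡-Reasoning

  module _ {m N : ℕ} (Mat : Fin N → Row (2 ℕ.+ m)) where
    private
      V = Vℤ (2 ℕ.+ m)
      one : Fin (2 ℕ.+ m)
      one = suc zero

    apply : ℕ → V → Vℤ N
    apply t x c = dot (evs (Mat c) t) x

    -- Points of `P` at height `t` are mapped by a matrix depending on `t`. At fixed `t` the map is
    -- linear, so hulls may be computed among the digit vectors; its entries are polynomials, so
    -- polynomial vertices remain polynomial.
    Image : (V → Set) → ℕ → Vℤ N → Set
    Image P t u = ∃[ x ] P x × x one ≡ + t × u ≗ apply t x

    Boxed : V → Set
    Boxed x = ∀ i → 0ℤ ≤ x i × 0ℤ ≤ x one - x i

    boxed-resp : ∀ {x y} → x ≗ y → Boxed x → Boxed y
    boxed-resp eq b i = subst (0ℤ ≤_) (eq i) (proj₁ (b i)) , subst (0ℤ ≤_) (cong₂ _-_ (eq one) (eq i)) (proj₂ (b i))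

    -- The transpose of `apply`, through which a functional on the image is tested on digit vectors.
    adjoint : ℕ → Vℤ N → V
    adjoint t F i = dot F (λ c → ev (Mat c i) t)

    dot-apply : ∀ t F x → dot F (apply t x) ≡ dot (adjoint t F) x
    dot-apply t F x = begin
      dot F (apply t x)                                ≡⟨ dot-congʳ F (λ c → dot-comm (evs (Mat c) t) x) ⟩
      dot F (λ c → sum (λ i → x i * ev (Mat c i) t))   ≡⟨ dot-sum F x (λ i c → ev (Mat c i) t) ⟩
      sum (λ i → x i * adjoint t F i)                  ≡⟨ dot-comm x (adjoint t F) ⟩
      dot (adjoint t F) x                              ∎
      where open ≡-Reasoning

    -- With all generators at height 0 or L, those at height 0 vanish since the piece is boxed, so
    -- the slice at height t is a dilated simplex with vertices p + q h.
    simplex-hull : ∀ b p (hs : List V) → (∀ {y} → Span hs y → Boxed (p +ᵥ y)) →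
      All (λ h → Trit (+ suc b) (dot (e one) h)) hs → Hull (Image (_∈ₚ (p , hs)))
    -- Every height in the piece is congruent to `κ`, the height of `p`, so on other residues the
    -- slice is empty and no curve is listed.
    simplex-hull b p hs boxed trits = b , λ r → curves r (r ℕ.≟ κ % suc b)
      where
      L = + suc b
      open Classes (classify (e one) L hs trits)
      κ = ∣ p one ∣
      κ≡ : + κ ≡ p one
      κ≡ = 0≤i⇒+∣i∣≡i (subst (0ℤ ≤_) (+-identityʳ (p one)) (proj₁ (boxed span-0 one)))

      -- The whole ray `p + n h` is boxed, which forces the same inequalities on its direction `h`.
      gen≥0 : ∀ {h} → h ∈ hs → ∀ i → 0ℤ ≤ h i
      gen≥0 {h} h∈ i = archimedean (p i) (h i) (λ n → proj₁ (boxed (span-* n (span-∈ h∈)) i))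
      gen≤ : ∀ {h} → h ∈ hs → ∀ i → 0ℤ ≤ h one - h i
      gen≤ {h} h∈ i = archimedean (p one - p i) (h one - h i)
          (λ n → subst (0ℤ ≤_) (arrange (p one) (p i) (h one) (h i) (+ n)) (proj₂ (boxed (span-* n (span-∈ h∈)) i)))
        where
        arrange : ∀ p q h k n → (p + n * h) - (q + n * k) ≡ p - q + n * (h - k)
        arrange = solve-∀
      z≗0 : ∀ k {z} → SpanN zs k z → z ≗ 0ᵥ
      z≗0 zero    s = s
      z≗0 (suc k) {z} (h , y , h∈ , s , eq) i = trans (eq i) (cong₂ _+_ h≡0 (z≗0 k s i))
        where
        h≡0 : h i ≡ 0ℤ
        h≡0 = ≤-antisym (diff-≤ (subst (λ u → 0ℤ ≤ u - h i) (trans (sym (dot-e one h)) (All.lookup zs≡ h∈)) (gen≤ (zs⊆ h∈) i)))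
                        (gen≥0 (zs⊆ h∈) i)
      n≗0 : ∀ k {n} → SpanN ns k n → n ≗ 0ᵥ
      n≗0 zero    s = s
      n≗0 (suc k) (h , y , h∈ , _) with subst (0ℤ ≤_) (trans (sym (dot-e one h)) (All.lookup ns≡ h∈)) (gen≥0 (ns⊆ h∈) one)
      ... | ()
      slice : ∀ {x} → x ∈ₚ (p , hs) → ∃[ i ] ∃[ a ] SpanN as i a × x ≗ p +ᵥ a
      slice {x} (y , sy , x≗) with decompose sy
      ... | z , a , n , i , j , (k , sz) , sa , sn , y≗ = i , a , sa , x≗′
        where
        x≗′ : ∀ c → x c ≡ p c + a c
        x≗′ c rewrite x≗ c | y≗ c | z≗0 k sz c | n≗0 j sn c = cong (λ u → p c + u) (trans (+-identityˡ _) (+-identityʳ (a c)))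
      height : ∀ {t i a x} → SpanN as i a → x ≗ p +ᵥ a → x one ≡ + t → t ≡ κ ℕ.+ i ℕ.* suc b
      height {t} {i} {a} {x} sa x≗ x≡ = +-injective (begin
        + t                       ≡⟨ x≡ ⟨
        x one                     ≡⟨ x≗ one ⟩
        p one + a one             ≡⟨ cong₂ _+_ (sym κ≡) (trans (sym (dot-e one a)) (spanN-value (e one) L as≡ i sa)) ⟩
        + κ + + i * L             ≡⟨ cong (λ u → + κ + u) (pos-* i (suc b)) ⟨
        + κ + + (i ℕ.* suc b)     ≡⟨ pos-+ κ (i ℕ.* suc b) ⟨
        + (κ ℕ.+ i ℕ.* suc b)     ∎)
        where open ≡-Reasoning

      -- `L (p + q h)` with `q = (t - κ) / L` substituted: a polynomial of degree at most 1 in `t`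
      -- with integral coefficients.
      point : V → Row (2 ℕ.+ m)
      point h i = (L * p i - + κ * h i) ∷ h i ∷ []
      curve : V → Curve N
      curve h = L , λ c → dotP (Mat c) (point h)

      ev-curve : ∀ h {t} q → t ≡ κ ℕ.+ q ℕ.* suc b → ∀ c → ev (proj₂ (curve h) c) t ≡ L * apply t (p +ᵥ + q *ᵥ h) c
      ev-curve h {t} q t≡ c = trans (ev-dotP (Mat c) (point h) t) (trans (dot-congʳ (evs (Mat c) t) pointwise) (dot-* (evs (Mat c) t) L (p +ᵥ + q *ᵥ h)))
        where
        arrange : ∀ L p κ h q → (L * p - κ * h) + (κ + q * L) * (h + (κ + q * L) * 0ℤ) ≡ L * (p + q * h)
        arrange = solve-∀
        pointwise : ∀ i → (L * p i - + κ * h i) + + t * (h i + + t * 0ℤ) ≡ L * (p i + + q * h i)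
        pointwise i = trans (cong (λ u → (L * p i - + κ * h i) + u * (h i + u * 0ℤ))
            (trans (cong +_ t≡) (trans (pos-+ κ _) (cong (λ u → + κ + u) (pos-* q (suc b))))))
          (arrange L (p i) (+ κ) (h i) (+ q))

      sound : ∀ {t h} → κ ℕ.≤ t → t % suc b ≡ κ % suc b → h ∈ as → OnCurve (Image (_∈ₚ (p , hs))) t (curve h)
      sound {t} {h} κ≤t t%b h∈ = apply t x , (x , (+ q *ᵥ h , span-* q (span-∈ (as⊆ h∈)) , λ _ → refl) , x-one , λ _ → refl) ,
          +<+ ℕ.z<s , ev-curve h q t≡
        where
        q = t / suc b ℕ.∸ κ / suc b
        x = p +ᵥ + q *ᵥ h
        t≡ : t ≡ κ ℕ.+ q ℕ.* suc b
        t≡ = begin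
          t                                                          ≡⟨ m≡m%n+[m/n]*n t (suc b) ⟩
          t % suc b ℕ.+ t / suc b ℕ.* suc b                          ≡⟨ cong₂ (λ u v → u ℕ.+ v ℕ.* suc b) t%b
                                                                         (sym (ℕ.m+[n∸m]≡n (/-monoˡ-≤ (suc b) κ≤t))) ⟩
          κ % suc b ℕ.+ (κ / suc b ℕ.+ q) ℕ.* suc b                  ≡⟨ cong (κ % suc b ℕ.+_) (ℕ.*-distribʳ-+ (suc b) (κ / suc b) q) ⟩
          κ % suc b ℕ.+ (κ / suc b ℕ.* suc b ℕ.+ q ℕ.* suc b)        ≡⟨ ℕ.+-assoc (κ % suc b) _ _ ⟨
          κ % suc b ℕ.+ κ / suc b ℕ.* suc b ℕ.+ q ℕ.* suc b          ≡⟨ cong (ℕ._+ q ℕ.* suc b) (m≡m%n+[m/n]*n κ (suc b)) ⟨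
          κ ℕ.+ q ℕ.* suc b                                          ∎
          where open ≡-Reasoning
        x-one : p one + + q * h one ≡ + t
        x-one = trans (cong₂ _+_ (sym κ≡) (trans (cong (+ q *_) (trans (sym (dot-e one h)) (All.lookup as≡ h∈))) (sym (pos-* q (suc b)))))
                      (trans (sym (pos-+ κ (q ℕ.* suc b))) (cong +_ (sym t≡)))

      complete : ∀ {t} → κ ℕ.< t → ∀ F → All (λ (L , G) → 0ℤ ≤ dot F (evs G t)) (map curve as) →
        ∀ u → Image (_∈ₚ (p , hs)) t u → 0ℤ ≤ dot F u
      complete {t} κ<t F F≥0 u (x , x∈ , x≡ , u≗) with slice x∈
      ... | i , a , sa , x≗ = subst (0ℤ ≤_) (sym F-value) (*-nonneg⁻¹ (i>0 i t≡)
            (subst (0ℤ ≤_) (arrange (+ i) (dot A p) (dot A a)) (average i sa)))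
        where
        A = adjoint t F
        t≡ = height {i = i} sa x≗ x≡
        arrange : ∀ i p a → i * a + i * p ≡ i * (p + a)
        arrange = solve-∀
        F-value : dot F u ≡ dot A p + dot A a
        F-value = begin
          dot F u              ≡⟨ dot-congʳ F u≗ ⟩
          dot F (apply t x)    ≡⟨ dot-apply t F x ⟩
          dot A x              ≡⟨ dot-congʳ A x≗ ⟩
          dot A (p +ᵥ a)       ≡⟨ dot-+ A p a ⟩
          dot A p + dot A a    ∎
          where open ≡-Reasoning
        i>0 : ∀ i → t ≡ κ ℕ.+ i ℕ.* suc b → 0ℤ < + i
        i>0 zero    t≡κ = contradiction (trans t≡κ (ℕ.+-identityʳ κ)) (ℕ.<⇒≢ κ<t ∘ sym)
        i>0 (suc i) _   = +<+ ℕ.z<s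
        vertex≥0 : ∀ {h} → h ∈ as → 0ℤ ≤ dot A p + + i * dot A h
        vertex≥0 {h} h∈ = *-nonneg⁻¹ {L} (+<+ ℕ.z<s) (subst (0ℤ ≤_) value (All.lookup (All.map⁻ F≥0) h∈))
          where
          y = p +ᵥ + i *ᵥ h
          value : dot F (evs (proj₂ (curve h)) t) ≡ L * (dot A p + + i * dot A h)
          value = begin
            dot F (evs (proj₂ (curve h)) t)   ≡⟨ dot-congʳ F (ev-curve h i t≡) ⟩
            dot F (L *ᵥ apply t y)            ≡⟨ dot-* F L (apply t y) ⟩
            L * dot F (apply t y)             ≡⟨ cong (L *_) (dot-apply t F y) ⟩
            L * dot A y                       ≡⟨ cong (L *_) (trans (dot-+ A p (+ i *ᵥ h)) (cong (λ v → dot A p + v) (dot-* A (+ i) h))) ⟩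
            L * (dot A p + + i * dot A h)     ∎
            where open ≡-Reasoning
        -- If `a` is the sum of generators `h₁, …, hᵢ`, then `p + a` is the mean of the vertices
        -- `p + i hⱼ`. The induction adds up `j` of these vertices.
        average : ∀ j {a} → SpanN as j a → 0ℤ ≤ + i * dot A a + + j * dot A p
        average zero    {a} s = ≤-reflexive (sym (trans (cong (λ v → + i * v + 0ℤ) (dot-0 A s)) (trans (+-identityʳ (+ i * 0ℤ)) (*-zeroʳ (+ i)))))
        average (suc j) {a} (h , y , h∈ , s , eq) = subst (0ℤ ≤_) value (+-nonneg (vertex≥0 h∈) (average j s))
          where
          arrange′ : ∀ i j p h y → p + i * h + (i * y + j * p) ≡ i * (h + y) + (1ℤ + j) * p
          arrange′ = solve-∀
          value : dot A p + + i * dot A h + (+ i * dot A y + + j * dot A p) ≡ + i * dot A a + + suc j * dot A p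
          value = trans (arrange′ (+ i) (+ j) (dot A p) (dot A h) (dot A y))
            (cong (λ v → + i * v + + suc j * dot A p) (sym (trans (dot-congʳ A eq) (dot-+ A h y))))

      curves : ∀ r → _ → Σ[ cs ∈ List (Curve N) ] Eventually (λ t → t % suc b ≡ r → HullAt (Image (_∈ₚ (p , hs))) cs t)
      -- The bound starts at `suc κ` because at height `κ` the slice is the point `p` alone, which
      -- no curve passes through when `as` is empty; above it `i` is positive and the mean makes
      -- sense.
      curves r (yes r≡) = map curve as , suc κ , λ t κ<t t%b →
        All.map⁺ (All.tabulate (sound (ℕ.<⇒≤ κ<t) (trans t%b r≡))) , complete κ<t
      curves r (no r≢) = [] , pureᴱ λ t t%b → [] , λ F _ u (x , x∈ , x≡ , _) →
        let i , a , sa , x≗ = slice x∈ in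
        contradiction (trans (sym t%b) (trans (cong (_% suc b) (height {i = i} sa x≗ x≡)) ([m+kn]%n≡m%n κ i (suc b)))) r≢

    -- Scaling brings the heights of all generators to 0 or plus or minus a common `suc b`. Each
    -- offset then begins a piece of its own, boxed because it lies in the given one.
    piece-hull : ∀ p (hs : List V) → (∀ {y} → Span hs y → Boxed (p +ᵥ y)) → Hull (Image (_∈ₚ (p , hs)))
    piece-hull p hs boxed with multiplier (e one) hs
    ... | b , mult = hull-map (pureᴱ λ t u → to , from)
        (hull-⋃ offsets λ {o} o∈ → simplex-hull b (p +ᵥ o) gens
          (λ {y} sy → boxed-resp (λ c → sym (+-assoc (p c) (o c) (y c)))
            (boxed (span-+ (All.lookup offsets⊆ o∈) (span-bind (All.lookup gens⊆) sy)))) good)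
      where
      open Rescaling (rescale {Q = λ h → Trit (+ suc b) (dot (e one) h)} hs mult)
      to : ∀ {t u} → Any (λ o → Image (_∈ₚ (p +ᵥ o , gens)) t u) offsets → Image (_∈ₚ (p , hs)) t u
      to a with find a
      ... | o , o∈ , x , (y , sy , x≗) , x≡ , u≗ = x , (o +ᵥ y ,
            span-+ (All.lookup offsets⊆ o∈) (span-bind (All.lookup gens⊆) sy) ,
            λ c → trans (x≗ c) (+-assoc (p c) (o c) (y c))) , x≡ , u≗
      from : ∀ {t u} → Image (_∈ₚ (p , hs)) t u → Any (λ o → Image (_∈ₚ (p +ᵥ o , gens)) t u) offsets
      from (x , (w , sw , x≗) , x≡ , u≗) with cover sw
      ... | o , y , o∈ , sy , w≗ = lose o∈ (x , (y , sy , λ c → trans (x≗ c)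
            (trans (cong (λ v → p c + v) (w≗ c)) (sym (+-assoc (p c) (o c) (y c))))) , x≡ , u≗)

    formula-hull : ∀ φ → (∀ x → ⟦ φ ⟧ x → Boxed x) → Hull (Image (λ x → x zero ≡ 1ℤ × ⟦ φ ⟧ x))
    formula-hull φ φ⇒boxed with semilinear φ orthant
    ... | pieces , eq = hull-map (pureᴱ λ t u → to , from)
        (hull-⋃ pieces λ {π} π∈ → piece-hull (proj₁ π) (proj₂ π)
          λ {y} sy → φ⇒boxed _ (proj₂ (proj₂ (eq (proj₁ π +ᵥ y)) (lose π∈ (y , sy , λ _ → refl)))))
      where
      to : ∀ {t u} → Any (λ π → Image (_∈ₚ π) t u) pieces → Image (λ x → x zero ≡ 1ℤ × ⟦ φ ⟧ x) t u
      to a with find a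
      ... | π , π∈ , x , x∈ , rest with proj₂ (eq x) (lose π∈ x∈)
      ...   | x∈orthant , φx = x , (orthant-zero x∈orthant , φx) , rest
      from : ∀ {t u} → Image (λ x → x zero ≡ 1ℤ × ⟦ φ ⟧ x) t u → Any (λ π → Image (_∈ₚ π) t u) pieces
      from (x , (x₀ , φx) , rest) = Any.map (λ x∈ → x , x∈ , rest)
        (proj₁ (eq x) (∈-orthant x₀ (λ i → proj₁ (φ⇒boxed x φx i)) , φx))

-- Lattice points of the moving polytope as digit vectors.

module Digits where

  open IntegersAndPolynomials
  open ConeDescription
  open Semilinear
  open Carrying
  open Hulls
  open import Data.Nat as ℕ using (ℕ; zero; suc)
  import Data.Nat.Properties as ℕ
  open import Data.Nat.DivMod using (_/_; _%_; m≡m%n+[m/n]*n; m%n<n; m<n*o⇒m/o<n)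
  open import Data.Integer hiding (suc; pred; sign; _/_; _%_)
  open import Data.Integer.Properties
  open import Data.Integer.Tactic.RingSolver using (solve-∀)
  open import Data.Fin using (Fin; zero; suc; toℕ; remQuot; combine; _↑ˡ_; _↑ʳ_)
  open import Data.Fin.Properties using (remQuot-combine)
  open import Data.List using (List; []; _∷_; map; length)
  open import Data.List.Properties using (length-map)
  open import Data.List.Relation.Unary.All as All using (All; []; _∷_)
  open import Data.Product using (Σ-syntax; _×_; _,_; proj₁; proj₂)
  open import Function using (_∘_)
  open import Relation.Binary.PropositionalEquality

  monomial : ℕ → Poly
  monomial zero    = K 1ℤ
  monomial (suc j) = 0ℤ ∷ monomial j

  ev-monomial : ∀ j t → ev (monomial j) t ≡ + (t ℕ.^ j)
  ev-monomial zero    t = ev-K 1ℤ t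
  ev-monomial (suc j) t = trans (+-identityˡ _) (trans (cong (+ t *_) (ev-monomial j t)) (sym (pos-* t (t ℕ.^ j))))

  -- Constant terms are peeled off in step until a bare monomial remains, positive from `t = 1` on;
  -- `large-*` then restores them one at a time.
  monomial-dominates : ∀ D p → length p ℕ.≤ D → Eventually (λ t → 0ℤ < ev (monomial D ⊕ p) t)
  monomial-dominates D [] _ = 1 , λ t 1≤t → subst (0ℤ <_)
    (sym (trans (ev-⊕ (monomial D) [] t) (trans (+-identityʳ _) (ev-monomial D t)))) (+<+ (ℕ.m^n>0 t {{ℕ.>-nonZero 1≤t}} D))
  monomial-dominates (suc D) (a ∷ p) (ℕ.s≤s h) = large-* (0ℤ + a) {monomial D ⊕ p} (monomial-dominates D p h)

  digit-expansion : ∀ E t {N} → 0 ℕ.< t → N ℕ.< t ℕ.^ E →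
    Σ[ dig ∈ (Fin E → ℕ) ] (∀ j → dig j ℕ.< t) × sum (λ j → ev (monomial (toℕ j)) t * + dig j) ≡ + N
  digit-expansion zero    t {zero} _ _ = (λ ()) , (λ ()) , refl
  digit-expansion zero    t {suc N} _ (ℕ.s≤s ())
  digit-expansion (suc E) t {N} t>0 N<
    with digit-expansion E t {(N / t) {{ℕ.>-nonZero t>0}}} t>0
           (m<n*o⇒m/o<n {{ℕ.>-nonZero t>0}} (subst (N ℕ.<_) (ℕ.*-comm t (t ℕ.^ E)) N<))
  ... | dig , dig< , eq = dig′ , dig′< , (begin
      ev (K 1ℤ) t * + (N % t) + sum (λ j → ev (monomial (suc (toℕ j))) t * + dig j)
        ≡⟨ cong₂ _+_ (trans (cong (_* + (N % t)) (ev-K 1ℤ t)) (*-identityˡ (+ (N % t))))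
             (trans (sum-cong-≗ (λ j → shift (+ t) (ev (monomial (toℕ j)) t) (+ dig j)))
                    (sym (*-distribˡ-sum (+ t) (λ j → ev (monomial (toℕ j)) t * + dig j)))) ⟩
      + (N % t) + + t * sum (λ j → ev (monomial (toℕ j)) t * + dig j)
        ≡⟨ cong (λ u → + (N % t) + + t * u) eq ⟩
      + (N % t) + + t * + (N / t)
        ≡⟨ cong (λ u → + (N % t) + u) (trans (*-comm (+ t) (+ (N / t))) (sym (pos-* (N / t) t))) ⟩
      + (N % t) + + (N / t ℕ.* t)
        ≡⟨ pos-+ (N % t) (N / t ℕ.* t) ⟨
      + (N % t ℕ.+ N / t ℕ.* t)
        ≡⟨ cong +_ (m≡m%n+[m/n]*n N t) ⟨
      + N ∎)
    where
    open ≡-Reasoning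
    instance _ = ℕ.>-nonZero t>0
    dig′ : Fin (suc E) → ℕ
    dig′ zero    = N % t
    dig′ (suc j) = dig j
    dig′< : ∀ j → dig′ j ℕ.< t
    dig′< zero    = m%n<n N t
    dig′< (suc j) = dig< j
    shift : ∀ t x d → (0ℤ + t * x) * d ≡ t * (x * d)
    shift = solve-∀

  sum-++ : ∀ a {b} (f : Fin (a ℕ.+ b) → ℤ) → sum f ≡ sum (λ i → f (i ↑ˡ b)) + sum (λ i → f (a ↑ʳ i))
  sum-++ zero    f = sym (+-identityˡ (sum f))
  sum-++ (suc a) f = trans (cong (λ u → f zero + u) (sum-++ a (f ∘ suc))) (sym (+-assoc (f zero) _ _))

  sum-combine : ∀ n E (f : Fin (n ℕ.* E) → ℤ) → sum f ≡ sum (λ c → sum (λ j → f (combine {n} {E} c j)))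
  sum-combine zero    E f = refl
  sum-combine (suc n) E f = trans (sum-++ E f) (cong (λ u → sum (λ j → f (j ↑ˡ (n ℕ.* E))) + u) (sum-combine n E (λ i → f (E ↑ʳ i))))

  sum-remQuot : ∀ n E (g : Fin n → Fin E → ℤ) →
    sum (λ i → g (proj₁ (remQuot {n} E i)) (proj₂ (remQuot {n} E i))) ≡ sum (λ c → sum (g c))
  sum-remQuot n E g = trans (sum-combine n E _) (sum-cong-≗ (λ c → sum-cong-≗ (λ j →
    cong (λ (c , j) → g c j) (remQuot-combine {n} {E} c j))))

  -- The coordinates of a lattice point u with |u c| ≤ t ^ D, written as
  -- u c = - t ^ D + Σ dig c j t ^ j with 0 ≤ dig c j < t, are linear functions of (1 , t , dig).
  module _ (n D : ℕ) where
    private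
      E = suc D

    place : Fin (suc n) → Row (2 ℕ.+ n ℕ.* E)
    place zero    i             = K (e zero i)
    place (suc c) zero          = -1ℤ ⊙ monomial D
    place (suc c) (suc zero)    = []
    place (suc c) (suc (suc i)) = e c (proj₁ (remQuot {n} E i)) ⊙ monomial (toℕ (proj₂ (remQuot {n} E i)))

    -- `u c + t ^ D` lies between 0 and `2 t ^ D`, which is below `t ^ suc D` once `t` is at least
    -- 3: hence the `suc D` digits and the bound on `t`.
    encode : ∀ {t} → 3 ℕ.≤ t → (u : Vℤ (suc n)) → u zero ≡ 1ℤ →
      (∀ c → 0ℤ ≤ u (suc c) + ev (monomial D) t × 0ℤ ≤ ev (monomial D) t - u (suc c)) →
      Σ[ x ∈ Vℤ (2 ℕ.+ n ℕ.* E) ] Digits t x × u ≗ apply place t x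
    encode {t} 3≤t u u₀ bound = x , digits refl refl lower upper , u≗
      where
      t>0 : 0 ℕ.< t
      t>0 = ℕ.≤-trans (ℕ.s≤s ℕ.z≤n) 3≤t
      N : Fin n → ℕ
      N c = ∣ u (suc c) + ev (monomial D) t ∣
      N≡ : ∀ c → + N c ≡ u (suc c) + ev (monomial D) t
      N≡ c = 0≤i⇒+∣i∣≡i (proj₁ (bound c))
      N< : ∀ c → N c ℕ.< t ℕ.^ E
      N< c = drop‿+<+ (begin-strict
          + N c                                ≤⟨ diff-≤ (subst (0ℤ ≤_) difference (proj₂ (bound c))) ⟩
          + (2 ℕ.* t ℕ.^ D)                    <⟨ +<+ (ℕ.*-monoˡ-< (t ℕ.^ D) {{ℕ.m^n≢0 t D {{ℕ.>-nonZero t>0}}}} 3≤t) ⟩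
          + (t ℕ.* t ℕ.^ D)                    ∎)
        where
        open ≤-Reasoning
        arrange : ∀ u m → m - u ≡ (1ℤ + 1ℤ) * m - (u + m)
        arrange = solve-∀
        difference : ev (monomial D) t - u (suc c) ≡ + (2 ℕ.* t ℕ.^ D) - + N c
        difference = trans (arrange (u (suc c)) (ev (monomial D) t)) (cong₂ _-_
          (trans (cong (λ v → + 2 * v) (ev-monomial D t)) (sym (pos-* 2 (t ℕ.^ D)))) (sym (N≡ c)))
      expansion : ∀ c → _
      expansion c = digit-expansion E t t>0 (N< c)
      dig : Fin n → Fin E → ℕ
      dig c = proj₁ (expansion c)
      dig< : ∀ c j → dig c j ℕ.< t
      dig< c = proj₁ (proj₂ (expansion c))
      x : Vℤ (2 ℕ.+ n ℕ.* E)
      x zero          = 1ℤ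
      x (suc zero)    = + t
      x (suc (suc i)) = + dig (proj₁ (remQuot {n} E i)) (proj₂ (remQuot {n} E i))
      lower : ∀ i → 0ℤ ≤ x i
      lower zero          = +≤+ ℕ.z≤n
      lower (suc zero)    = +≤+ ℕ.z≤n
      lower (suc (suc i)) = +≤+ ℕ.z≤n
      upper : ∀ i → x i ≤ + t
      upper zero          = +≤+ t>0
      upper (suc zero)    = ≤-refl
      upper (suc (suc i)) = +≤+ (ℕ.<⇒≤ (dig< (proj₁ (remQuot {n} E i)) (proj₂ (remQuot {n} E i))))
      u≗ : u ≗ apply place t x
      u≗ zero    = trans u₀ (sym (trans (dot-congˡ x (λ i → ev-K (e zero i) t)) (dot-e zero x)))
      u≗ (suc c) = sym (begin
          ev (-1ℤ ⊙ monomial D) t * 1ℤ + (0ℤ * + t + sum rest)  ≡⟨ cong₂ (λ v w → v * 1ℤ + (0ℤ + w)) (ev-neg (monomial D) t) total ⟩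
          - ev (monomial D) t * 1ℤ + (0ℤ + + N c)               ≡⟨ cong (λ v → - ev (monomial D) t * 1ℤ + (0ℤ + v)) (N≡ c) ⟩
          - M * 1ℤ + (0ℤ + (u (suc c) + M))                     ≡⟨ arrange M (u (suc c)) ⟩
          u (suc c)                                             ∎)
        where
        open ≡-Reasoning
        M = ev (monomial D) t
        rest : Fin (n ℕ.* E) → ℤ
        rest i = ev (place (suc c) (suc (suc i))) t * x (suc (suc i))
        arrange : ∀ M u → - M * 1ℤ + (0ℤ + (u + M)) ≡ u
        arrange = solve-∀
        total : sum rest ≡ + N c
        total = begin
          sum rest
            ≡⟨ sum-cong-≗ (λ i → trans (cong (_* x (suc (suc i))) (ev-⊙ (e c (proj₁ (remQuot {n} E i))) (monomial (toℕ (proj₂ (remQuot {n} E i)))) t))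
                 (*-assoc (e c (proj₁ (remQuot {n} E i))) (ev (monomial (toℕ (proj₂ (remQuot {n} E i)))) t) (x (suc (suc i))))) ⟩
          sum (λ i → e c (proj₁ (remQuot {n} E i)) * (ev (monomial (toℕ (proj₂ (remQuot {n} E i)))) t * + dig (proj₁ (remQuot {n} E i)) (proj₂ (remQuot {n} E i))))
            ≡⟨ sum-remQuot n E (λ c′ j → e c c′ * (ev (monomial (toℕ j)) t * + dig c′ j)) ⟩
          sum (λ c′ → sum (λ j → e c c′ * (ev (monomial (toℕ j)) t * + dig c′ j)))
            ≡⟨ sum-cong-≗ (λ c′ → sym (*-distribˡ-sum (e c c′) (λ j → ev (monomial (toℕ j)) t * + dig c′ j))) ⟩
          dot (e c) (λ c′ → sum (λ j → ev (monomial (toℕ j)) t * + dig c′ j))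
            ≡⟨ dot-e c (λ c′ → sum (λ j → ev (monomial (toℕ j)) t * + dig c′ j)) ⟩
          sum (λ j → ev (monomial (toℕ j)) t * + dig c j)
            ≡⟨ proj₂ (proj₂ (expansion c)) ⟩
          + N c ∎

  maxLength : ∀ {m} → (Fin m → Poly) → ℕ
  maxLength {zero}  A = 0
  maxLength {suc m} A = length (A zero) ℕ.⊔ maxLength (A ∘ suc)

  length≤max : ∀ {m} (A : Fin m → Poly) i → length (A i) ℕ.≤ maxLength A
  length≤max A zero    = ℕ.m≤m⊔n (length (A zero)) _
  length≤max A (suc i) = ℕ.≤-trans (length≤max (A ∘ suc) i) (ℕ.m≤n⊔m (length (A zero)) _)

  below : ∀ {m} → Fin (2 ℕ.+ m) → Vℤ (2 ℕ.+ m)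
  below i = 1ℤ *ᵥ e (suc zero) +ᵥ -1ℤ *ᵥ e i

  -- The upper bound is `t` and not `t - 1`, since coordinate 1 is `t` itself. Digit vectors are
  -- therefore not unique, but only their images under `place` count.
  boxed : ∀ {m} → Formula (2 ℕ.+ m)
  boxed = ⋀ (atom ∘ e) and ⋀ (atom ∘ below)

  boxed⇔ : ∀ {m} (x : Vℤ (2 ℕ.+ m)) → (⟦ boxed ⟧ x → ∀ i → 0ℤ ≤ x i × 0ℤ ≤ x (suc zero) - x i) ×
    ((∀ i → 0ℤ ≤ x i × 0ℤ ≤ x (suc zero) - x i) → ⟦ boxed ⟧ x)
  boxed⇔ x = (λ (p , q) i → subst (0ℤ ≤_) (dot-e i x) (⋀-elim (atom ∘ e) p i) , subst (0ℤ ≤_) (value i) (⋀-elim (atom ∘ below) q i)) ,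
    λ h → ⋀-intro (atom ∘ e) (λ i → subst (0ℤ ≤_) (sym (dot-e i x)) (proj₁ (h i))) ,
          ⋀-intro (atom ∘ below) (λ i → subst (0ℤ ≤_) (sym (value i)) (proj₂ (h i)))
    where
    arrange : ∀ a b → 1ℤ * a + -1ℤ * b ≡ a - b
    arrange = solve-∀
    value : ∀ i → dot (below i) x ≡ x (suc zero) - x i
    value i = trans (dot-lin′ x 1ℤ (e (suc zero)) -1ℤ (e i))
      (trans (cong₂ (λ u v → 1ℤ * u + -1ℤ * v) (dot-e (suc zero) x) (dot-e i x)) (arrange (x (suc zero)) (x i)))

  module _ {m N : ℕ} (Mat : Fin N → Row (2 ℕ.+ m)) where

    pullback : Row N → Row (2 ℕ.+ m)
    pullback r i = dotP r (λ c → Mat c i)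

    dot-pullback : ∀ r t x → dot (evs (pullback r) t) x ≡ dot (evs r t) (apply Mat t x)
    dot-pullback r t x = trans (dot-congˡ x (λ i → ev-dotP r (λ c → Mat c i) t)) (sym (dot-apply Mat t (evs r t) x))

    -- The conjunction ends in `boxed`, so that at height `t` every solution with coordinate 0 equal
    -- to 1 is a digit vector. Both the correctness of `carry` and the boundedness of slices in
    -- `formula-hull` rest on this.
    system : List (Row N) → Formula (2 ℕ.+ m)
    system []       = boxed
    system (r ∷ rs) = carry (maxLength (pullback r)) 0ℤ (pullback r) and system rs

    system⇒boxed : ∀ rs x → ⟦ system rs ⟧ x → Boxed Mat x
    system⇒boxed []       x h       = proj₁ (boxed⇔ x) h
    system⇒boxed (r ∷ rs) x (_ , h) = system⇒boxed rs x h

    system⇒ : ∀ {t x} → 0 ℕ.< t → Digits t x → ∀ rs → ⟦ system rs ⟧ x → All (NonnegAt t (apply Mat t x)) rs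
    system⇒ t>0 D []       h       = []
    system⇒ {t} {x} t>0 D (r ∷ rs) (h , k) =
      subst (0ℤ ≤_) (trans (+-identityˡ _) (dot-pullback r t x)) (carry⇒ t>0 D _ 0ℤ (pullback r) (length≤max (pullback r)) h)
      ∷ system⇒ t>0 D rs k

    system⇐ : ∀ {t x} → 0 ℕ.< t → Digits t x → ∀ rs → All (NonnegAt t (apply Mat t x)) rs → ⟦ system rs ⟧ x
    system⇐ {t} {x} t>0 (digits x₀ x₁ lo hi) [] h = proj₂ (boxed⇔ x) (λ i → lo i , subst (λ v → 0ℤ ≤ v - x i) (sym x₁) (≤-diff (hi i)))
    system⇐ {t} {x} t>0 D (r ∷ rs) (h ∷ hs) =
      carry⇐ t>0 D _ 0ℤ (pullback r) (length≤max (pullback r)) (subst (0ℤ ≤_) (sym (trans (+-identityˡ _) (dot-pullback r t x))) h) ,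
      system⇐ t>0 D rs hs

  -- The functionals `t ^ D * y zero + y c` and `t ^ D * y zero - y c` are nonnegative on all
  -- generators, so every lattice point at `u zero ≡ 1ℤ` has coordinates of absolute value at most
  -- `t ^ D` and is reached by digit vectors.
  polytope-hull : ∀ {k n} (G : Fin k → Row (suc n)) → Eventually (λ t → ∀ i → 0ℤ < ev (G i zero) t) →
    Hull (λ t u → u zero ≡ 1ℤ × Cone (λ i → evs (G i) t) u)
  polytope-hull {k} {n} G G>0 with hrep G
  ... | rows , H = hull-map (mapᴱ equiv ((large3 ∧ᴱ H) ∧ᴱ (G>0 ∧ᴱ dominated)))
      (formula-hull (place n D) (system (place n D) rows) (system⇒boxed (place n D) rows))
    where
    D : ℕ
    -- A maximum over `i`: `maxLength` is fed a monomial whose length is one more than the `i`-th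
    -- bound, so `D` strictly exceeds every coefficient length.
    D = maxLength {k} (λ i → monomial (maxLength (G i)))
    large3 : Eventually (3 ℕ.≤_)
    large3 = 3 , λ _ h → h
    length-monomial : ∀ j → length (monomial j) ≡ suc j
    length-monomial zero    = refl
    length-monomial (suc j) = cong suc (length-monomial j)
    length≤D : ∀ i c → length (G i c) ℕ.≤ D
    length≤D i c = ℕ.≤-trans (length≤max (G i) c) (ℕ.≤-trans (ℕ.n≤1+n _)
      (subst (ℕ._≤ D) (length-monomial (maxLength (G i))) (length≤max (λ i → monomial (maxLength (G i))) i)))
    dominated : Eventually (λ t → ∀ i c → 0ℤ < ev (monomial D ⊕ G i c) t × 0ℤ < ev (monomial D ⊕ (-1ℤ ⊙ G i c)) t)
    dominated = allFinᴱ λ i → allFinᴱ λ c → monomial-dominates D (G i c) (length≤D i c) ∧ᴱ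
      monomial-dominates D (-1ℤ ⊙ G i c) (subst (ℕ._≤ D) (sym (length-map (-1ℤ *_) (G i c))) (length≤D i c))
    Sys = ⟦ system (place n D) rows ⟧
    equiv : ∀ t → (3 ℕ.≤ t × HRep G rows t) × ((∀ i → 0ℤ < ev (G i zero) t) ×
        (∀ i c → 0ℤ < ev (monomial D ⊕ G i c) t × 0ℤ < ev (monomial D ⊕ (-1ℤ ⊙ G i c)) t)) →
      ∀ u → (Image (place n D) (λ x → x zero ≡ 1ℤ × Sys x) t u → u zero ≡ 1ℤ × Cone (λ i → evs (G i) t) u) ×
            (u zero ≡ 1ℤ × Cone (λ i → evs (G i) t) u → Image (place n D) (λ x → x zero ≡ 1ℤ × Sys x) t u)
    equiv t ((3≤t , sound , complete) , (G₀>0 , dom)) u = to , from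
      where
      t>0 : 0 ℕ.< t
      t>0 = ℕ.≤-trans (ℕ.s≤s ℕ.z≤n) 3≤t
      M = ev (monomial D) t
      to : Image (place n D) (λ x → x zero ≡ 1ℤ × Sys x) t u → _
      to (x , (x₀ , sys) , x₁ , u≗) = trans (u≗ zero) (trans (dot-congˡ x (λ i → ev-K (e zero i) t)) (trans (dot-e zero x) x₀)) ,
        complete u (All.map (λ {r} → subst (0ℤ ≤_) (dot-congʳ (evs r t) (sym ∘ u≗))) (system⇒ (place n D) t>0 D′ rows sys))
        where
        box = system⇒boxed (place n D) rows x sys
        D′ : Digits t x
        D′ = digits x₀ x₁ (proj₁ ∘ box) (λ i → diff-≤ (subst (λ v → 0ℤ ≤ v - x i) x₁ (proj₂ (box i))))
      from : u zero ≡ 1ℤ × Cone (λ i → evs (G i) t) u → _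
      from (u₀ , cone) =
        let x , D′ , u≗ = encode n D 3≤t u u₀ bound
        in x , (Digits.at-0 D′ , system⇐ (place n D) t>0 D′ rows
             (All.map (λ {r} G≥0 → subst (0ℤ ≤_) (dot-congʳ (evs r t) u≗) (cone-nonneg (evs r t) G≥0 cone)) sound)) ,
           Digits.at-1 D′ , u≗
        where
        -- The positive integer `g₀` is at least 1, so the bound `M + g > 0` survives multiplying
        -- `M` by `g₀`.
        scaled≥ : ∀ g₀ g → 0ℤ < g₀ → 0ℤ < M + g → 0ℤ ≤ M → 0ℤ ≤ M * g₀ + g
        scaled≥ g₀ g g₀>0 h M≥0 = subst (0ℤ ≤_) (arrange M g₀ g) (+-nonneg (*-nonneg M≥0 (≤-diff (<⇒1≤ g₀>0))) (<⇒≤ h))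
          where
          arrange : ∀ M g₀ g → M * (g₀ - 1ℤ) + (M + g) ≡ M * g₀ + g
          arrange = solve-∀
        M≥0 : 0ℤ ≤ M
        M≥0 = subst (0ℤ ≤_) (sym (ev-monomial D t)) (+≤+ ℕ.z≤n)
        functional : ∀ s c y → dot (M *ᵥ e zero +ᵥ s *ᵥ e (suc c)) y ≡ M * y zero + s * y (suc c)
        functional s c y = trans (dot-lin′ y M (e zero) s (e (suc c))) (cong₂ (λ v w → M * v + s * w) (dot-e zero y) (dot-e (suc c) y))
        via : ∀ s c → (∀ i → 0ℤ < M + s * ev (G i (suc c)) t) → 0ℤ ≤ M * u zero + s * u (suc c)
        via s c h = subst (0ℤ ≤_) (functional s c u) (cone-nonneg (M *ᵥ e zero +ᵥ s *ᵥ e (suc c))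
          (λ i → subst (0ℤ ≤_) (sym (functional s c (evs (G i) t))) (scaled≥ _ _ (G₀>0 i) (h i) M≥0)) cone)
        arr₁ : ∀ M u → M * 1ℤ + 1ℤ * u ≡ u + M
        arr₁ = solve-∀
        arr₂ : ∀ M u → M * 1ℤ + -1ℤ * u ≡ M - u
        arr₂ = solve-∀
        bound : ∀ c → 0ℤ ≤ u (suc c) + M × 0ℤ ≤ M - u (suc c)
        bound c =
          subst (0ℤ ≤_) (trans (cong (λ v → M * v + 1ℤ * u (suc c)) u₀) (arr₁ M (u (suc c))))
            (via 1ℤ c (λ i → subst (0ℤ <_) (trans (ev-⊕ (monomial D) (G i (suc c)) t)
              (cong (λ v → M + v) (sym (*-identityˡ _)))) (proj₁ (dom i (suc c))))) ,
          subst (0ℤ ≤_) (trans (cong (λ v → M * v + -1ℤ * u (suc c)) u₀) (arr₂ M (u (suc c))))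
            (via -1ℤ c (λ i → subst (0ℤ <_) (trans (ev-⊕ (monomial D) (-1ℤ ⊙ G i (suc c)) t)
              (cong (λ v → M + v) (ev-⊙ -1ℤ (G i (suc c)) t))) (proj₂ (dom i (suc c)))))

-- Removal of redundant curves, uniformly in t.

module Pruning where

  open IntegersAndPolynomials
  open ConeDescription
  open Hulls
  open import Data.Nat as ℕ using (ℕ; zero; suc)
  open import Data.Nat.DivMod using (_%_)
  open import Data.Integer hiding (suc; pred; sign; _/_; _%_)
  open import Data.Integer.Properties using (≤-reflexive; <⇒≤)
  open import Data.Fin using (zero; suc)
  open import Data.List using (List; []; _∷_; _++_; lookup)
  open import Data.List.Relation.Unary.All as All using (All; []; _∷_)
  import Data.List.Relation.Unary.All.Properties as All
  open import Data.List.Relation.Unary.Any using (here; there)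
  open import Data.List.Membership.Propositional using (_∈_)
  open import Data.List.Membership.Propositional.Properties using (∈-lookup)
  open import Data.Product using (Σ-syntax; ∃-syntax; _×_; _,_; proj₂)
  open import Data.Sum using (_⊎_; inj₁; inj₂)
  open import Data.Unit using (⊤; tt)
  open import Function using (_∘_; id)
  open import Relation.Nullary using (contradiction)
  open import Relation.Binary.PropositionalEquality

  module _ {N : ℕ} where

    at : ℕ → Curve N → Vℤ N
    at t (_ , G) = evs G t

    Nonneg : ℕ → Vℤ N → Curve N → Set
    Nonneg t F w = 0ℤ ≤ dot F (at t w)

    SeparatedBy : Row N → Curve N → List (Curve N) → ℕ → Set
    SeparatedBy h w others t = 0ℤ < - dot (evs h t) (at t w) × All (Nonneg t (evs h t)) others

    -- `before` holds the curves that precede, so each curve is separated from all others of the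
    -- list. The separating row is polynomial and serves all large `t` at once.
    Irredundant : List (Curve N) → List (Curve N) → Set
    Irredundant before []       = ⊤
    Irredundant before (w ∷ ws) =
      (Σ[ h ∈ Row N ] Eventually (SeparatedBy h w (before ++ ws))) × Irredundant (w ∷ before) ws

    -- Eventual signs decide membership in the cone of `rows` uniformly: either a single row
    -- excludes `w` for all large `t`, or all rows eventually admit it.
    violated : ∀ (w : Curve N) rows → (Σ[ h ∈ Row N ] h ∈ rows × Eventually (λ t → 0ℤ < - dot (evs h t) (at t w))) ⊎
      Eventually (λ t → All (NonnegAt t (at t w)) rows)
    violated w [] = inj₂ (pureᴱ λ _ → [])
    violated w@(_ , G) (h ∷ rows) with sign (dotP h G) | violated w rows
    ... | neg₋ n | _ = inj₁ (h , here refl , mapᴱ (λ t → subst (λ z → 0ℤ < - z) (ev-dotP h G t)) n)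
    ... | _      | inj₁ (h′ , h′∈ , n) = inj₁ (h′ , there h′∈ , n)
    ... | zer z  | inj₂ p = inj₂ (mapᴱ (λ t → ≤-reflexive (trans (sym (ev-zero z t)) (ev-dotP h G t)) ∷_) p)
    ... | pos₊ q | inj₂ p = inj₂ (mapᴱ (λ { t (q , p) → subst (0ℤ ≤_) (ev-dotP h G t) (<⇒≤ q) ∷ p }) (q ∧ᴱ p))

    fromLookup : ∀ (ws : List (Curve N)) {P : Curve N → Set} → (∀ j → P (lookup ws j)) → All P ws
    fromLookup []       h = []
    fromLookup (w ∷ ws) h = h zero ∷ fromLookup ws (h ∘ suc)

    -- Each `w` is tested against the curves already kept and all those still to come. A kept curve
    -- remains separated when some of the others are dropped. A dropped one lies in the cone of the
    -- others; the functional is nonnegative on these by the recursive call, and hence also on `w`.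
    prune : ∀ before todo → Σ[ ws ∈ List (Curve N) ] (∀ {w} → w ∈ ws → w ∈ todo) × Irredundant before ws ×
      Eventually (λ t → ∀ F → All (Nonneg t F) before → All (Nonneg t F) ws → All (Nonneg t F) todo)
    prune before [] = [] , id , tt , pureᴱ λ _ _ _ p → p
    prune before (w ∷ todo) with hrep (λ i → proj₂ (lookup (before ++ todo) i))
    ... | rows , H with violated w rows
    ...   | inj₁ (h , h∈ , n) =
      let ws , ws⊆ , irr , dual = prune (w ∷ before) todo in
      w ∷ ws , (λ { (here p) → here p ; (there i) → there (ws⊆ i) }) ,
      ((h , mapᴱ (λ { t (n , sound , _) → n ,
          let others≥0 = fromLookup (before ++ todo) (All.lookup sound h∈)
          in All.++⁺ (All.++⁻ˡ before others≥0) (All.tabulate (All.lookup (All.++⁻ʳ before others≥0) ∘ ws⊆)) }) (n ∧ᴱ H)) , irr) ,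
      mapᴱ (λ { t d F b (p ∷ q) → p ∷ d F (p ∷ b) q }) dual
    ...   | inj₂ p =
      let ws , ws⊆ , irr , dual = prune before todo in
      ws , there ∘ ws⊆ , irr ,
      mapᴱ (λ { t (d , p , _ , complete) F b q →
        let rest = d F b q in
        cone-nonneg F (λ i → All.lookup (All.++⁺ b rest) (∈-lookup {xs = before ++ todo} i)) (complete (at t w) p) ∷ rest })
        (dual ∧ᴱ (p ∧ᴱ H))

    SeparatedAt : List (Curve N) → ℕ → Set
    SeparatedAt ws t = ∀ j → Σ[ h ∈ Vℤ N ] 0ℤ < - dot h (at t (lookup ws j)) ×
      (∀ i → i ≢ j → 0ℤ ≤ dot h (at t (lookup ws i)))

    irredundant⇒separated : ∀ ws → Irredundant [] ws → Eventually (SeparatedAt ws)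
    irredundant⇒separated ws irr = mapᴱ {SeparatedAfter [] ws} (λ t f j → let h , n , _ , p = f j in h , n , p) (go [] ws irr)
      where
      SeparatedAfter : List (Curve N) → List (Curve N) → ℕ → Set
      SeparatedAfter before ws t = ∀ j → Σ[ h ∈ Vℤ N ] 0ℤ < - dot h (at t (lookup ws j)) ×
        All (Nonneg t h) before × (∀ i → i ≢ j → 0ℤ ≤ dot h (at t (lookup ws i)))
      go : ∀ before ws → Irredundant before ws → Eventually (SeparatedAfter before ws)
      go before [] _ = pureᴱ λ _ ()
      go before (w ∷ ws) ((h , sep) , irr) = mapᴱ (λ
        { t ((n , p) , f) zero    → evs h t , n , All.++⁻ˡ before p ,
            λ { zero 0≢0 → contradiction refl 0≢0 ; (suc i) _ → All.lookup (All.++⁻ʳ before p) (∈-lookup {xs = ws} i) }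
        ; t (_ , f) (suc j) → let h′ , n′ , p′ , r = f j in h′ , n′ , All.tail p′ ,
            λ { zero _ → All.head p′ ; (suc i) i≢ → r i (i≢ ∘ cong suc) } }) (sep ∧ᴱ go (w ∷ before) ws irr)

    VerticesAt : (ℕ → Vℤ N → Set) → List (Curve N) → ℕ → Set
    VerticesAt S ws t = (∀ j → OnCurve S t (lookup ws j)) ×
      (∀ u → S t u → Cone (λ j → at t (lookup ws j)) u) × SeparatedAt ws t

    -- `HullAt` speaks only of functionals. Applied to the rows that describe the cone of the kept
    -- curves, it yields actual membership in that cone.
    hull-vertices : ∀ {S} → Hull S → ∃[ d ] ∀ r → Σ[ ws ∈ List (Curve N) ]
      Eventually (λ t → t % suc d ≡ r → VerticesAt S ws t)
    hull-vertices (d , f) = d , λ r →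
      let cs , H = f r
          ws , ws⊆ , irr , dual = prune [] cs
          rows , R = hrep (λ j → proj₂ (lookup ws j))
      in ws , mapᴱ (λ { t (h , (dual , (rsound , rcomplete) , sep)) t%d →
          let sound , complete = h t%d in
          (λ j → All.lookup sound (ws⊆ (∈-lookup {xs = ws} j))) ,
          (λ u s → rcomplete u (All.map (λ {r} r≥0 → complete (evs r t) (dual (evs r t) [] (fromLookup ws r≥0)) u s) rsound)) ,
          sep }) (H ∧ᴱ (dual ∧ᴱ (R ∧ᴱ irredundant⇒separated ws irr)))

-- Extreme points of convex hulls over the Cauchy reals.

module RealHulls where

  open import Defs
  open IntegersAndPolynomials using (Eventually; _∧ᴱ_; mapᴱ; pureᴱ)
  open import Data.Nat as ℕ using (ℕ; zero; suc)
  import Data.Nat.Properties as ℕ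
  open import Data.Rational
  open import Data.Rational.Properties
  open import Data.Fin using (Fin; zero; suc)
  open import Data.Fin.Properties using () renaming (_≟_ to _≟ᶠ_)
  open import Data.Vec.Functional using (Vector)
  open import Data.Product using (Σ-syntax; ∃-syntax; _×_; _,_; proj₁; proj₂)
  open import Data.Sum using (_⊎_; inj₁; inj₂)
  open import Function using (_∘_; mk⇔)
  open import Level using (0ℓ)
  open import Relation.Nullary using (Dec; yes; no; contradiction)
  open import Relation.Nullary.Decidable using (dec⇒maybe)
  open import Relation.Unary using (Pred; _∈_)
  open import Relation.Binary.PropositionalEquality
  open import Tactic.RingSolver using (solve-∀)
  open import Tactic.RingSolver.Core.AlmostCommutativeRing using (AlmostCommutativeRing; fromCommutativeRing)
  open import Algebra.Bundles using (CommutativeRing)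
  open import Algebra.Properties.Semiring.Sum (CommutativeRing.semiring +-*-commutativeRing)
    using (sum; sum-cong-≗; *-distribˡ-sum; ∑-distrib-+; ∑-comm)

  ringℚ : AlmostCommutativeRing 0ℓ 0ℓ
  ringℚ = fromCommutativeRing +-*-commutativeRing (λ q → dec⇒maybe (0ℚ ≟ q))

  *-≥0 : ∀ {a b} → 0ℚ ≤ a → 0ℚ ≤ b → 0ℚ ≤ a * b
  *-≥0 {a} {b} p q = subst (_≤ a * b) (*-zeroʳ a) (*-monoˡ-≤-nonNeg a {{nonNegative p}} q)

  *->0 : ∀ {a b} → 0ℚ < a → 0ℚ < b → 0ℚ < a * b
  *->0 {a} {b} p q = subst (_< a * b) (*-zeroʳ a) (*-monoʳ-<-pos a {{positive p}} q)

  *->0⁻¹ : ∀ {a b} → 0ℚ < a → 0ℚ < a * b → 0ℚ < b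
  *->0⁻¹ {a} {b} p q = *-cancelˡ-<-nonNeg a {{nonNegative (<⇒≤ p)}} (subst (_< a * b) (sym (*-zeroʳ a)) q)

  <-diffℚ : ∀ {a b} → a < b → 0ℚ < b - a
  <-diffℚ {a} {b} p = subst (_< b - a) (+-inverseʳ a) (+-monoˡ-< (- a) p)

  diffℚ-< : ∀ {a b} → 0ℚ < b - a → a < b
  diffℚ-< {a} {b} p = subst₂ _<_ (+-identityˡ a) (cancel a b) (+-monoˡ-< a p)
    where
    cancel : ∀ a b → b - a + a ≡ b
    cancel = solve-∀ ringℚ

  ≤-diffℚ : ∀ {a b} → a ≤ b → 0ℚ ≤ b - a
  ≤-diffℚ {a} {b} p = subst (_≤ b - a) (+-inverseʳ a) (+-monoˡ-≤ (- a) p)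

  neg-neg : ∀ p → - - p ≡ p
  neg-neg = solve-∀ ringℚ

  p≤∣p∣ : ∀ p → p ≤ ∣ p ∣
  p≤∣p∣ p with ∣p∣≡p∨∣p∣≡-p p
  ... | inj₁ eq = ≤-reflexive (sym eq)
  ... | inj₂ eq = ≤-trans (subst₂ _≤_ (neg-neg p) refl (neg-antimono-≤ (subst (0ℚ ≤_) eq (0≤∣p∣ p)))) (0≤∣p∣ p)

  -p≤∣p∣ : ∀ p → - p ≤ ∣ p ∣
  -p≤∣p∣ p = subst (- p ≤_) (∣-p∣≡∣p∣ p) (p≤∣p∣ (- p))

  ∣∣-< : ∀ {p ε} → p < ε → - p < ε → ∣ p ∣ < ε
  ∣∣-< {p} h k with ∣p∣≡p∨∣p∣≡-p p
  ... | inj₁ eq = subst (_< _) (sym eq) h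
  ... | inj₂ eq = subst (_< _) (sym eq) k

  half>0 : ∀ {ε} → 0ℚ < ε → 0ℚ < ½ * ε
  half>0 = *->0 (positive⁻¹ ½)

  ½+½ : ∀ ε → ½ * ε + ½ * ε ≡ ε
  ½+½ ε = trans (sym (*-distribʳ-+ ε ½ ½)) (*-identityˡ ε)

  divide : ∀ {B ε} → 0ℚ < B → 0ℚ < ε → ∃[ δ ] 0ℚ < δ × B * δ ≡ ε
  divide {B} {ε} 0<B 0<ε = 1/ B * ε , *->0 (positive⁻¹ (1/ B) {{1/pos⇒pos B}}) 0<ε ,
      trans (sym (*-assoc B (1/ B) ε)) (trans (cong (_* ε) (*-inverseʳ B)) (*-identityˡ ε))
    where
    instance
      _ = positive 0<B
      _ = pos⇒nonZero B

  -- Null sequences and asymptotically nonnegative sequences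

  Null : (ℕ → ℚ) → Set
  Null s = ∀ ε → 0ℚ < ε → Eventually (λ n → ∣ s n ∣ < ε)

  Bounded : (ℕ → ℚ) → Set
  Bounded s = ∃[ B ] 0ℚ < B × Eventually (λ n → ∣ s n ∣ ≤ B)

  NN : (ℕ → ℚ) → Set
  NN s = ∀ ε → 0ℚ < ε → Eventually (λ n → 0ℚ < s n + ε)

  null-ext : ∀ {s r} → s ≗ r → Null s → Null r
  null-ext s≗r h ε ε>0 = mapᴱ (λ n → subst (λ q → ∣ q ∣ < ε) (s≗r n)) (h ε ε>0)

  null-0 : Null (λ _ → 0ℚ)
  null-0 ε ε>0 = pureᴱ λ _ → ε>0

  null-+ : ∀ {s r} → Null s → Null r → Null (λ n → s n + r n)
  null-+ {s} {r} h k ε ε>0 = mapᴱ (λ n (p , q) → ≤-<-trans (∣p+q∣≤∣p∣+∣q∣ (s n) (r n))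
      (subst (∣ s n ∣ + ∣ r n ∣ <_) (½+½ ε) (+-mono-< p q)))
    (h (½ * ε) (half>0 ε>0) ∧ᴱ k (½ * ε) (half>0 ε>0))

  null-* : ∀ {s r} → Bounded s → Null r → Null (λ n → s n * r n)
  null-* {s} {r} (B , B>0 , hB) h ε ε>0 =
    let δ , δ>0 , eq = divide B>0 ε>0 in
    mapᴱ (λ n (b , p) → begin-strict
      ∣ s n * r n ∣        ≡⟨ ∣p*q∣≡∣p∣*∣q∣ (s n) (r n) ⟩
      ∣ s n ∣ * ∣ r n ∣    ≤⟨ *-monoʳ-≤-nonNeg ∣ r n ∣ {{∣-∣-nonNeg (r n)}} b ⟩
      B * ∣ r n ∣          <⟨ *-monoʳ-<-pos B {{positive B>0}} p ⟩
      B * δ                ≡⟨ eq ⟩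
      ε                    ∎) (hB ∧ᴱ h δ δ>0)
    where open ≤-Reasoning

  bounded-const : ∀ c → Bounded (λ _ → c)
  bounded-const c = ∣ c ∣ + 1ℚ , +-mono-≤-< (0≤∣p∣ c) (positive⁻¹ 1ℚ) ,
    pureᴱ λ _ → subst (_≤ ∣ c ∣ + 1ℚ) (+-identityʳ ∣ c ∣) (+-monoʳ-≤ ∣ c ∣ (<⇒≤ (positive⁻¹ 1ℚ)))

  null-scale : ∀ c {s} → Null s → Null (λ n → c * s n)
  null-scale c = null-* (bounded-const c)

  null-scale⁻¹ : ∀ {c s} → 0ℚ < c → Null (λ n → c * s n) → Null s
  null-scale⁻¹ {c} {s} c>0 h =
    let d , _ , cd = divide c>0 (positive⁻¹ 1ℚ) in
    null-ext (λ n → trans (arrange c d (s n)) (trans (cong (_* s n) cd) (*-identityˡ (s n)))) (null-scale d h)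
    where
    arrange : ∀ c d s → d * (c * s) ≡ c * d * s
    arrange = solve-∀ ringℚ

  null-neg : ∀ {s} → Null s → Null (λ n → - s n)
  null-neg {s} h ε ε>0 = mapᴱ (λ n → subst (_< ε) (sym (∣-p∣≡∣p∣ (s n)))) (h ε ε>0)

  null-sum : ∀ {m} {s : Fin m → ℕ → ℚ} → (∀ i → Null (s i)) → Null (λ n → sum (λ i → s i n))
  null-sum {zero}  h = null-0
  null-sum {suc m} {s} h = null-+ {s zero} {λ n → sum (λ i → s (suc i) n)} (h zero) (null-sum {m} {s ∘ suc} (h ∘ suc))

  nn-ext : ∀ {s r} → s ≗ r → NN s → NN r
  nn-ext s≗r h ε ε>0 = mapᴱ (λ n → subst (λ q → 0ℚ < q + ε) (s≗r n)) (h ε ε>0)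

  null⇒nn : ∀ {s} → Null s → NN s
  null⇒nn {s} h ε ε>0 = mapᴱ (λ n p → subst (0ℚ <_) (arrange (s n) ε) (<-diffℚ (≤-<-trans (-p≤∣p∣ (s n)) p))) (h ε ε>0)
    where
    arrange : ∀ s ε → ε - - s ≡ s + ε
    arrange = solve-∀ ringℚ

  nn⇒null : ∀ {s} → NN s → NN (λ n → - s n) → Null s
  nn⇒null {s} h k ε ε>0 = mapᴱ (λ n (p , q) → ∣∣-<
      (diffℚ-< (subst (0ℚ <_) (+-comm (- s n) ε) q))
      (diffℚ-< (subst (0ℚ <_) (arrange (s n) ε) p)))
    (h ε ε>0 ∧ᴱ k ε ε>0)
    where
    arrange : ∀ s ε → s + ε ≡ ε - - s
    arrange = solve-∀ ringℚ

  nn-const : ∀ {c} → 0ℚ ≤ c → NN (λ _ → c)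
  nn-const c≥0 ε ε>0 = pureᴱ λ _ → +-mono-≤-< c≥0 ε>0

  nn-const⁻¹ : ∀ {c} → NN (λ _ → c) → 0ℚ ≤ c
  nn-const⁻¹ {c} h with c <? 0ℚ
  ... | no c≮0 = ≮⇒≥ c≮0
  ... | yes c<0 with h (- c) (neg-antimono-< c<0)
  ...   | N , k = contradiction (subst (0ℚ <_) (+-inverseʳ c) (k N ℕ.≤-refl)) (<-irrefl refl)

  nn-+ : ∀ {s r} → NN s → NN r → NN (λ n → s n + r n)
  nn-+ {s} {r} h k ε ε>0 = mapᴱ (λ n (p , q) → subst (0ℚ <_)
      (trans (arrange (s n) (r n) (½ * ε)) (cong (s n + r n +_) (½+½ ε))) (+-mono-< p q))
    (h (½ * ε) (half>0 ε>0) ∧ᴱ k (½ * ε) (half>0 ε>0))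
    where
    arrange : ∀ s r δ → (s + δ) + (r + δ) ≡ s + r + (δ + δ)
    arrange = solve-∀ ringℚ

  nn-scale : ∀ {c s} → 0ℚ ≤ c → NN s → NN (λ n → c * s n)
  nn-scale {c} {s} c≥0 h ε ε>0 =
    let δ , δ>0 , eq = divide {c + 1ℚ} (+-mono-≤-< c≥0 (positive⁻¹ 1ℚ)) ε>0 in
    mapᴱ (λ n p → subst (0ℚ <_) (trans (arrange c (s n) δ) (cong (c * s n +_) eq))
      (+-mono-≤-< (*-≥0 c≥0 (<⇒≤ p)) δ>0)) (h δ δ>0)
    where
    arrange : ∀ c s δ → c * (s + δ) + δ ≡ c * s + (c + 1ℚ) * δ
    arrange = solve-∀ ringℚ

  nn-sum : ∀ {m} {s : Fin m → ℕ → ℚ} → (∀ i → NN (s i)) → NN (λ n → sum (λ i → s i n))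
  nn-sum {zero}  h = nn-const ≤-refl
  nn-sum {suc m} {s} h = nn-+ {s zero} {λ n → sum (λ i → s (suc i) n)} (h zero) (nn-sum {m} {s ∘ suc} (h ∘ suc))

  Eventually> : ℚ → (ℕ → ℚ) → Set
  Eventually> c s = Eventually (λ n → c < s n)

  -- A slack `δ = ε / B` in `r` costs at most `ε` in the product, because `s` stays below `B`.
  nn-* : ∀ {s r} → Bounded s → Eventually> 0ℚ s → NN r → NN (λ n → s n * r n)
  nn-* {s} {r} (B , B>0 , hB) s>0 h ε ε>0 =
    let δ , δ>0 , eq = divide B>0 ε>0 in
    mapᴱ (λ n (b , p , q) → subst (0ℚ <_) (trans (arrange (s n) (r n) δ B) (cong (s n * r n +_) eq))
      (+-mono-<-≤ (*->0 p q) (*-≥0 (≤-diffℚ (≤-trans (p≤∣p∣ (s n)) b)) (<⇒≤ δ>0)))) (hB ∧ᴱ (s>0 ∧ᴱ h δ δ>0))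
    where
    arrange : ∀ s r δ B → s * (r + δ) + (B - s) * δ ≡ s * r + B * δ
    arrange = solve-∀ ringℚ

  -- Division by `s` is controlled by its lower bound `a`: from `0 < s r + a ε` and `a < s` follows
  -- `0 < s (r + ε)`.
  nn-*⁻¹ : ∀ {a s r} → 0ℚ < a → Eventually> a s → NN (λ n → s n * r n) → NN r
  nn-*⁻¹ {a} {s} {r} a>0 s>a h ε ε>0 = mapᴱ (λ n (p , q) → *->0⁻¹ (<-trans a>0 p) (<-≤-trans q
      (subst₂ _≤_ (+-comm (a * ε) (s n * r n)) (arrange (s n) (r n) ε)
        (+-monoˡ-≤ (s n * r n) (*-monoʳ-≤-nonNeg ε {{nonNegative (<⇒≤ ε>0)}} (<⇒≤ p))))))
    (s>a ∧ᴱ h (a * ε) (*->0 a>0 ε>0))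
    where
    arrange : ∀ s r ε → s * ε + s * r ≡ s * (r + ε)
    arrange = solve-∀ ringℚ

  cauchy⇒bounded : ∀ {s} → IsCauchy s → Bounded s
  cauchy⇒bounded {s} h with h 1ℚ (positive⁻¹ 1ℚ)
  ... | N , k = 1ℚ + ∣ s N ∣ , +-mono-<-≤ (positive⁻¹ 1ℚ) (0≤∣p∣ (s N)) , N , λ n N≤n → begin
      ∣ s n ∣                  ≡⟨ cong ∣_∣ (split (s n) (s N)) ⟩
      ∣ (s n - s N) + s N ∣    ≤⟨ ∣p+q∣≤∣p∣+∣q∣ (s n - s N) (s N) ⟩
      ∣ s n - s N ∣ + ∣ s N ∣  ≤⟨ +-monoˡ-≤ ∣ s N ∣ (<⇒≤ (k n N N≤n ℕ.≤-refl)) ⟩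
      1ℚ + ∣ s N ∣             ∎
    where
    open ≤-Reasoning
    split : ∀ a b → a ≡ (a - b) + b
    split = solve-∀ ringℚ

  seq-bounded : ∀ x → Bounded (seq x)
  seq-bounded x = cauchy⇒bounded (cauchy x)

  ≈ᴿ-sym : ∀ {x y} → x ≈ᴿ y → y ≈ᴿ x
  ≈ᴿ-sym {x} {y} h = null-ext (λ n → flip (seq x n) (seq y n)) (null-neg h)
    where
    flip : ∀ a b → - (a - b) ≡ b - a
    flip = solve-∀ ringℚ

  ≈ᴿ-trans : ∀ {x y z} → x ≈ᴿ y → y ≈ᴿ z → x ≈ᴿ z
  ≈ᴿ-trans {x} {y} {z} h k = null-ext (λ n → telescope (seq x n) (seq y n) (seq z n)) (null-+ h k)
    where
    telescope : ∀ a b c → (a - b) + (b - c) ≡ a - c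
    telescope = solve-∀ ringℚ

  ≗⇒≈ᴿ : ∀ {x y} → seq x ≗ seq y → x ≈ᴿ y
  ≗⇒≈ᴿ {x} {y} h = null-ext (λ n → sym (trans (cong (_- seq y n) (h n)) (+-inverseʳ (seq y n)))) null-0

  ι-injective : ∀ {p q} → ι p ≈ᴿ ι q → p ≡ q
  ι-injective {p} {q} h = ≤-antisym
      (subst₂ _≤_ (+-identityˡ p) (cancel p q) (+-monoˡ-≤ p (nn-const⁻¹ {q - p} (null⇒nn (≈ᴿ-sym {ι p} {ι q} h)))))
      (subst₂ _≤_ (+-identityˡ q) (cancel q p) (+-monoˡ-≤ q (nn-const⁻¹ {p - q} (null⇒nn h))))
    where
    cancel : ∀ a b → b - a + a ≡ b
    cancel = solve-∀ ringℚ

  seq-sumᴿ : ∀ {m} (a : Vector ℝ m) n → seq (sumᴿ a) n ≡ sum (λ i → seq (a i) n)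
  seq-sumᴿ {zero}  a n = refl
  seq-sumᴿ {suc m} a n = cong (seq (a zero) n +_) (seq-sumᴿ (a ∘ suc) n)

  -- Affine functionals with rational coefficients

  affine : ∀ {n} → ℚ → Vector ℚ n → Vector ℚ n → ℚ
  affine h₀ h x = h₀ + sum (λ c → h c * x c)

  coords : ∀ {n} → Point n → ℕ → Vector ℚ n
  coords x k c = seq (x c) k

  affine-cong : ∀ {n} h₀ (h : Vector ℚ n) {x y} → x ≗ y → affine h₀ h x ≡ affine h₀ h y
  affine-cong h₀ h x≗y = cong (h₀ +_) (sum-cong-≗ (λ c → cong (h c *_) (x≗y c)))

  sum-neg : ∀ {m} (f : Vector ℚ m) → sum (λ i → - f i) ≡ - sum f
  sum-neg {zero}  f = refl
  sum-neg {suc m} f = trans (cong (- f zero +_) (sum-neg (f ∘ suc))) (sym (neg-distrib-+ (f zero) (sum (f ∘ suc))))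

  affine-≋ : ∀ {n} h₀ (h : Vector ℚ n) {x y : Point n} → x ≋ y →
    Null (λ k → affine h₀ h (coords x k) - affine h₀ h (coords y k))
  affine-≋ h₀ h {x} {y} x≋y = null-ext {λ k → sum (λ c → h c * (seq (x c) k - seq (y c) k))} eq
      (null-sum {s = λ c k → h c * (seq (x c) k - seq (y c) k)} (λ c → null-scale (h c) {λ k → seq (x c) k - seq (y c) k} (x≋y c)))
    where
    arrange : ∀ h x y → h * (x - y) ≡ h * x + - (h * y)
    arrange = solve-∀ ringℚ
    arrange′ : ∀ h₀ a b → a + - b ≡ (h₀ + a) - (h₀ + b)
    arrange′ = solve-∀ ringℚ
    eq : ∀ k → sum (λ c → h c * (seq (x c) k - seq (y c) k)) ≡ affine h₀ h (coords x k) - affine h₀ h (coords y k)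
    eq k = trans (sum-cong-≗ (λ c → arrange (h c) (seq (x c) k) (seq (y c) k)))
      (trans (∑-distrib-+ (λ c → h c * seq (x c) k) (λ c → - (h c * seq (y c) k)))
      (trans (cong (sum (λ c → h c * seq (x c) k) +_) (sum-neg (λ c → h c * seq (y c) k)))
        (arrange′ h₀ (sum (λ c → h c * seq (x c) k)) (sum (λ c → h c * seq (y c) k)))))

  -- At a finite index of the Cauchy sequences the weights sum to 1 only approximately. The defect
  -- is kept as a separate term, which tends to 0.
  affine-combination : ∀ {n m} h₀ (h : Vector ℚ n) (a : Vector ℚ m) (y : Fin m → Vector ℚ n) →
    affine h₀ h (λ c → sum (λ i → a i * y i c)) ≡ h₀ * (1ℚ - sum a) + sum (λ i → a i * affine h₀ h (y i))
  affine-combination {n} {m} h₀ h a y = begin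
    h₀ + sum (λ c → h c * sum (λ i → a i * y i c))
      ≡⟨ cong (h₀ +_) (sum-cong-≗ (λ c → *-distribˡ-sum (h c) (λ i → a i * y i c))) ⟩
    h₀ + sum (λ c → sum (λ i → h c * (a i * y i c)))
      ≡⟨ cong (h₀ +_) (∑-comm (λ c i → h c * (a i * y i c))) ⟩
    h₀ + sum (λ i → sum (λ c → h c * (a i * y i c)))
      ≡⟨ cong (h₀ +_) (sum-cong-≗ (λ i → trans (sum-cong-≗ (λ c → swap (h c) (a i) (y i c))) (sym (*-distribˡ-sum (a i) (λ c → h c * y i c))))) ⟩
    h₀ + sum (λ i → a i * L i)
      ≡⟨ arrange h₀ (sum a) (sum (λ i → a i * L i)) ⟩
    h₀ * (1ℚ - sum a) + (h₀ * sum a + sum (λ i → a i * L i))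
      ≡⟨ cong (λ q → h₀ * (1ℚ - sum a) + (q + sum (λ i → a i * L i))) (*-distribˡ-sum h₀ a) ⟩
    h₀ * (1ℚ - sum a) + (sum (λ i → h₀ * a i) + sum (λ i → a i * L i))
      ≡⟨ cong (h₀ * (1ℚ - sum a) +_) (sym (∑-distrib-+ (λ i → h₀ * a i) (λ i → a i * L i))) ⟩
    h₀ * (1ℚ - sum a) + sum (λ i → h₀ * a i + a i * L i)
      ≡⟨ cong (h₀ * (1ℚ - sum a) +_) (sum-cong-≗ (λ i → factor h₀ (a i) (L i))) ⟩
    h₀ * (1ℚ - sum a) + sum (λ i → a i * affine h₀ h (y i)) ∎
    where
    open ≡-Reasoning
    L : Vector ℚ m
    L i = sum (λ c → h c * y i c)
    swap : ∀ p q r → p * (q * r) ≡ q * (p * r)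
    swap = solve-∀ ringℚ
    arrange : ∀ h s l → h + l ≡ h * (1ℚ - s) + (h * s + l)
    arrange = solve-∀ ringℚ
    factor : ∀ h a l → h * a + a * l ≡ a * (h + l)
    factor = solve-∀ ringℚ

  -- The rational limit `η` splits each product of a weight `a` with a value `H` into `η a`, which
  -- is asymptotically nonnegative, and `a (H - η)`, which is null because `a` is bounded.
  conv-nonneg : ∀ {n} h₀ (h : Vector ℚ n) {S : Pred (Point n) 0ℓ} →
    (∀ Y → Y ∈ S → ∃[ η ] 0ℚ ≤ η × Null (λ k → affine h₀ h (coords Y k) - η)) →
    ∀ X → X ∈ conv S → NN (λ k → affine h₀ h (coords X k))
  conv-nonneg h₀ h lim X (m , y , a , y∈S , a≥0 , Σa , X≋) =
    nn-ext {λ k → (H X k - H P k) + (h₀ * (1ℚ - seq (sumᴿ a) k) + sum (λ i → seq (a i) k * H (y i) k))} {H X} eq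
      (nn-+ {λ k → H X k - H P k} {λ k → h₀ * (1ℚ - seq (sumᴿ a) k) + sum (λ i → seq (a i) k * H (y i) k)}
        (null⇒nn {λ k → H X k - H P k} (affine-≋ h₀ h {X} {P} X≋))
        (nn-+ {λ k → h₀ * (1ℚ - seq (sumᴿ a) k)} {λ k → sum (λ i → seq (a i) k * H (y i) k)}
          (null⇒nn {λ k → h₀ * (1ℚ - seq (sumᴿ a) k)}
            (null-scale h₀ {λ k → 1ℚ - seq (sumᴿ a) k} (≈ᴿ-sym {sumᴿ a} {1ᴿ} Σa)))
          (nn-sum {m} {λ i k → seq (a i) k * H (y i) k} term)))
    where
    H : Point _ → ℕ → ℚ
    H Y k = affine h₀ h (coords Y k)
    split : ∀ a f η → η * a + a * (f - η) ≡ a * f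
    split = solve-∀ ringℚ
    term : ∀ i → NN (λ k → seq (a i) k * H (y i) k)
    term i = let η , η≥0 , H→η = lim (y i) (y∈S i) in nn-ext
          {λ k → η * seq (a i) k + seq (a i) k * (H (y i) k - η)} {λ k → seq (a i) k * H (y i) k}
          (λ k → split (seq (a i) k) (H (y i) k) η)
          (nn-+ {λ k → η * seq (a i) k} {λ k → seq (a i) k * (H (y i) k - η)} (nn-scale {η} {seq (a i)} η≥0 (a≥0 i))
            (null⇒nn {λ k → seq (a i) k * (H (y i) k - η)} (null-* {seq (a i)} {λ k → H (y i) k - η} (seq-bounded (a i)) H→η)))
    P : Point _
    P c = sumᴿ (λ i → a i *ᴿ y i c)
    HP : ∀ k → H P k ≡ h₀ * (1ℚ - seq (sumᴿ a) k) + sum (λ i → seq (a i) k * H (y i) k)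
    HP k = trans (affine-cong h₀ h (λ c → seq-sumᴿ (λ i → a i *ᴿ y i c) k))
      (trans (affine-combination h₀ h (λ i → seq (a i) k) (λ i → coords (y i) k))
        (cong (λ q → h₀ * (1ℚ - q) + sum (λ i → seq (a i) k * H (y i) k)) (sym (seq-sumᴿ a k))))
    cancel : ∀ a b → (a - b) + b ≡ a
    cancel = solve-∀ ringℚ
    eq : ∀ k → (H X k - H P k) + (h₀ * (1ℚ - seq (sumᴿ a) k) + sum (λ i → seq (a i) k * H (y i) k)) ≡ H X k
    eq k = trans (cong (H X k - H P k +_) (sym (HP k))) (cancel (H X k) (H P k))

  -- Extreme points of convex hulls

  Pos : (ℕ → ℚ) → Set
  Pos s = ∃[ ε ] 0ℚ < ε × Eventually> ε s

  -- One sample at an index past both Cauchy moduli shows which summand exceeds `½ * ε`, and the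
  -- moduli preserve half of that excess at all later indices. This replaces a decision on real
  -- numbers.
  pos-split : ∀ {s r} → IsCauchy s → IsCauchy r → Pos (λ n → s n + r n) → Pos s ⊎ Pos r
  pos-split {s} {r} cs cr (ε , ε>0 , N₀ , h) = go (½ * ε <? s N)
    where
    δ>0 : 0ℚ < ½ * (½ * ε)
    δ>0 = half>0 (half>0 ε>0)
    N₁ = proj₁ (cs _ δ>0)
    N₂ = proj₁ (cr _ δ>0)
    N = N₀ ℕ.⊔ (N₁ ℕ.⊔ N₂)
    N₁≤N : N₁ ℕ.≤ N
    N₁≤N = ℕ.≤-trans (ℕ.m≤m⊔n N₁ N₂) (ℕ.m≤n⊔m N₀ _)
    N₂≤N : N₂ ℕ.≤ N
    N₂≤N = ℕ.≤-trans (ℕ.m≤n⊔m N₁ N₂) (ℕ.m≤n⊔m N₀ _)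
    persist : ∀ η q q′ → ½ * η + ½ * η ≡ η → η < q → ∣ q - q′ ∣ < ½ * η → ½ * η < q′
    persist η q q′ eq η<q close = diffℚ-< (subst (0ℚ <_)
        (trans (arrange η q q′ (½ * η)) (trans (cong (λ u → q′ - ½ * η + (u - η)) eq) (cancel (q′ - ½ * η) η)))
        (+-mono-< (<-diffℚ η<q) (<-diffℚ (≤-<-trans (p≤∣p∣ (q - q′)) close))))
      where
      arrange : ∀ η q q′ δ → (q - η) + (δ - (q - q′)) ≡ q′ - δ + (δ + δ - η)
      arrange = solve-∀ ringℚ
      cancel : ∀ a b → a + (b - b) ≡ a
      cancel = solve-∀ ringℚ
    go : Dec (½ * ε < s N) → Pos s ⊎ Pos r
    go (yes p) = inj₁ (½ * (½ * ε) , δ>0 , N , λ n N≤n →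
      persist (½ * ε) (s N) (s n) (½+½ (½ * ε)) p (proj₂ (cs _ δ>0) N n N₁≤N (ℕ.≤-trans N₁≤N N≤n)))
    go (no ¬p) = inj₂ (½ * (½ * ε) , δ>0 , N , λ n N≤n →
      persist (½ * ε) (r N) (r n) (½+½ (½ * ε)) q (proj₂ (cr _ δ>0) N n N₂≤N (ℕ.≤-trans N₂≤N N≤n)))
      where
      arrange : ∀ s r η → (s + r - (η + η)) + (η - s) ≡ r - η
      arrange = solve-∀ ringℚ
      q : ½ * ε < r N
      q = diffℚ-< (subst (0ℚ <_) (arrange (s N) (r N) (½ * ε)) (+-mono-<-≤
        (<-diffℚ (subst (_< s N + r N) (sym (½+½ ε)) (h N (ℕ.m≤m⊔n N₀ _)))) (≤-diffℚ (≮⇒≥ ¬p))))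

  -- Supplies the index of a weight bounded away from 0, from which the argument about extreme
  -- points starts.
  pos-sum : ∀ {m} (a : Vector ℝ m) → Pos (seq (sumᴿ a)) → ∃[ i ] Pos (seq (a i))
  pos-sum {zero}  a (ε , ε>0 , N , h) = contradiction (<-trans ε>0 (h N ℕ.≤-refl)) (<-irrefl refl)
  pos-sum {suc m} a p = go (pos-split {seq (a zero)} {seq (sumᴿ (a ∘ suc))} (cauchy (a zero)) (cauchy (sumᴿ (a ∘ suc))) p)
    where
    go : Pos (seq (a zero)) ⊎ Pos (seq (sumᴿ (a ∘ suc))) → ∃[ i ] Pos (seq (a i))
    go (inj₁ q) = zero , q
    go (inj₂ q) = let i , r = pos-sum (a ∘ suc) q in suc i , r

  unit : ∀ {m} → Fin m → Vector ℚ m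
  unit zero    zero    = 1ℚ
  unit zero    (suc j) = 0ℚ
  unit (suc i) zero    = 0ℚ
  unit (suc i) (suc j) = unit i j

  sum-≡0 : ∀ {m} {f : Vector ℚ m} → (∀ i → f i ≡ 0ℚ) → sum f ≡ 0ℚ
  sum-≡0 {zero}  h = refl
  sum-≡0 {suc m} {f} h = trans (cong (_+ sum (f ∘ suc)) (h zero)) (trans (+-identityˡ (sum (f ∘ suc))) (sum-≡0 (h ∘ suc)))

  sum-unit : ∀ {m} (i : Fin m) (f : Vector ℚ m) → sum (λ j → unit i j * f j) ≡ f i
  sum-unit {suc m} zero f = begin
    1ℚ * f zero + sum {m} (λ j → 0ℚ * f (suc j))  ≡⟨ cong (1ℚ * f zero +_) (sum-≡0 (λ j → *-zeroˡ (f (suc j)))) ⟩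
    1ℚ * f zero + 0ℚ                              ≡⟨ +-identityʳ (1ℚ * f zero) ⟩
    1ℚ * f zero                                   ≡⟨ *-identityˡ (f zero) ⟩
    f zero                                        ∎
    where open ≡-Reasoning
  sum-unit {suc m} (suc i) f = begin
    0ℚ * f zero + sum {m} (λ j → unit i j * f (suc j))  ≡⟨ cong₂ _+_ (*-zeroˡ (f zero)) (sum-unit i (f ∘ suc)) ⟩
    0ℚ + f (suc i)                                      ≡⟨ +-identityˡ (f (suc i)) ⟩
    f (suc i)                                           ∎
    where open ≡-Reasoning

  unit-≢ : ∀ {m} (i j : Fin m) → i ≢ j → unit i j ≡ 0ℚ
  unit-≢ zero    zero    i≢j = contradiction refl i≢j
  unit-≢ zero    (suc j) i≢j = refl
  unit-≢ (suc i) zero    i≢j = refl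
  unit-≢ (suc i) (suc j) i≢j = unit-≢ i j (i≢j ∘ cong suc)

  unit-refl : ∀ {m} (i : Fin m) → unit i i ≡ 1ℚ
  unit-refl zero    = refl
  unit-refl (suc i) = unit-refl i

  conv-∈ : ∀ {n} {S : Pred (Point n) 0ℓ} {x p} → x ∈ S → p ≋ x → p ∈ conv S
  conv-∈ {x = x} {p} x∈S p≋x = 1 , (λ _ → x) , (λ _ → 1ᴿ) , (λ _ → x∈S) ,
    (λ _ → nn-const {1ℚ} (<⇒≤ (positive⁻¹ 1ℚ))) , ≗⇒≈ᴿ {1ᴿ +ᴿ 0ᴿ} {1ᴿ} (λ _ → refl) ,
    λ c → ≈ᴿ-trans {p c} {x c} {1ᴿ *ᴿ x c +ᴿ 0ᴿ} (p≋x c)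
      (≗⇒≈ᴿ {x c} {1ᴿ *ᴿ x c +ᴿ 0ᴿ} (λ n → sym (trans (+-identityʳ (1ℚ * seq (x c) n)) (*-identityˡ (seq (x c) n)))))

  -- The cap `½` keeps the complementary weight `1ℚ - ρ` positive even when one point carries the
  -- whole weight.
  below-1 : ∀ {ε} → 0ℚ < ε → ∃[ ρ ] 0ℚ < ρ × ρ ≤ ε × 0ℚ < 1ℚ - ρ
  below-1 {ε} ε>0 = go (⊓-sel ε ½)
    where
    go : ε ⊓ ½ ≡ ε ⊎ ε ⊓ ½ ≡ ½ → ∃[ ρ ] 0ℚ < ρ × ρ ≤ ε × 0ℚ < 1ℚ - ρ
    go (inj₁ eq) = ε , ε>0 , ≤-refl , <-diffℚ {ε} {1ℚ} (≤-<-trans {ε} {½} {1ℚ} (subst (_≤ ½) eq (p⊓q≤q ε ½)) (diffℚ-< {½} {1ℚ} (positive⁻¹ (1ℚ - ½))))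
    go (inj₂ eq) = ½ , positive⁻¹ ½ , subst (_≤ ε) eq (p⊓q≤p ε ½) , positive⁻¹ (1ℚ - ½)

  -- If a i > ρ > 0 then p = ρ y i + (1 - ρ) y′ with y′ in the hull, so that p = y i.
  module _ {n} {S : Pred (Point n) 0ℓ} {p} (pv : IsVertex (conv S) p)
    {m} (y : Vector (Point n) m) (a : Vector ℝ m) (y∈S : ∀ i → y i ∈ S) (a≥0 : ∀ i → 0ᴿ ≤ᴿ a i) (Σa : sumᴿ a ≈ᴿ 1ᴿ)
    (p≋ : p ≋ (λ c → sumᴿ (λ i → a i *ᴿ y i c)))
    (i : Fin m) {ρ κ : ℚ} (ρ>0 : 0ℚ < ρ) (1-ρ>0 : 0ℚ < 1ℚ - ρ) (κ>0 : 0ℚ < κ) ([1-ρ]κ≡1 : (1ℚ - ρ) * κ ≡ 1ℚ)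
    (ρ<aᵢ : Eventually> ρ (seq (a i))) where
    private
      -- The weights of `y′`: `ρ` is taken off the `i`-th weight, and all are divided by `1ℚ - ρ`,
      -- whose inverse is `κ`.
      b : Vector ℝ m
      b j = (a j +ᴿ ι (- (ρ * unit i j))) *ᴿ ι κ
      reweigh : ∀ (w f : Vector ℚ m) → sum (λ j → (w j + - (ρ * unit i j)) * κ * f j) ≡ κ * (sum (λ j → w j * f j) - ρ * f i)
      reweigh w f = begin
        sum (λ j → (w j + - (ρ * unit i j)) * κ * f j)
          ≡⟨ sum-cong-≗ (λ j → arrange (w j) ρ (unit i j) κ (f j)) ⟩
        sum (λ j → κ * (w j * f j) + (- (κ * ρ)) * (unit i j * f j))
          ≡⟨ ∑-distrib-+ (λ j → κ * (w j * f j)) (λ j → (- (κ * ρ)) * (unit i j * f j)) ⟩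
        sum (λ j → κ * (w j * f j)) + sum (λ j → (- (κ * ρ)) * (unit i j * f j))
          ≡⟨ cong₂ _+_ (sym (*-distribˡ-sum κ (λ j → w j * f j)))
               (trans (sym (*-distribˡ-sum (- (κ * ρ)) (λ j → unit i j * f j))) (cong ((- (κ * ρ)) *_) (sum-unit i f))) ⟩
        κ * sum (λ j → w j * f j) + (- (κ * ρ)) * f i
          ≡⟨ arrange′ κ (sum (λ j → w j * f j)) ρ (f i) ⟩
        κ * (sum (λ j → w j * f j) - ρ * f i) ∎
        where
        open ≡-Reasoning
        arrange : ∀ w ρ u κ f → (w + - (ρ * u)) * κ * f ≡ κ * (w * f) + (- (κ * ρ)) * (u * f)
        arrange = solve-∀ ringℚ
        arrange′ : ∀ κ s ρ f → κ * s + (- (κ * ρ)) * f ≡ κ * (s - ρ * f)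
        arrange′ = solve-∀ ringℚ
      b≥0 : ∀ j → 0ᴿ ≤ᴿ b j
      b≥0 j = nn-ext {λ k → κ * (seq (a j) k + - (ρ * unit i j))} (λ k → *-comm κ (seq (a j) k + - (ρ * unit i j)))
          (nn-scale {κ} {λ k → seq (a j) k + - (ρ * unit i j)} (<⇒≤ κ>0) (go (i ≟ᶠ j)))
        where
        go : Dec (i ≡ j) → NN (λ k → seq (a j) k + - (ρ * unit i j))
        go (no i≢j) = nn-ext {seq (a j)} (λ k → trans (arrange (seq (a j) k) ρ) (cong (λ u → seq (a j) k + - (ρ * u)) (sym (unit-≢ i j i≢j)))) (a≥0 j)
          where
          arrange : ∀ a ρ → a ≡ a + - (ρ * 0ℚ)
          arrange = solve-∀ ringℚ
        go (yes i≡j) η η>0 = mapᴱ (λ k p → +-mono-< (subst (0ℚ <_) (eq k) (<-diffℚ p)) η>0) ρ<aᵢ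
          where
          arrange : ∀ a ρ → a - ρ ≡ a + - (ρ * 1ℚ)
          arrange = solve-∀ ringℚ
          eq : ∀ k → seq (a i) k - ρ ≡ seq (a j) k + - (ρ * unit i j)
          eq k = trans (arrange (seq (a i) k) ρ) (cong₂ (λ l u → seq (a l) k + - (ρ * u)) i≡j
            (trans (sym (unit-refl i)) (cong (unit i) i≡j)))
      Σb : sumᴿ b ≈ᴿ 1ᴿ
      Σb = null-ext {λ k → κ * (seq (sumᴿ a) k - 1ℚ)} eq (null-scale κ {λ k → seq (sumᴿ a) k - 1ℚ} Σa)
        where
        arrange : ∀ κ s ρ → κ * (s - 1ℚ) ≡ κ * (s - ρ * 1ℚ) - (1ℚ - ρ) * κ
        arrange = solve-∀ ringℚ
        eq : ∀ k → κ * (seq (sumᴿ a) k - 1ℚ) ≡ seq (sumᴿ b) k - 1ℚ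
        eq k = begin
          κ * (seq (sumᴿ a) k - 1ℚ)                                       ≡⟨ arrange κ (seq (sumᴿ a) k) ρ ⟩
          κ * (seq (sumᴿ a) k - ρ * 1ℚ) - (1ℚ - ρ) * κ                    ≡⟨ cong₂ (λ s o → κ * (s - ρ * 1ℚ) - o)
                                                                               (trans (seq-sumᴿ a k) (sum-cong-≗ (λ j → sym (*-identityʳ (seq (a j) k))))) [1-ρ]κ≡1 ⟩
          κ * (sum (λ j → seq (a j) k * 1ℚ) - ρ * 1ℚ) - 1ℚ                ≡⟨ cong (_- 1ℚ) (sym (reweigh (λ j → seq (a j) k) (λ _ → 1ℚ))) ⟩
          sum (λ j → (seq (a j) k + - (ρ * unit i j)) * κ * 1ℚ) - 1ℚ      ≡⟨ cong (_- 1ℚ) (trans (sum-cong-≗ (λ j → *-identityʳ (seq (b j) k))) (sym (seq-sumᴿ b k))) ⟩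
          seq (sumᴿ b) k - 1ℚ                                             ∎
          where open ≡-Reasoning
      y′ : Point n
      y′ c = sumᴿ (λ j → b j *ᴿ y j c)
      y′∈ : y′ ∈ conv S
      y′∈ = m , y , b , y∈S , b≥0 , Σb , λ c → ≗⇒≈ᴿ {y′ c} {y′ c} (λ _ → refl)
      P : Point n
      P c = sumᴿ (λ j → a j *ᴿ y j c)
      P≡ : ∀ c k → seq (P c) k ≡ ρ * seq (y i c) k + (1ℚ - ρ) * seq (y′ c) k
      P≡ c k = begin
        seq (P c) k                                    ≡⟨ seq-sumᴿ (λ j → a j *ᴿ y j c) k ⟩
        s                                              ≡⟨ expand s (ρ * q) ⟩
        ρ * q + 1ℚ * (s - ρ * q)                       ≡⟨ cong (λ o → ρ * q + o * (s - ρ * q)) (sym [1-ρ]κ≡1) ⟩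
        ρ * q + (1ℚ - ρ) * κ * (s - ρ * q)             ≡⟨ cong (ρ * q +_) (*-assoc (1ℚ - ρ) κ (s - ρ * q)) ⟩
        ρ * q + (1ℚ - ρ) * (κ * (s - ρ * q))           ≡⟨ cong (λ u → ρ * q + (1ℚ - ρ) * u) (sym (trans (seq-sumᴿ (λ j → b j *ᴿ y j c) k)
                                                            (reweigh (λ j → seq (a j) k) (λ j → seq (y j c) k)))) ⟩
        ρ * q + (1ℚ - ρ) * seq (y′ c) k                ∎
        where
        open ≡-Reasoning
        s = sum (λ j → seq (a j) k * seq (y j c) k)
        q = seq (y i c) k
        expand : ∀ s r → s ≡ r + 1ℚ * (s - r)
        expand = solve-∀ ringℚ
      combo : p ≋ (λ c → ι ρ *ᴿ y i c +ᴿ ι (1ℚ - ρ) *ᴿ y′ c)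
      combo c = ≈ᴿ-trans {p c} {P c} {ι ρ *ᴿ y i c +ᴿ ι (1ℚ - ρ) *ᴿ y′ c} (p≋ c)
        (≗⇒≈ᴿ {P c} {ι ρ *ᴿ y i c +ᴿ ι (1ℚ - ρ) *ᴿ y′ c} (P≡ c))
      ι>0 : ∀ {q} → 0ℚ < q → 0ᴿ <ᴿ ι q
      ι>0 {q} q>0 = ½ * q , half>0 q>0 , 0 , λ _ _ → subst₂ _<_ (+-comm (½ * q) 0ℚ) (½+½ q) (+-monoʳ-< (½ * q) (half>0 q>0))
      yᵢ≋y′ : y i ≋ y′
      yᵢ≋y′ = proj₂ pv (y i) y′ (ι ρ) (ι (1ℚ - ρ)) (conv-∈ {S = S} {y i} {y i} (y∈S i) (λ c → ≗⇒≈ᴿ {y i c} {y i c} (λ _ → refl))) y′∈ (ι>0 ρ>0) (ι>0 1-ρ>0)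
          (≗⇒≈ᴿ {ι ρ +ᴿ ι (1ℚ - ρ)} {1ᴿ} (λ _ → arrange ρ 1ℚ)) combo
        where
        arrange : ∀ ρ o → ρ + (o - ρ) ≡ o
        arrange = solve-∀ ringℚ
    extreme-term : p ≋ y i
    extreme-term c = null-ext {λ k → (seq (p c) k - (ρ * seq (y i c) k + (1ℚ - ρ) * seq (y′ c) k)) + (1ℚ - ρ) * (seq (y′ c) k - seq (y i c) k)}
        (λ k → arrange (seq (p c) k) ρ (seq (y i c) k) (seq (y′ c) k))
        (null-+ {λ k → seq (p c) k - (ρ * seq (y i c) k + (1ℚ - ρ) * seq (y′ c) k)} {λ k → (1ℚ - ρ) * (seq (y′ c) k - seq (y i c) k)} (combo c)
          (null-scale (1ℚ - ρ) {λ k → seq (y′ c) k - seq (y i c) k} (≈ᴿ-sym {y i c} {y′ c} (yᵢ≋y′ c))))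
      where
      arrange : ∀ p ρ y y′ → (p - (ρ * y + (1ℚ - ρ) * y′)) + (1ℚ - ρ) * (y′ - y) ≡ p - y
      arrange = solve-∀ ringℚ

  extreme-combination : ∀ {n} {S : Pred (Point n) 0ℓ} {p} → IsVertex (conv S) p →
    ∀ {m} (y : Vector (Point n) m) (a : Vector ℝ m) → (∀ i → y i ∈ S) → (∀ i → 0ᴿ ≤ᴿ a i) → sumᴿ a ≈ᴿ 1ᴿ →
    p ≋ (λ c → sumᴿ (λ i → a i *ᴿ y i c)) → ∃[ i ] p ≋ y i
  extreme-combination {n} {S} {p} pv {m} y a y∈S a≥0 Σa p≋ =
    let i , ε , ε>0 , ε<aᵢ = pos-sum a Σa>½
        ρ , ρ>0 , ρ≤ε , 1-ρ>0 = below-1 ε>0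
        κ , κ>0 , eq = divide 1-ρ>0 (positive⁻¹ 1ℚ)
    in i , extreme-term {n} {S} {p} pv y a y∈S a≥0 Σa p≋ i ρ>0 1-ρ>0 κ>0 eq (mapᴱ (λ _ → ≤-<-trans ρ≤ε) ε<aᵢ)
    where
    Σa>½ : Pos (seq (sumᴿ a))
    Σa>½ = ½ , positive⁻¹ ½ , mapᴱ (λ k close → diffℚ-< (subst (0ℚ <_) (arrange (seq (sumᴿ a) k) ½ 1ℚ (½+½ 1ℚ))
        (<-diffℚ (≤-<-trans (-p≤∣p∣ (seq (sumᴿ a) k - 1ℚ)) close)))) (Σa ½ (positive⁻¹ ½))
      where
      move : ∀ s h → h - - (s - (h * 1ℚ + h * 1ℚ)) ≡ s - h
      move = solve-∀ ringℚ
      arrange : ∀ s h o → h * 1ℚ + h * 1ℚ ≡ o → h - - (s - o) ≡ s - h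
      arrange s h o eq = trans (cong (λ o → h - - (s - o)) (sym eq)) (move s h)

  affine-mix : ∀ {n} h₀ (h : Vector ℚ n) a b (x y : Vector ℚ n) →
    affine h₀ h (λ c → a * x c + b * y c) ≡ h₀ * (1ℚ - (a + b)) + (a * affine h₀ h x + b * affine h₀ h y)
  affine-mix h₀ h a b x y = begin
    h₀ + sum (λ c → h c * (a * x c + b * y c))
      ≡⟨ cong (h₀ +_) (sum-cong-≗ (λ c → distribute (h c) a (x c) b (y c))) ⟩
    h₀ + sum (λ c → a * (h c * x c) + b * (h c * y c))
      ≡⟨ cong (h₀ +_) (∑-distrib-+ (λ c → a * (h c * x c)) (λ c → b * (h c * y c))) ⟩
    h₀ + (sum (λ c → a * (h c * x c)) + sum (λ c → b * (h c * y c)))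
      ≡⟨ cong (h₀ +_) (sym (cong₂ _+_ (*-distribˡ-sum a (λ c → h c * x c)) (*-distribˡ-sum b (λ c → h c * y c)))) ⟩
    h₀ + (a * sum (λ c → h c * x c) + b * sum (λ c → h c * y c))
      ≡⟨ arrange h₀ a b (sum (λ c → h c * x c)) (sum (λ c → h c * y c)) ⟩
    h₀ * (1ℚ - (a + b)) + (a * affine h₀ h x + b * affine h₀ h y) ∎
    where
    open ≡-Reasoning
    distribute : ∀ h a x b y → h * (a * x + b * y) ≡ a * (h * x) + b * (h * y)
    distribute = solve-∀ ringℚ
    arrange : ∀ h a b u v → h + (a * u + b * v) ≡ h * (1ℚ - (a + b)) + (a * (h + u) + b * (h + v))
    arrange = solve-∀ ringℚ

  -- Rotates the hyperplane of `affine h₀ h` towards coordinate `c`, about points where that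
  -- functional vanishes and coordinate `c` equals `w`.
  tilt : ∀ {n} → ℚ → ℚ → Vector ℚ n → ℚ → Fin n → ℚ → ℚ × Vector ℚ n
  tilt D h₀ h β c w = D * h₀ + - (β * w) , λ i → D * h i + β * unit c i

  affine-tilt : ∀ {n} D h₀ (h : Vector ℚ n) β c w x →
    affine (proj₁ (tilt D h₀ h β c w)) (proj₂ (tilt D h₀ h β c w)) x ≡ D * affine h₀ h x + β * (x c - w)
  affine-tilt D h₀ h β c w x = begin
    D * h₀ + - (β * w) + sum (λ i → (D * h i + β * unit c i) * x i)
      ≡⟨ cong (D * h₀ + - (β * w) +_) (trans (sum-cong-≗ (λ i → distribute D (h i) β (unit c i) (x i)))
           (∑-distrib-+ (λ i → D * (h i * x i)) (λ i → β * (unit c i * x i)))) ⟩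
    D * h₀ + - (β * w) + (sum (λ i → D * (h i * x i)) + sum (λ i → β * (unit c i * x i)))
      ≡⟨ cong (D * h₀ + - (β * w) +_) (cong₂ _+_ (sym (*-distribˡ-sum D (λ i → h i * x i)))
           (trans (sym (*-distribˡ-sum β (λ i → unit c i * x i))) (cong (β *_) (sum-unit c x)))) ⟩
    D * h₀ + - (β * w) + (D * sum (λ i → h i * x i) + β * x c)
      ≡⟨ arrange D h₀ β w (sum (λ i → h i * x i)) (x c) ⟩
    D * affine h₀ h x + β * (x c - w) ∎
    where
    open ≡-Reasoning
    distribute : ∀ D h β u x → (D * h + β * u) * x ≡ D * (h * x) + β * (u * x)
    distribute = solve-∀ ringℚ
    arrange : ∀ D h₀ β w s x → D * h₀ + - (β * w) + (D * s + β * x) ≡ D * (h₀ + s) + β * (x - w)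
    arrange = solve-∀ ringℚ

  sum-≥0 : ∀ {m} {f : Vector ℚ m} → (∀ i → 0ℚ ≤ f i) → 0ℚ ≤ sum f
  sum-≥0 {zero}  h = ≤-refl
  sum-≥0 {suc m} h = +-mono-≤ (h zero) (sum-≥0 (h ∘ suc))

  term≤sum : ∀ {m} {f : Vector ℚ m} → (∀ i → 0ℚ ≤ f i) → ∀ i → f i ≤ sum f
  term≤sum {suc m} {f} h zero    = subst (_≤ sum f) (+-identityʳ (f zero)) (+-monoʳ-≤ (f zero) (sum-≥0 (h ∘ suc)))
  term≤sum {suc m} {f} h (suc i) = subst (_≤ sum f) (+-identityˡ (f (suc i))) (+-mono-≤ (h zero) (term≤sum (h ∘ suc) i))

  embed : ∀ {n} → Vector ℚ n → Point n
  embed w c = ι (w c)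

  ≋-sym : ∀ {n} {x y : Point n} → x ≋ y → y ≋ x
  ≋-sym {x = x} {y} h c = ≈ᴿ-sym {x c} {y c} (h c)

  ≋-trans : ∀ {n} {x y z : Point n} → x ≋ y → y ≋ z → x ≋ z
  ≋-trans {x = x} {y} {z} h k c = ≈ᴿ-trans {x c} {y c} {z c} (h c) (k c)

  mixture∈conv : ∀ {n z} {S : Pred (Point n) 0ℓ} (W : Fin z → Vector ℚ n) → (∀ j → embed (W j) ∈ S) →
    (l : Vector ℚ z) → (∀ j → 0ℚ ≤ l j) → sum l ≡ 1ℚ → (w : Vector ℚ n) → (∀ c → sum (λ j → l j * W j c) ≡ w c) →
    embed w ∈ conv S
  mixture∈conv {n} {z} {S} W W∈S l l≥0 Σl w eq = z , embed ∘ W , ι ∘ l , W∈S , weights≥0 , total , combination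
    where
    weights≥0 : ∀ j → 0ᴿ ≤ᴿ ι (l j)
    weights≥0 j = nn-const {l j} (l≥0 j)
    total : sumᴿ (ι ∘ l) ≈ᴿ 1ᴿ
    total = ≗⇒≈ᴿ {sumᴿ (ι ∘ l)} {1ᴿ} (λ k → trans (seq-sumᴿ (ι ∘ l) k) Σl)
    combination : embed w ≋ (λ c → sumᴿ (λ j → ι (l j) *ᴿ embed (W j) c))
    combination c = ≗⇒≈ᴿ {ι (w c)} {sumᴿ (λ j → ι (l j) *ᴿ embed (W j) c)}
      (λ k → trans (sym (eq c)) (sym (seq-sumᴿ (λ j → ι (l j) *ᴿ embed (W j) c) k)))

  -- The weights are rational although `X` is real, so a rational functional has a rational limit at
  -- `X`, as `conv-nonneg` demands.
  Mixture : ∀ {n z} → (Fin z → Vector ℚ n) → Point n → Set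
  Mixture {n} {z} W X = Σ[ l ∈ Vector ℚ z ] (∀ j → 0ℚ ≤ l j) × sum l ≡ 1ℚ × X ≋ embed (λ c → sum (λ j → l j * W j c))

  module _ {n z} (A : Pred (Point n) 0ℓ) (W : Fin z → Vector ℚ n)
    (W∈A : ∀ j → embed (W j) ∈ A)
    (mixture : ∀ X → X ∈ A → Mixture W X)
    (separate : ∀ j → Σ[ h₀ ∈ ℚ ] Σ[ h ∈ Vector ℚ n ] affine h₀ h (W j) < 0ℚ × (∀ i → i ≢ j → 0ℚ ≤ affine h₀ h (W i))) where
    private
      limit : ∀ q₀ q → (∀ i → 0ℚ ≤ affine q₀ q (W i)) → ∀ X → X ∈ A →
        ∃[ η ] 0ℚ ≤ η × Null (λ k → affine q₀ q (coords X k) - η)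
      limit q₀ q q≥0 X X∈ =
        let l , l≥0 , Σl , X≋ = mixture X X∈
            V = λ c → sum (λ j → l j * W j c)
        in affine q₀ q V ,
           subst (0ℚ ≤_) (sym (trans (affine-combination q₀ q l W)
             (trans (cong (λ s → q₀ * (1ℚ - s) + sum (λ j → l j * affine q₀ q (W j))) Σl) (drop q₀ (sum (λ j → l j * affine q₀ q (W j)))))))
             (sum-≥0 {f = λ j → l j * affine q₀ q (W j)} (λ j → *-≥0 (l≥0 j) (q≥0 j))) ,
           affine-≋ q₀ q {X} {embed V} X≋
        where
        drop : ∀ q s → q * (1ℚ - 1ℚ) + s ≡ s
        drop = solve-∀ ringℚ

      eventually> : ∀ (a : ℝ) → 0ᴿ <ᴿ a → Pos (seq a)
      eventually> a (ε , ε>0 , N , h) = ε , ε>0 , N , λ k N≤k → subst (_< seq a k) (+-identityˡ ε) (h k N≤k)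

      -- Up to null errors `a q(x) + b q(y)` equals `q(W j)`, which is 0. Since `q(x)` and `q(y)`
      -- are asymptotically nonnegative, so is `- a q(x)`, and division by `a` shows that `q(x)` is
      -- null.
      face : ∀ q₀ q → (∀ i → 0ℚ ≤ affine q₀ q (W i)) → ∀ j → affine q₀ q (W j) ≡ 0ℚ →
        ∀ x y (a b : ℝ) → x ∈ conv A → y ∈ conv A → 0ᴿ <ᴿ a → 0ᴿ <ᴿ b → a +ᴿ b ≈ᴿ 1ᴿ →
        embed (W j) ≋ (λ c → a *ᴿ x c +ᴿ b *ᴿ y c) → Null (λ k → affine q₀ q (coords x k))
      face q₀ q q≥0 j qW≡0 x y a b x∈ y∈ a>0 b>0 a+b eq =
        nn⇒null {s} (conv-nonneg q₀ q {A} (limit q₀ q q≥0) x x∈)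
          (nn-*⁻¹ {α} {seq a} {λ k → - s k} α>0 a>α
            (nn-ext {λ k → seq b k * r k + (E k + q₀ * (1ℚ - (seq a k + seq b k)))} {λ k → seq a k * - s k} balance
              (nn-+ {λ k → seq b k * r k} {λ k → E k + q₀ * (1ℚ - (seq a k + seq b k))}
                (nn-* {seq b} {r} (seq-bounded b) b>0′ (conv-nonneg q₀ q {A} (limit q₀ q q≥0) y y∈))
                (null⇒nn {λ k → E k + q₀ * (1ℚ - (seq a k + seq b k))} (null-+ {E} {λ k → q₀ * (1ℚ - (seq a k + seq b k))}
                  (affine-≋ q₀ q {embed (W j)} {λ c → a *ᴿ x c +ᴿ b *ᴿ y c} eq)
                  (null-scale q₀ {λ k → 1ℚ - (seq a k + seq b k)} (≈ᴿ-sym {a +ᴿ b} {1ᴿ} a+b)))))))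
        where
        s r E : ℕ → ℚ
        s k = affine q₀ q (coords x k)
        r k = affine q₀ q (coords y k)
        E k = affine q₀ q (W j) - affine q₀ q (λ c → seq a k * seq (x c) k + seq b k * seq (y c) k)
        α = proj₁ (eventually> a a>0)
        α>0 = proj₁ (proj₂ (eventually> a a>0))
        a>α = proj₂ (proj₂ (eventually> a a>0))
        b>0′ : Eventually> 0ℚ (seq b)
        b>0′ = mapᴱ (λ _ → <-trans (proj₁ (proj₂ (eventually> b b>0)))) (proj₂ (proj₂ (eventually> b b>0)))
        arrange : ∀ a b s r u → b * r + (0ℚ - (u + (a * s + b * r)) + u) ≡ a * - s
        arrange = solve-∀ ringℚ
        balance : ∀ k → seq b k * r k + (E k + q₀ * (1ℚ - (seq a k + seq b k))) ≡ seq a k * - s k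
        balance k = trans (cong₂ (λ v w → seq b k * r k + (v - w + q₀ * (1ℚ - (seq a k + seq b k)))) qW≡0
            (affine-mix q₀ q (seq a k) (seq b k) (coords x k) (coords y k)))
          (arrange (seq a k) (seq b k) (s k) (r k) (q₀ * (1ℚ - (seq a k + seq b k))))

      -- With D ≥ |W i c - W j c| for all i, the functionals D g ± γ (x c - W j c) are nonnegative on the
      -- W i and vanish at W j, hence at x.
      segment-end : ∀ j x y (a b : ℝ) → x ∈ conv A → y ∈ conv A → 0ᴿ <ᴿ a → 0ᴿ <ᴿ b → a +ᴿ b ≈ᴿ 1ᴿ →
        embed (W j) ≋ (λ c → a *ᴿ x c +ᴿ b *ᴿ y c) → x ≋ embed (W j)
      segment-end j x y a b x∈ y∈ a>0 b>0 a+b eq c =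
        -- The tilted functionals for `γ` and `- γ` are both null at `x`, and their difference is
        -- `2 γ (x c - W j c)`.
        null-scale⁻¹ {γ + γ} {d} (+-mono-< γ>0 γ>0)
          (null-ext {λ k → Q γ k + - Q (- γ) k} {λ k → (γ + γ) * d k} difference
            (null-+ {Q γ} {λ k → - Q (- γ) k} (on-face γ (λ i → refl-bound i)) (null-neg {Q (- γ)} (on-face (- γ) (λ i → neg-bound i)))))
        where
        h₀ = proj₁ (separate j)
        h = proj₁ (proj₂ (separate j))
        γ = - affine h₀ h (W j)
        γ>0 : 0ℚ < γ
        γ>0 = neg-antimono-< (proj₁ (proj₂ (proj₂ (separate j))))
        -- The separating functional shifted by `γ`: it vanishes at `W j` and is at least `γ` at
        -- every other `W i`.
        g : Vector ℚ n → ℚ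
        g = affine (h₀ + γ) h
        D = sum (λ i → ∣ W i c - W j c ∣)
        d : ℕ → ℚ
        d k = seq (x c) k - W j c
        Q : ℚ → ℕ → ℚ
        Q β k = affine (proj₁ (tilt D (h₀ + γ) h β c (W j c))) (proj₂ (tilt D (h₀ + γ) h β c (W j c))) (coords x k)
        g≡ : ∀ w → g w ≡ affine h₀ h w - affine h₀ h (W j)
        g≡ w = arrange h₀ (sum (λ i → h i * w i)) (affine h₀ h (W j))
          where
          arrange : ∀ h s m → h + - m + s ≡ (h + s) - m
          arrange = solve-∀ ringℚ
        bound : ∀ β → (∀ i → - (β * (W i c - W j c)) ≤ γ * ∣ W i c - W j c ∣) → ∀ i → 0ℚ ≤ D * g (W i) + β * (W i c - W j c)
        bound β small i = go (i ≟ᶠ j)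
          where
          δ = W i c - W j c
          go : Dec (i ≡ j) → 0ℚ ≤ D * g (W i) + β * δ
          go (yes i≡j) = ≤-reflexive (sym (trans (cong (λ i → D * g (W i) + β * (W i c - W j c)) i≡j)
              (trans (cong (λ v → D * v + β * (W j c - W j c)) (g≡ (W j))) (vanish D (affine h₀ h (W j)) β (W j c)))))
            where
            vanish : ∀ D m β w → D * (m - m) + β * (w - w) ≡ 0ℚ
            vanish = solve-∀ ringℚ
          go (no i≢j) = subst (0ℚ ≤_) (arrange D γ (g (W i)) (∣ δ ∣) (β * δ))
              (+-mono-≤ (*-≥0 D≥0 (subst (0ℚ ≤_) g-γ (proj₂ (proj₂ (proj₂ (separate j))) i i≢j)))
                (+-mono-≤ (*-≥0 (<⇒≤ γ>0) (≤-diffℚ (term≤sum {f = λ i → ∣ W i c - W j c ∣} (λ i → 0≤∣p∣ (W i c - W j c)) i)))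
                          (≤-diffℚ (small i))))
            where
            D≥0 : 0ℚ ≤ D
            D≥0 = sum-≥0 {f = λ i → ∣ W i c - W j c ∣} (λ i → 0≤∣p∣ (W i c - W j c))
            g-γ : affine h₀ h (W i) ≡ g (W i) - γ
            g-γ = trans (undo (affine h₀ h (W i)) (affine h₀ h (W j))) (cong (_- γ) (sym (g≡ (W i))))
              where
              undo : ∀ u m → u ≡ (u - m) - - m
              undo = solve-∀ ringℚ
            arrange : ∀ D γ g a b → D * (g - γ) + (γ * (D - a) + (γ * a - - b)) ≡ D * g + b
            arrange = solve-∀ ringℚ
        on-face : ∀ β → (∀ i → - (β * (W i c - W j c)) ≤ γ * ∣ W i c - W j c ∣) → Null (Q β)
        on-face β small = face (proj₁ q) (proj₂ q)
            (λ i → subst (0ℚ ≤_) (sym (affine-tilt D (h₀ + γ) h β c (W j c) (W i))) (bound β small i)) j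
            (trans (affine-tilt D (h₀ + γ) h β c (W j c) (W j)) (trans (cong (λ v → D * v + β * (W j c - W j c)) (g≡ (W j)))
              (vanish D (affine h₀ h (W j)) β (W j c))))
            x y a b x∈ y∈ a>0 b>0 a+b eq
          where
          q = tilt D (h₀ + γ) h β c (W j c)
          vanish : ∀ D m β w → D * (m - m) + β * (w - w) ≡ 0ℚ
          vanish = solve-∀ ringℚ
        refl-bound : ∀ i → - (γ * (W i c - W j c)) ≤ γ * ∣ W i c - W j c ∣
        refl-bound i = subst (_≤ γ * ∣ W i c - W j c ∣) (sym (neg-distribʳ-* γ (W i c - W j c)))
          (*-monoˡ-≤-nonNeg γ {{nonNegative (<⇒≤ γ>0)}} (-p≤∣p∣ (W i c - W j c)))
        neg-bound : ∀ i → - (- γ * (W i c - W j c)) ≤ γ * ∣ W i c - W j c ∣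
        neg-bound i = subst (_≤ γ * ∣ W i c - W j c ∣) (cancel γ (W i c - W j c))
            (*-monoˡ-≤-nonNeg γ {{nonNegative (<⇒≤ γ>0)}} (p≤∣p∣ (W i c - W j c)))
          where
          cancel : ∀ γ δ → γ * δ ≡ - (- γ * δ)
          cancel = solve-∀ ringℚ
        difference : ∀ k → Q γ k + - Q (- γ) k ≡ (γ + γ) * d k
        difference k = trans (cong₂ (λ u v → u + - v) (affine-tilt D (h₀ + γ) h γ c (W j c) (coords x k))
            (affine-tilt D (h₀ + γ) h (- γ) c (W j c) (coords x k))) (arrange (D * g (coords x k)) γ (d k))
          where
          arrange : ∀ m γ d → (m + γ * d) + - (m + - γ * d) ≡ (γ + γ) * d
          arrange = solve-∀ ringℚ

      -- Extremality is used twice: it reduces `p` to one of the points of `A` that combine to it,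
      -- and then, through the mixture representing that point, to one of the `W j`.
      vertex⇒listed : ∀ p → IsVertex (conv A) p → ∃[ j ] p ≋ embed (W j)
      vertex⇒listed p pv@((m , y , a , y∈A , a≥0 , Σa , p≋) , _) =
        let i , p≋yᵢ = extreme-combination {n} {A} {p} pv y a y∈A a≥0 Σa p≋
            l , l≥0 , Σl , yᵢ≋ = mixture (y i) (y∈A i)
            V = λ c → sum (λ j → l j * W j c)
        in extreme-combination {n} {A} {p} pv (embed ∘ W) (ι ∘ l) W∈A (λ j → nn-const (l≥0 j))
             (≗⇒≈ᴿ {sumᴿ (ι ∘ l)} {1ᴿ} (λ k → trans (seq-sumᴿ (ι ∘ l) k) Σl))
             (λ c → ≈ᴿ-trans {p c} {ι (V c)} {sumᴿ (λ j → ι (l j) *ᴿ embed (W j) c)}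
               (≈ᴿ-trans {p c} {y i c} {ι (V c)} (p≋yᵢ c) (yᵢ≋ c))
               (≗⇒≈ᴿ {ι (V c)} {sumᴿ (λ j → ι (l j) *ᴿ embed (W j) c)} (λ k → sym (seq-sumᴿ (λ j → ι (l j) *ᴿ embed (W j) c) k))))

      listed⇒vertex : ∀ p → ∃[ j ] p ≋ embed (W j) → IsVertex (conv A) p
      listed⇒vertex p (j , p≋) = conv-∈ {S = A} {embed (W j)} {p} (W∈A j) p≋ , λ x y a b x∈ y∈ a>0 b>0 a+b eq →
        let ab≋ = ≋-trans {x = embed (W j)} {p} {λ c → a *ᴿ x c +ᴿ b *ᴿ y c} (≋-sym {x = p} {embed (W j)} p≋) eq
            ba≋ = λ c → ≈ᴿ-trans {embed (W j) c} {a *ᴿ x c +ᴿ b *ᴿ y c} {b *ᴿ y c +ᴿ a *ᴿ x c} (ab≋ c)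
                    (≗⇒≈ᴿ {a *ᴿ x c +ᴿ b *ᴿ y c} {b *ᴿ y c +ᴿ a *ᴿ x c} (λ k → +-comm (seq a k * seq (x c) k) (seq b k * seq (y c) k)))
            b+a = ≈ᴿ-trans {b +ᴿ a} {a +ᴿ b} {1ᴿ} (≗⇒≈ᴿ {b +ᴿ a} {a +ᴿ b} (λ k → +-comm (seq b k) (seq a k))) a+b
        in ≋-trans {x = x} {embed (W j)} {y} (segment-end j x y a b x∈ y∈ a>0 b>0 a+b ab≋)
             (≋-sym {x = y} {embed (W j)} (segment-end j y x b a y∈ x∈ b>0 a>0 b+a ba≋))

      distinct : ∀ i j → embed (W i) ≋ embed (W j) → i ≡ j
      distinct i j eq = go (i ≟ᶠ j)
        where
        go : Dec (i ≡ j) → i ≡ j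
        go (yes i≡j) = i≡j
        go (no i≢j) = contradiction (≤-<-trans (proj₂ (proj₂ (proj₂ (separate j))) i i≢j)
          (subst (_< 0ℚ) (affine-cong (proj₁ (separate j)) (proj₁ (proj₂ (separate j))) (λ c → sym (ι-injective {W i c} {W j c} (eq c))))
            (proj₁ (proj₂ (proj₂ (separate j)))))) (<-irrefl refl)

    hasVertices : HasVertices (conv A) (embed ∘ W)
    hasVertices = (λ p → mk⇔ (vertex⇒listed p) (listed⇒vertex p)) , distinct

-- From rational functions to integral homogeneous vectors.

module RationalData where

  open import Defs using (ℚ[t]; eval; _≈ᴾ_; 0ᴾ; ℚ⟨t⟩; num; den; den≉0; DefinedAt; value)
  open IntegersAndPolynomials
  open ConeDescription using (Row)
  open RealHulls using (ringℚ)
  open import Data.Nat as ℕ using (ℕ; zero; suc)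
  open import Data.Nat.Coprimality as Coprime using (1-coprimeTo)
  open import Data.Integer as ℤ using (ℤ; +_; 0ℤ; 1ℤ)
  import Data.Integer.Properties as ℤ
  import Data.Integer.Tactic.RingSolver as ℤ-Solver
  open import Data.Rational
  open import Data.Rational.Properties
  import Data.Rational.Unnormalised as ℚᵘ
  open ℚᵘ using (mkℚᵘ; *≡*)
  import Data.Rational.Unnormalised.Properties as ℚᵘ
  open import Data.Fin using (Fin; zero; suc)
  open import Data.List using (List; []; _∷_)
  open import Data.List.Relation.Unary.All as All using (All; []; _∷_)
  open import Data.Vec.Functional using (Vector)
  open import Data.Product using (Σ-syntax; _×_; _,_; proj₁; proj₂)
  open import Data.Sum using (_⊎_; inj₁; inj₂)
  open import Function using (_∘_)
  open import Relation.Nullary using (contradiction)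
  open import Relation.Binary.PropositionalEquality
  open import Tactic.RingSolver using (solve-∀)
  open import Algebra.Bundles using (CommutativeRing)
  import Algebra.Properties.Semiring.Sum (CommutativeRing.semiring +-*-commutativeRing) as ℚΣ

  -- `a / 1` in literal normal form: its numerator and denominator compute without the normalisation
  -- by a gcd that `_/_` performs.
  frac : ℤ → ℚ
  frac a = mkℚ a 0 (Coprime.sym (1-coprimeTo ℤ.∣ a ∣))

  frac≡ : ∀ a → a / 1 ≡ frac a
  frac≡ a = ↥p/↧p≡p (frac a)

  frac-+ : ∀ a b → frac (a ℤ.+ b) ≡ frac a + frac b
  frac-+ a b = toℚᵘ-injective (ℚᵘ.≃-trans (*≡* (arrange a b)) (ℚᵘ.≃-sym (toℚᵘ-homo-+ (frac a) (frac b))))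
    where
    arrange : ∀ a b → (a ℤ.+ b) ℤ.* 1ℤ ≡ (a ℤ.* 1ℤ ℤ.+ b ℤ.* 1ℤ) ℤ.* 1ℤ
    arrange = ℤ-Solver.solve-∀

  frac-* : ∀ a b → frac (a ℤ.* b) ≡ frac a * frac b
  frac-* a b = toℚᵘ-injective (ℚᵘ.≃-trans (*≡* refl) (ℚᵘ.≃-sym (toℚᵘ-homo-* (frac a) (frac b))))

  frac-neg : ∀ a → frac (ℤ.- a) ≡ - frac a
  frac-neg a = begin
    frac (ℤ.- a)                        ≡⟨ expand (frac (ℤ.- a)) (frac a) ⟩
    frac (ℤ.- a) + frac a - frac a      ≡⟨ cong (_- frac a) (sym (frac-+ (ℤ.- a) a)) ⟩
    frac (ℤ.- a ℤ.+ a) - frac a         ≡⟨ cong (λ z → frac z - frac a) (ℤ.+-inverseˡ a) ⟩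
    0ℚ - frac a                         ≡⟨ +-identityˡ (- frac a) ⟩
    - frac a                            ∎
    where
    open ≡-Reasoning
    expand : ∀ x y → x ≡ x + y - y
    expand = solve-∀ ringℚ

  frac-sum : ∀ {m} (f : Fin m → ℤ) → frac (sum f) ≡ ℚΣ.sum (frac ∘ f)
  frac-sum {zero}  f = refl
  frac-sum {suc m} f = trans (frac-+ (f zero) (sum (f ∘ suc))) (cong (λ q → frac (f zero) + q) (frac-sum (f ∘ suc)))

  frac-≤ : ∀ {a} → 0ℤ ℤ.≤ a → 0ℚ ≤ frac a
  frac-≤ {a} h = *≤* (subst (0ℤ ℤ.≤_) (sym (ℤ.*-identityʳ a)) h)

  frac-≤⁻¹ : ∀ {a} → 0ℚ ≤ frac a → 0ℤ ℤ.≤ a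
  frac-≤⁻¹ {a} (*≤* h) = subst (0ℤ ℤ.≤_) (ℤ.*-identityʳ a) h

  frac-< : ∀ {a} → 0ℤ ℤ.< a → 0ℚ < frac a
  frac-< {a} h = *<* (subst (0ℤ ℤ.<_) (sym (ℤ.*-identityʳ a)) h)

  cancelˡ : ∀ {a x y} → 0ℚ < a → a * x ≡ a * y → x ≡ y
  cancelˡ {a} {x} {y} a>0 eq = begin
    x                  ≡⟨ sym (*-identityˡ x) ⟩
    1ℚ * x             ≡⟨ cong (_* x) (sym (*-inverseˡ a)) ⟩
    1/ a * a * x       ≡⟨ *-assoc (1/ a) a x ⟩
    1/ a * (a * x)     ≡⟨ cong (1/ a *_) eq ⟩
    1/ a * (a * y)     ≡⟨ sym (*-assoc (1/ a) a y) ⟩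
    1/ a * a * y       ≡⟨ cong (_* y) (*-inverseˡ a) ⟩
    1ℚ * y             ≡⟨ *-identityˡ y ⟩
    y                  ∎
    where
    open ≡-Reasoning
    instance _ = pos⇒nonZero a {{positive a>0}}

  *-≥0⁻¹ : ∀ {a x} → 0ℚ < a → 0ℚ ≤ a * x → 0ℚ ≤ x
  *-≥0⁻¹ {a} {x} a>0 h = *-cancelˡ-≤-pos a {{positive a>0}} (subst (_≤ a * x) (sym (*-zeroʳ a)) h)

  /-whole : ∀ a l → frac a ≡ frac (+ suc l) * (a / suc l)
  /-whole a l = toℚᵘ-injective (ℚᵘ.≃-sym (ℚᵘ.≃-trans (toℚᵘ-homo-* (frac (+ suc l)) (a / suc l))
      (ℚᵘ.≃-trans (ℚᵘ.*-congˡ {mkℚᵘ (+ suc l) 0} (toℚᵘ-fromℚᵘ (mkℚᵘ a l))) (*≡* (arrange (+ suc l) a)))))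
    where
    arrange : ∀ l a → l ℤ.* a ℤ.* 1ℤ ≡ a ℤ.* (1ℤ ℤ.* l)
    arrange = ℤ-Solver.solve-∀

  ↧*p≡↥ : ∀ p → frac (↧ p) * p ≡ frac (↥ p)
  ↧*p≡↥ p@record{} = toℚᵘ-injective (ℚᵘ.≃-trans (toℚᵘ-homo-* (frac (↧ p)) p) (*≡* (arrange (↧ p) (↥ p))))
    where
    arrange : ∀ d n → d ℤ.* n ℤ.* 1ℤ ≡ n ℤ.* (1ℤ ℤ.* d)
    arrange = ℤ-Solver.solve-∀

  -- `zero?` carries formal vanishing back to `p`, so that a nonzero denominator cannot be cleared
  -- to a zero polynomial.
  record Cleared (p : ℚ[t]) : Set where
    field
      scale  : ℤ
      poly   : Poly
      scale>0 : 0ℤ ℤ.< scale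
      eval≡  : ∀ t → frac (ev poly t) ≡ frac scale * eval p t
      zero?  : All (_≡ 0ℤ) poly → p ≈ᴾ 0ᴾ

  clear : ∀ p → Cleared p
  clear [] = record { scale = 1ℤ ; poly = [] ; scale>0 = ℤ.+<+ ℕ.z<s ; eval≡ = λ t → refl ; zero? = λ _ i → refl }
  clear (a ∷ p) = record
    { scale = ↧ a ℤ.* scale
    ; poly = ↥ a ℤ.* scale ∷ (↧ a ⊙ poly)
    ; scale>0 = *-pos {↧ a} (ℤ.+<+ ℕ.z<s) scale>0
    ; eval≡ = eq
    ; zero? = λ { (z ∷ zs) zero → a≡0 z ; (z ∷ zs) (suc i) → zero? (unscale poly zs) i } }
    where
    open Cleared (clear p)
    open ≡-Reasoning
    arrange : ∀ d s a t e → (d * a) * s + t * (d * (s * e)) ≡ d * s * (a + t * e)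
    arrange = solve-∀ ringℚ
    eq : ∀ t → frac (↥ a ℤ.* scale ℤ.+ + t ℤ.* ev (↧ a ⊙ poly) t) ≡ frac (↧ a ℤ.* scale) * (a + (+ t / 1) * eval p t)
    eq t = begin
      frac (↥ a ℤ.* scale ℤ.+ + t ℤ.* ev (↧ a ⊙ poly) t)
        ≡⟨ frac-+ (↥ a ℤ.* scale) (+ t ℤ.* ev (↧ a ⊙ poly) t) ⟩
      frac (↥ a ℤ.* scale) + frac (+ t ℤ.* ev (↧ a ⊙ poly) t)
        ≡⟨ cong₂ _+_ (trans (frac-* (↥ a) scale) (cong (_* frac scale) (sym (↧*p≡↥ a))))
             (trans (frac-* (+ t) (ev (↧ a ⊙ poly) t)) (cong (frac (+ t) *_) (trans (cong frac (ev-⊙ (↧ a) poly t))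
               (trans (frac-* (↧ a) (ev poly t)) (cong (frac (↧ a) *_) (eval≡ t)))))) ⟩
      (frac (↧ a) * a) * frac scale + frac (+ t) * (frac (↧ a) * (frac scale * eval p t))
        ≡⟨ arrange (frac (↧ a)) (frac scale) a (frac (+ t)) (eval p t) ⟩
      frac (↧ a) * frac scale * (a + frac (+ t) * eval p t)
        ≡⟨ cong₂ (λ s u → s * (a + u * eval p t)) (sym (frac-* (↧ a) scale)) (sym (frac≡ (+ t))) ⟩
      frac (↧ a ℤ.* scale) * (a + (+ t / 1) * eval p t) ∎
    nonzero : ∀ {x y} → 0ℤ ℤ.< y → x ℤ.* y ≡ 0ℤ → x ≡ 0ℤ
    nonzero {x} {y} y>0 e = ℤ.*-cancelʳ-≡ x 0ℤ y {{ℤ.>-nonZero y>0}} e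
    a≡0 : ↥ a ℤ.* scale ≡ 0ℤ → a ≡ 0ℚ
    a≡0 e = ↥p≡0⇒p≡0 a (nonzero scale>0 e)
    unscale : ∀ q → All (_≡ 0ℤ) (↧ a ⊙ q) → All (_≡ 0ℤ) q
    unscale []      []       = []
    unscale (b ∷ q) (z ∷ zs) = nonzero {b} {↧ a} (ℤ.+<+ ℕ.z<s) (trans (ℤ.*-comm b (↧ a)) z) ∷ unscale q zs

  value-* : ∀ t f d → value t f d * eval (den f) t ≡ eval (num f) t
  value-* t f d = begin
    eval (num f) t * 1/ q * q      ≡⟨ *-assoc (eval (num f) t) (1/ q) q ⟩
    eval (num f) t * (1/ q * q)    ≡⟨ cong (eval (num f) t *_) (*-inverseˡ q) ⟩
    eval (num f) t * 1ℚ            ≡⟨ *-identityʳ (eval (num f) t) ⟩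
    eval (num f) t                 ∎
    where
    open ≡-Reasoning
    q = eval (den f) t
    instance _ = ≢-nonZero d

  record IntegerFraction (f : ℚ⟨t⟩) : Set where
    field
      upper lower : Poly
      lower>0 : Eventually (λ t → 0ℤ ℤ.< ev lower t)
      defined : Eventually (λ t → DefinedAt t f)
      value≡  : ∀ t d → frac (ev upper t) ≡ frac (ev lower t) * value t f d

  integerFraction : ∀ f → IntegerFraction f
  integerFraction f = record
    -- The fraction `A / B` is expanded by `B`: the new denominator is a square, positive whatever
    -- the eventual sign of `B`.
    { upper = A ⊗ B ; lower = B ⊗ B
    ; lower>0 = mapᴱ (λ t → B²>0 t) Q≢0
    ; defined = mapᴱ (λ t h e → Q-nonzero h (frac-injective (trans (D.eval≡ t) (trans (cong (frac D.scale *_) e) (*-zeroʳ (frac D.scale)))))) Q≢0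
    ; value≡ = eq }
    where
    module N = Cleared (clear (num f))
    module D = Cleared (clear (den f))
    A B : Poly
    A = D.scale ⊙ N.poly
    B = N.scale ⊙ D.poly
    Apart : ℤ → Set
    Apart x = 0ℤ ℤ.< x ⊎ 0ℤ ℤ.< ℤ.- x
    Q-nonzero : ∀ {x} → Apart x → x ≢ 0ℤ
    Q-nonzero (inj₁ h) refl = ℤ.<-irrefl refl h
    Q-nonzero (inj₂ h) refl = ℤ.<-irrefl refl h
    frac-injective : ∀ {x} → frac x ≡ 0ℚ → x ≡ 0ℤ
    frac-injective {x} e = cong ↥_ e
    Q≢0 : Eventually (λ t → Apart (ev D.poly t))
    Q≢0 with sign D.poly
    ... | zer z  = contradiction (D.zero? z) (den≉0 f)
    ... | pos₊ h = mapᴱ (λ _ → inj₁) h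
    ... | neg₋ h = mapᴱ (λ _ → inj₂) h
    square : ∀ s x → (s ℤ.* ℤ.- x) ℤ.* (s ℤ.* ℤ.- x) ≡ (s ℤ.* x) ℤ.* (s ℤ.* x)
    square = ℤ-Solver.solve-∀
    B≡ : ∀ t → ev (B ⊗ B) t ≡ (N.scale ℤ.* ev D.poly t) ℤ.* (N.scale ℤ.* ev D.poly t)
    B≡ t = trans (ev-⊗ B B t) (cong (λ b → b ℤ.* b) (ev-⊙ N.scale D.poly t))
    B²>0 : ∀ t → Apart (ev D.poly t) → 0ℤ ℤ.< ev (B ⊗ B) t
    B²>0 t (inj₁ h) = subst (0ℤ ℤ.<_) (sym (B≡ t)) (*-pos (*-pos N.scale>0 h) (*-pos N.scale>0 h))
    B²>0 t (inj₂ h) = subst (0ℤ ℤ.<_) (trans (square N.scale (ev D.poly t)) (sym (B≡ t))) (*-pos (*-pos N.scale>0 h) (*-pos N.scale>0 h))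
    evA : ∀ t → frac (ev A t) ≡ frac D.scale * (frac N.scale * eval (num f) t)
    evA t = trans (cong frac (ev-⊙ D.scale N.poly t)) (trans (frac-* D.scale (ev N.poly t)) (cong (frac D.scale *_) (N.eval≡ t)))
    evB : ∀ t → frac (ev B t) ≡ frac N.scale * (frac D.scale * eval (den f) t)
    evB t = trans (cong frac (ev-⊙ N.scale D.poly t)) (trans (frac-* N.scale (ev D.poly t)) (cong (frac N.scale *_) (D.eval≡ t)))
    arrange : ∀ d n v q → d * (n * (v * q)) ≡ n * (d * q) * v
    arrange = solve-∀ ringℚ
    swap : ∀ b v → b * v * b ≡ b * b * v
    swap = solve-∀ ringℚ
    A≡Bv : ∀ t d → frac (ev A t) ≡ frac (ev B t) * value t f d
    A≡Bv t d = trans (evA t) (trans (cong (λ x → frac D.scale * (frac N.scale * x)) (sym (value-* t f d)))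
      (trans (arrange (frac D.scale) (frac N.scale) (value t f d) (eval (den f) t)) (cong (_* value t f d) (sym (evB t)))))
    eq : ∀ t d → frac (ev (A ⊗ B) t) ≡ frac (ev (B ⊗ B) t) * value t f d
    eq t d = begin
      frac (ev (A ⊗ B) t)                              ≡⟨ trans (cong frac (ev-⊗ A B t)) (frac-* (ev A t) (ev B t)) ⟩
      frac (ev A t) * frac (ev B t)                    ≡⟨ cong (_* frac (ev B t)) (A≡Bv t d) ⟩
      frac (ev B t) * value t f d * frac (ev B t)      ≡⟨ swap (frac (ev B t)) (value t f d) ⟩
      frac (ev B t) * frac (ev B t) * value t f d      ≡⟨ cong (_* value t f d) (sym (trans (cong frac (ev-⊗ B B t)) (frac-* (ev B t) (ev B t)))) ⟩
      frac (ev (B ⊗ B) t) * value t f d                ∎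
      where open ≡-Reasoning

  -- `q` is the product of all `B c`, and `G c` is `A c` times the remaining factors. The equality
  -- of the fractions is stated in cross-multiplied form.
  commonDenominator : ∀ {n} (A B : Fin n → Poly) → Σ[ q ∈ Poly ] Σ[ G ∈ (Fin n → Poly) ]
    (∀ t → (∀ c → 0ℤ ℤ.< ev (B c) t) → 0ℤ ℤ.< ev q t) × (∀ c t → ev (G c) t ℤ.* ev (B c) t ≡ ev q t ℤ.* ev (A c) t)
  commonDenominator {zero}  A B = K 1ℤ , (λ ()) , (λ t _ → subst (0ℤ ℤ.<_) (sym (ev-K 1ℤ t)) (ℤ.+<+ ℕ.z<s)) , λ ()
  commonDenominator {suc n} A B with commonDenominator (A ∘ suc) (B ∘ suc)
  ... | q , G , q>0 , eq = B zero ⊗ q , G′ ,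
      (λ t h → subst (0ℤ ℤ.<_) (sym (ev-⊗ (B zero) q t)) (*-pos (h zero) (q>0 t (h ∘ suc)))) , eq′
    where
    G′ : Fin (suc n) → Poly
    G′ zero    = A zero ⊗ q
    G′ (suc c) = B zero ⊗ G c
    arr₁ : ∀ a q b → a ℤ.* q ℤ.* b ≡ b ℤ.* q ℤ.* a
    arr₁ = ℤ-Solver.solve-∀
    eq′ : ∀ c t → ev (G′ c) t ℤ.* ev (B c) t ≡ ev (B zero ⊗ q) t ℤ.* ev (A c) t
    eq′ zero t = trans (cong (ℤ._* ev (B zero) t) (ev-⊗ (A zero) q t)) (trans (arr₁ (ev (A zero) t) (ev q t) (ev (B zero) t))
      (cong (ℤ._* ev (A zero) t) (sym (ev-⊗ (B zero) q t))))
    eq′ (suc c) t = begin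
      ev (B zero ⊗ G c) t ℤ.* ev (B (suc c)) t                   ≡⟨ cong (ℤ._* ev (B (suc c)) t) (ev-⊗ (B zero) (G c) t) ⟩
      ev (B zero) t ℤ.* ev (G c) t ℤ.* ev (B (suc c)) t          ≡⟨ ℤ.*-assoc (ev (B zero) t) (ev (G c) t) (ev (B (suc c)) t) ⟩
      ev (B zero) t ℤ.* (ev (G c) t ℤ.* ev (B (suc c)) t)        ≡⟨ cong (ev (B zero) t ℤ.*_) (eq c t) ⟩
      ev (B zero) t ℤ.* (ev q t ℤ.* ev (A (suc c)) t)            ≡⟨ sym (ℤ.*-assoc (ev (B zero) t) (ev q t) (ev (A (suc c)) t)) ⟩
      ev (B zero) t ℤ.* ev q t ℤ.* ev (A (suc c)) t              ≡⟨ cong (ℤ._* ev (A (suc c)) t) (sym (ev-⊗ (B zero) q t)) ⟩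
      ev (B zero ⊗ q) t ℤ.* ev (A (suc c)) t                     ∎
      where open ≡-Reasoning

  record Homogenized {n} (v : Vector ℚ⟨t⟩ n) : Set where
    field
      row     : Row (suc n)
      row>0   : Eventually (λ t → 0ℤ ℤ.< ev (row zero) t)
      defined : Eventually (λ t → ∀ c → DefinedAt t (v c))
      value≡  : Eventually (λ t → ∀ c d → frac (ev (row (suc c)) t) ≡ frac (ev (row zero) t) * value t (v c) d)

  homogenize : ∀ {n} (v : Vector ℚ⟨t⟩ n) → Homogenized v
  homogenize {n} v = record
    { row = row ; row>0 = mapᴱ q>0 lowers>0
    ; defined = allFinᴱ (λ c → IntegerFraction.defined (fraction c))
    ; value≡ = mapᴱ (λ t h c d → cancelˡ (frac-< (h c)) (eq′ t c d)) lowers>0 }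
    where
    fraction : ∀ c → IntegerFraction (v c)
    fraction c = integerFraction (v c)
    A B : Fin n → Poly
    A c = IntegerFraction.upper (fraction c)
    B c = IntegerFraction.lower (fraction c)
    lowers>0 : Eventually (λ t → ∀ c → 0ℤ ℤ.< ev (B c) t)
    lowers>0 = allFinᴱ (λ c → IntegerFraction.lower>0 (fraction c))
    common = commonDenominator A B
    q = proj₁ common
    G = proj₁ (proj₂ common)
    q>0 = proj₁ (proj₂ (proj₂ common))
    eq = proj₂ (proj₂ (proj₂ common))
    row : Row (suc n)
    row zero    = q
    row (suc c) = G c
    arrange : ∀ q b v → q * (b * v) ≡ b * (q * v)
    arrange = solve-∀ ringℚ
    eq′ : ∀ t c d → frac (ev (B c) t) * frac (ev (G c) t) ≡ frac (ev (B c) t) * (frac (ev q t) * value t (v c) d)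
    eq′ t c d = begin
      frac (ev (B c) t) * frac (ev (G c) t)                        ≡⟨ *-comm (frac (ev (B c) t)) (frac (ev (G c) t)) ⟩
      frac (ev (G c) t) * frac (ev (B c) t)                        ≡⟨ sym (frac-* (ev (G c) t) (ev (B c) t)) ⟩
      frac (ev (G c) t ℤ.* ev (B c) t)                             ≡⟨ cong frac (eq c t) ⟩
      frac (ev q t ℤ.* ev (A c) t)                                 ≡⟨ frac-* (ev q t) (ev (A c) t) ⟩
      frac (ev q t) * frac (ev (A c) t)                            ≡⟨ cong (frac (ev q t) *_) (IntegerFraction.value≡ (fraction c) t d) ⟩
      frac (ev q t) * (frac (ev (B c) t) * value t (v c) d)        ≡⟨ arrange (frac (ev q t)) (frac (ev (B c) t)) (value t (v c) d) ⟩
      frac (ev (B c) t) * (frac (ev q t) * value t (v c) d)        ∎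
      where open ≡-Reasoning

-- Transfer between integral cones and real convex hulls.

module Families where

  open import Defs
  open IntegersAndPolynomials
  open ConeDescription
  open Hulls
  open Pruning
  open RealHulls using (diffℚ-<; ringℚ; affine; coords; embed; Mixture; mixture∈conv; hasVertices; affine-≋; conv-nonneg; nn-const⁻¹;
    nn-+; nn-ext; null⇒nn; ≈ᴿ-trans; ≗⇒≈ᴿ; Null; *-≥0; *->0⁻¹; divide; null-neg)
  open RationalData
  open import Data.Nat as ℕ using (ℕ; zero; suc; NonZero)
  import Data.Nat.Properties as ℕ
  open import Data.Integer as ℤ using (ℤ; +_; -[1+_]; 0ℤ; 1ℤ)
  import Data.Integer.Properties as ℤ
  open import Data.Rational hiding (NonZero)
  open import Data.Rational.Properties
  open import Data.Fin using (Fin; zero; suc)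
  open import Data.List using (List; []; _∷_; map; length; lookup)
  open import Data.List.Relation.Unary.All as All using (All; []; _∷_)
  open import Data.Vec.Functional using (Vector)
  open import Data.Product using (Σ-syntax; ∃-syntax; _×_; _,_; proj₁; proj₂)
  open import Function using (_∘_)
  open import Relation.Unary using (Pred; _∈_; _∩_)
  open import Relation.Binary.PropositionalEquality
  open import Tactic.RingSolver using (solve-∀)
  open import Algebra.Bundles using (CommutativeRing)
  import Algebra.Properties.Semiring.Sum (CommutativeRing.semiring +-*-commutativeRing) as ℚΣ
  open ℚΣ using () renaming (sum to sumℚ; sum-cong-≗ to sumℚ-cong; *-distribˡ-sum to *-distribˡ-sumℚ)

  -- G is a positive multiple of (1 , P).
  Represents : ∀ {n} → Vℤ (suc n) → Vector ℚ n → Set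
  Represents G P = 0ℤ ℤ.< G zero × (∀ c → frac (G (suc c)) ≡ frac (G zero) * P c)

  -- The factor `frac (G zero)` is positive, so signs pass between integral pairings and affine
  -- functionals.
  frac-dot : ∀ {n} (h G : Vℤ (suc n)) {P} → Represents G P →
    frac (dot h G) ≡ frac (G zero) * affine (frac (h zero)) (frac ∘ h ∘ suc) P
  frac-dot {n} h G {P} (_ , G≡) = begin
    frac (h zero ℤ.* G zero ℤ.+ sum tail′)
      ≡⟨ trans (frac-+ (h zero ℤ.* G zero) (sum tail′)) (cong₂ _+_ (frac-* (h zero) (G zero)) (frac-sum tail′)) ⟩
    frac (h zero) * g + sumℚ (frac ∘ tail′)
      ≡⟨ cong (λ q → frac (h zero) * g + q) (sumℚ-cong (λ c → trans (frac-* (h (suc c)) (G (suc c)))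
           (trans (cong (frac (h (suc c)) *_) (G≡ c)) (swap (frac (h (suc c))) g (P c))))) ⟩
    frac (h zero) * g + sumℚ (λ c → g * (frac (h (suc c)) * P c))
      ≡⟨ cong (λ q → frac (h zero) * g + q) (sym (*-distribˡ-sumℚ g (λ c → frac (h (suc c)) * P c))) ⟩
    frac (h zero) * g + g * sumℚ (λ c → frac (h (suc c)) * P c)
      ≡⟨ factor (frac (h zero)) g (sumℚ (λ c → frac (h (suc c)) * P c)) ⟩
    g * affine (frac (h zero)) (frac ∘ h ∘ suc) P ∎
    where
    open ≡-Reasoning
    g = frac (G zero)
    tail′ : Vℤ n
    tail′ c = h (suc c) ℤ.* G (suc c)
    swap : ∀ h g p → h * (g * p) ≡ g * (h * p)
    swap = solve-∀ ringℚ
    factor : ∀ h g s → h * g + g * s ≡ g * (h + s)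
    factor = solve-∀ ringℚ

  represents-lattice : ∀ {n} (u : Vℤ (suc n)) → u zero ≡ 1ℤ → Represents u (λ c → u (suc c) / 1)
  represents-lattice u u₀ = subst (0ℤ ℤ.<_) (sym u₀) (ℤ.+<+ ℕ.z<s) , λ c → begin
      frac (u (suc c))                       ≡⟨ sym (frac≡ (u (suc c))) ⟩
      u (suc c) / 1                          ≡⟨ sym (*-identityˡ (u (suc c) / 1)) ⟩
      1ℚ * (u (suc c) / 1)                   ≡⟨ cong (λ z → frac z * (u (suc c) / 1)) (sym u₀) ⟩
      frac (u zero) * (u (suc c) / 1)        ∎
    where open ≡-Reasoning

  -- The weights are `a i * G i zero / μ`. Coordinate 0 of the cone equation says that they sum to
  -- 1, the other coordinates that they produce the point.
  cone⇒mixture : ∀ {k n} (G : Fin k → Vℤ (suc n)) (P : Fin k → Vector ℚ n) → (∀ i → Represents (G i) (P i)) →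
    ∀ u → u zero ≡ 1ℤ → Cone G u →
    Σ[ l ∈ Vector ℚ k ] (∀ i → 0ℚ ≤ l i) × sumℚ l ≡ 1ℚ × (∀ c → sumℚ (λ i → l i * P i c) ≡ u (suc c) / 1)
  cone⇒mixture {k} {n} G P rep u u₀ (μ , a , μ>0 , a≥0 , eq) =
    let ν , ν>0 , μν≡1 = divide (frac-< μ>0) (positive⁻¹ 1ℚ)
    in (λ i → ν * (frac (a i) * frac (G i zero))) ,
       (λ i → *-≥0 (<⇒≤ ν>0) (*-≥0 (frac-≤ (a≥0 i)) (<⇒≤ (frac-< (proj₁ (rep i)))))) ,
       total ν μν≡1 , coordinate ν μν≡1
    where
    open ≡-Reasoning
    scaled : ∀ ν → frac μ * ν ≡ 1ℚ → ∀ x → ν * frac (μ ℤ.* x) ≡ frac x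
    scaled ν μν≡1 x = begin
      ν * frac (μ ℤ.* x)        ≡⟨ cong (ν *_) (frac-* μ x) ⟩
      ν * (frac μ * frac x)     ≡⟨ arrange ν (frac μ) (frac x) ⟩
      frac μ * ν * frac x       ≡⟨ cong (_* frac x) μν≡1 ⟩
      1ℚ * frac x               ≡⟨ *-identityˡ (frac x) ⟩
      frac x                    ∎
      where
      arrange : ∀ ν μ x → ν * (μ * x) ≡ μ * ν * x
      arrange = solve-∀ ringℚ
    collect : ∀ c → frac (μ ℤ.* u c) ≡ sumℚ (λ i → frac (a i) * frac (G i c))
    collect c = trans (cong frac (eq c)) (trans (frac-sum (λ i → a i ℤ.* G i c)) (sumℚ-cong (λ i → frac-* (a i) (G i c))))
    total : ∀ ν → frac μ * ν ≡ 1ℚ → sumℚ (λ i → ν * (frac (a i) * frac (G i zero))) ≡ 1ℚ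
    total ν μν≡1 = begin
      sumℚ (λ i → ν * (frac (a i) * frac (G i zero)))      ≡⟨ sym (*-distribˡ-sumℚ ν (λ i → frac (a i) * frac (G i zero))) ⟩
      ν * sumℚ (λ i → frac (a i) * frac (G i zero))        ≡⟨ cong (ν *_) (sym (collect zero)) ⟩
      ν * frac (μ ℤ.* u zero)                              ≡⟨ scaled ν μν≡1 (u zero) ⟩
      frac (u zero)                                        ≡⟨ cong frac u₀ ⟩
      1ℚ                                                   ∎
    coordinate : ∀ ν → frac μ * ν ≡ 1ℚ → ∀ c → sumℚ (λ i → ν * (frac (a i) * frac (G i zero)) * P i c) ≡ u (suc c) / 1
    coordinate ν μν≡1 c = begin
      sumℚ (λ i → ν * (frac (a i) * frac (G i zero)) * P i c)
        ≡⟨ sumℚ-cong (λ i → trans (arrange ν (frac (a i)) (frac (G i zero)) (P i c)) (cong (λ g → ν * (frac (a i) * g)) (sym (proj₂ (rep i) c)))) ⟩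
      sumℚ (λ i → ν * (frac (a i) * frac (G i (suc c))))
        ≡⟨ sym (*-distribˡ-sumℚ ν (λ i → frac (a i) * frac (G i (suc c)))) ⟩
      ν * sumℚ (λ i → frac (a i) * frac (G i (suc c)))
        ≡⟨ cong (ν *_) (sym (collect (suc c))) ⟩
      ν * frac (μ ℤ.* u (suc c))
        ≡⟨ scaled ν μν≡1 (u (suc c)) ⟩
      frac (u (suc c))
        ≡⟨ sym (frac≡ (u (suc c))) ⟩
      u (suc c) / 1 ∎
      where
      arrange : ∀ ν a g p → ν * (a * g) * p ≡ ν * (a * (g * p))
      arrange = solve-∀ ringℚ

  -- The value for L ≤ 0 is junk: L is positive on every curve that occurs.
  quotient : ℤ → Poly → ℚ[t]
  quotient (+ zero)  p = []
  quotient (+ suc l) p = map (_/ suc l) p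
  quotient -[1+ _ ]  p = []

  eval-quotient : ∀ L → 0ℤ ℤ.< L → ∀ p t → frac (ev p t) ≡ frac L * eval (quotient L p) t
  eval-quotient (+ zero)  (ℤ.+<+ ()) p t
  eval-quotient (+ suc l) _ [] t = sym (*-zeroʳ (frac (+ suc l)))
  eval-quotient (+ suc l) L>0 (a ∷ p) t = begin
    frac (a ℤ.+ + t ℤ.* ev p t)
      ≡⟨ trans (frac-+ a (+ t ℤ.* ev p t)) (cong₂ _+_ (whole a) (trans (frac-* (+ t) (ev p t)) (cong (frac (+ t) *_) (eval-quotient (+ suc l) L>0 p t)))) ⟩
    frac L * (a / suc l) + frac (+ t) * (frac L * eval (map (_/ suc l) p) t)
      ≡⟨ arrange (frac L) (a / suc l) (frac (+ t)) (eval (map (_/ suc l) p) t) ⟩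
    frac L * (a / suc l + frac (+ t) * eval (map (_/ suc l) p) t)
      ≡⟨ cong (λ s → frac L * (a / suc l + s * eval (map (_/ suc l) p) t)) (sym (frac≡ (+ t))) ⟩
    frac L * (a / suc l + (+ t / 1) * eval (map (_/ suc l) p) t) ∎
    where
    open ≡-Reasoning
    L = + suc l
    arrange : ∀ L a t e → L * a + t * (L * e) ≡ L * (a + t * e)
    arrange = solve-∀ ringℚ
    whole : ∀ a → frac a ≡ frac L * (a / suc l)
    whole a = /-whole a l

  -- Dehomogenisation: where the curve passes through a lattice point with `u zero ≡ 1ℤ`, its
  -- coordinate 0 has the value `L`, which is the divisor.
  point : ∀ {n} → Curve (suc n) → Vector ℚ[t] n
  point (L , G) c = quotient L (G (suc c))

  onCurve⇒represents : ∀ {n} {S : ℕ → Vℤ (suc n) → Set} {t} (w : Curve (suc n)) →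
    (∀ {u} → S t u → u zero ≡ 1ℤ) → OnCurve S t w → Represents (at t w) (λ c → eval (point w c) t)
  onCurve⇒represents {t = t} (L , G) S₁ (u , s , L>0 , eq) =
    subst (0ℤ ℤ.<_) (sym G₀) L>0 ,
    λ c → trans (eval-quotient L L>0 (G (suc c)) t) (cong (λ z → frac z * eval (quotient L (G (suc c))) t) (sym G₀))
    where
    G₀ : ev (G zero) t ≡ L
    G₀ = trans (eq zero) (trans (cong (L ℤ.*_) (S₁ s)) (ℤ.*-identityʳ L))

  onCurve⇒lattice : ∀ {n} {S : ℕ → Vℤ (suc n) → Set} {t} (w : Curve (suc n)) ((u , _) : OnCurve S t w) →
    ∀ c → eval (point w c) t ≡ u (suc c) / 1
  onCurve⇒lattice {t = t} (L , G) (u , s , L>0 , eq) c = trans (cancelˡ (frac-< L>0) (begin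
      frac L * eval (quotient L (G (suc c))) t    ≡⟨ sym (eval-quotient L L>0 (G (suc c)) t) ⟩
      frac (ev (G (suc c)) t)                     ≡⟨ trans (cong frac (eq (suc c))) (frac-* L (u (suc c))) ⟩
      frac L * frac (u (suc c))                   ∎)) (sym (frac≡ (u (suc c))))
    where open ≡-Reasoning

  module _ {k n} (G : Fin k → Vℤ (suc n)) (P : Fin k → Vector ℚ n) (rep : ∀ i → Represents (G i) (P i)) where

    Hullᴿ : Pred (Point n) _
    Hullᴿ = conv (λ x → ∃[ i ] x ≋ embed (P i))

    cone⇒hull : ∀ u → u zero ≡ 1ℤ → Cone G u → ∀ w → (∀ c → w c ≡ u (suc c) / 1) → embed w ∈ Hullᴿ
    cone⇒hull u u₀ cone w w≡ =
      let l , l≥0 , Σl , eq = cone⇒mixture G P rep u u₀ cone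
      in mixture∈conv {S = λ x → ∃[ i ] x ≋ embed (P i)} P (λ i → i , λ c → ≗⇒≈ᴿ {ι (P i c)} {ι (P i c)} (λ _ → refl))
           l l≥0 Σl w (λ c → trans (eq c) (sym (w≡ c)))

    -- The real weights of `X` do not directly yield the integral coefficients of a `Cone`. An
    -- inequality, however, passes to the limit and becomes an exact statement about integers at the
    -- lattice point.
    hull⇒nonneg : ∀ h → (∀ i → 0ℤ ℤ.≤ dot h (G i)) → ∀ u → u zero ≡ 1ℤ → ∀ X → X ∈ Hullᴿ →
      X ≋ embed (λ c → u (suc c) / 1) → 0ℤ ℤ.≤ dot h u
    hull⇒nonneg h hG u u₀ X X∈ X≋ = frac-≤⁻¹ (subst (0ℚ ≤_) (sym value-u)
        (*-≥0 (<⇒≤ (frac-< (proj₁ rep-u))) (nn-const⁻¹ {A U} (nn-ext {λ j → A (coords X j) + - (A (coords X j) - A U)} {λ _ → A U}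
          (λ j → cancel (A (coords X j)) (A U))
          (nn-+ {λ j → A (coords X j)} {λ j → - (A (coords X j) - A U)} (conv-nonneg h₀ h′ {λ x → ∃[ i ] x ≋ embed (P i)} limit X X∈)
            (null⇒nn {λ j → - (A (coords X j) - A U)} (null-neg {λ j → A (coords X j) - A U} (affine-≋ h₀ h′ {X} {embed U} X≋))))))))
      where
      U : Vector ℚ n
      U c = u (suc c) / 1
      h₀ = frac (h zero)
      h′ = frac ∘ h ∘ suc
      A : Vector ℚ n → ℚ
      A = affine h₀ h′
      rep-u = represents-lattice u u₀
      value-u : frac (dot h u) ≡ frac (u zero) * A U
      value-u = frac-dot h u {U} rep-u
      cancel : ∀ a b → a + - (a - b) ≡ b
      cancel = solve-∀ ringℚ
      limit : ∀ Y → (∃[ i ] Y ≋ embed (P i)) → ∃[ η ] 0ℚ ≤ η × Null (λ j → A (coords Y j) - η)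
      limit Y (i , Y≋) = A (P i) ,
        *-≥0⁻¹ (frac-< (proj₁ (rep i))) (subst (0ℚ ≤_) (frac-dot h (G i) {P i} (rep i)) (frac-≤ (hG i))) ,
        affine-≋ h₀ h′ {Y} {embed (P i)} Y≋

  homogeneous : ∀ {n} → Vector ℤ n → Vℤ (suc n)
  homogeneous u zero    = 1ℤ
  homogeneous u (suc c) = u c

  LatticeCone : ∀ {k n} → (Fin k → Row (suc n)) → ℕ → Vℤ (suc n) → Set
  LatticeCone G t u = u zero ≡ 1ℤ × Cone (λ i → evs (G i) t) u

  module _ {k n} (v : Vector (Vector ℚ⟨t⟩ n) k) {t : ℕ} (def : AllDefinedAt t v) (G : Fin k → Row (suc n))
    (rep : ∀ i → Represents (evs (G i) t) (λ c → value t (v i c) (def i c)))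
    (rows : List (Row (suc n))) (hrepG : HRep G rows t)
    (ws : List (Curve (suc n))) (vertices : VerticesAt (LatticeCone G) ws t) where
    private
      W : Fin (length ws) → Vector ℚ n
      W j c = eval (point (lookup ws j) c) t

      P : Fin k → Vector ℚ n
      P i c = value t (v i c) (def i c)

      rep-W : ∀ j → Represents (at t (lookup ws j)) (W j)
      rep-W j = onCurve⇒represents {S = LatticeCone G} (lookup ws j) proj₁ (proj₁ vertices j)

      W∈ : ∀ j → embed (W j) ∈ (R v t def ∩ Lattice n)
      W∈ j = cone⇒hull (λ i → evs (G i) t) P rep u u₀ cone (W j) W≡ ,
          u ∘ suc , λ c → ≗⇒≈ᴿ {ι (W j c)} {ι (u (suc c) / 1)} (λ _ → W≡ c)
        where
        u = proj₁ (proj₁ vertices j)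
        u₀ = proj₁ (proj₁ (proj₂ (proj₁ vertices j)))
        cone = proj₂ (proj₁ (proj₂ (proj₁ vertices j)))
        W≡ : ∀ c → W j c ≡ u (suc c) / 1
        W≡ = onCurve⇒lattice {S = LatticeCone G} (lookup ws j) (proj₁ vertices j)

      mixture : ∀ X → X ∈ (R v t def ∩ Lattice n) → Mixture W X
      mixture X (X∈R , u , X≋) =
        let l , l≥0 , Σl , eq = cone⇒mixture (λ j → at t (lookup ws j)) W rep-W û refl (proj₁ (proj₂ vertices) û (refl , cone))
        in l , l≥0 , Σl , λ c → ≈ᴿ-trans {X c} {ι (u c / 1)} {ι (sumℚ (λ j → l j * W j c))} (X≋ c)
             (≗⇒≈ᴿ {ι (u c / 1)} {ι (sumℚ (λ j → l j * W j c))} (λ _ → sym (eq c)))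
        where
        û : Vℤ (suc n)
        û = homogeneous u
        cone : Cone (λ i → evs (G i) t) û
        -- Each row is nonnegative on the generators and hence at `û`; completeness of the rows then
        -- supplies integral coefficients.
        cone = proj₂ hrepG û (All.map (λ {r} r≥0 → hull⇒nonneg (λ i → evs (G i) t) P rep (evs r t) r≥0 û refl X X∈R X≋) (proj₁ hrepG))

      separate : ∀ j → Σ[ h₀ ∈ ℚ ] Σ[ h ∈ Vector ℚ n ] affine h₀ h (W j) < 0ℚ × (∀ i → i ≢ j → 0ℚ ≤ affine h₀ h (W i))
      separate j = h₀ , h′ , strict , λ i i≢j →
          *-≥0⁻¹ (frac-< (proj₁ (rep-W i))) (subst (0ℚ ≤_) (frac-dot h (at t (lookup ws i)) {W i} (rep-W i)) (frac-≤ (others i i≢j)))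
        where
        h = proj₁ (proj₂ (proj₂ vertices) j)
        below = proj₁ (proj₂ (proj₂ (proj₂ vertices) j))
        others = proj₂ (proj₂ (proj₂ (proj₂ vertices) j))
        h₀ = frac (h zero)
        h′ = frac ∘ h ∘ suc
        g = frac (at t (lookup ws j) zero)
        strict : affine h₀ h′ (W j) < 0ℚ
        strict = diffℚ-< (*->0⁻¹ {g} {0ℚ - affine h₀ h′ (W j)} (frac-< (proj₁ (rep-W j))) (subst (0ℚ <_) eq (frac-< below)))
          where
          arrange : ∀ g a → - (g * a) ≡ g * (0ℚ - a)
          arrange = solve-∀ ringℚ
          eq : frac (ℤ.- dot h (at t (lookup ws j))) ≡ g * (0ℚ - affine h₀ h′ (W j))
          eq = trans (frac-neg (dot h (at t (lookup ws j)))) (trans (cong -_ (frac-dot h (at t (lookup ws j)) {W j} (rep-W j)))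
            (arrange g (affine h₀ h′ (W j))))

    vertices-of-hull : HasVertices (conv (R v t def ∩ Lattice n)) (λ j → evalPoint (point (lookup ws j)) t)
    vertices-of-hull = hasVertices (R v t def ∩ Lattice n) W W∈ mixture separate

-- Assembly of the vertex polynomials on each residue class.

open import Defs
open import Data.Nat using (ℕ; NonZero; _≤_; _<_; _%_)
open import Data.Fin using (Fin; toℕ)
open import Data.Product using (Σ-syntax; ∃-syntax)
open import Data.Vec.Functional using (Vector)
open import Relation.Binary.PropositionalEquality using (_≡_)
open import Relation.Unary using (_∩_)

open import Data.List using (length; lookup)
open import Data.Nat using (suc; _⊔_)
open import Data.Nat.Properties using (≤-trans; m≤m⊔n; m≤n⊔m)
open import Data.Product using (_,_; proj₁; proj₂)
open IntegersAndPolynomials using (_∧ᴱ_; allFinᴱ)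
open ConeDescription using (Row; hrep)
open Digits using (polytope-hull)
open Pruning using (hull-vertices)
open RationalData using (module Homogenized; homogenize)
open Families using (point; vertices-of-hull)

theorem5p2 : ∀ (k n : ℕ) (v : Vector (Vector ℚ⟨t⟩ n) k) →
    Σ[ d ∈ ℕ ] Σ[ d≢0 ∈ NonZero d ]
    ∀ (r : Fin d) →
    Σ[ z ∈ ℕ ] Σ[ w ∈ Vector (Vector ℚ[t] n) z ]
    Σ[ T ∈ ℕ ] ∀ (t : ℕ) → 0 < t → T ≤ t → _%_ t d {{d≢0}} ≡ toℕ r →
    Σ[ def ∈ AllDefinedAt t v ]
    HasVertices (conv (R v t def ∩ Lattice n)) (λ j → evalPoint (w j) t)
theorem5p2 k n v =
  let d , curves = hull-vertices (polytope-hull G (allFinᴱ H.row>0)) in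
  suc d , _ , λ r →
    let ws , T₁ , vertices = curves (toℕ r)
        -- The vertex data hold from `T₁` on within the residue class. The inequalities, the
        -- definedness of all `v i` and their homogeneous form hold at every `t` from `T₂` on.
        T₂ , at-large = (proj₂ (hrep G) ∧ᴱ allFinᴱ H.row>0) ∧ᴱ (allFinᴱ H.defined ∧ᴱ allFinᴱ H.value≡)
    in length ws , (λ j → point (lookup ws j)) , T₁ ⊔ T₂ , λ t _ T≤t t%d →
       let (hrepG , G>0) , (def , values) = at-large t (≤-trans (m≤n⊔m T₁ T₂) T≤t)
       in def , vertices-of-hull v def G (λ i → G>0 i , λ c → values i c (def i c)) (proj₁ (hrep G)) hrepG
            ws (vertices t (≤-trans (m≤m⊔n T₁ T₂) T≤t) t%d)
  where
  module H i = Homogenized (homogenize (v i))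
  G : Fin k → Row (suc n)
  G i = H.row i
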